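{- For the online pairwise spanner problem in which the edge lengths are quasimetric, there is a randomized polynomial-time online algorithm with competitive ratio $\tilde{O}(n^{2/3})$.
   Context: Online pairwise spanner problem: a directed simple graph $G=(V,E)$ with $n=|V|$ vertices and edge lengths $\ell:E\to\mathbb{R}_{\ge 0}$ is known in advance. Terminal pairs $(s_i,t_i)\in V\times V$ together with target distances $d_i$ (with $d_G(s_i,t_i)\le d_i$) arrive one at a time in rounds $i=1,2,\dots,k$, where $k$ is not known in advance. The algorithm maintains an edge set $E'\subseteq E$, initially empty; in round $i$ it must irrevocably add edges of $E$ to $E'$ so that in $H=(V,E')$ the length of a shortest $s_i\leadsto t_i$ path is at most $d_i$ (edges are never removed). The cost is $|E'|$. $\mathsf{OPT}$ denotes the minimum $|F|$ over $F\subseteq E$ such that $(V,F)$ satisfies the distance requirements of all arrived pairs. An algorithm has competitive ratio $c$ if at all times its cost is at most $c\cdot\mathsf{OPT}$ (for randomized algorithms: the maintained solution is feasible and has cost at most $c\cdot\mathsf{OPT}$ with high probability). $\tilde{O}(\cdot)$ hides factors polylogarithmic in $n$. Polynomial time means polynomial in the input size per round. The edge lengths are quasimetric if for any two edges $u\to v$ and $v\to w$ in $E$ there is also an edge $u\to w$ in $E$ with $\ell(u,w)\le \ell(u,v)+\ell(v,w)$.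
   Formalization: Edge lengths and target distances are rational numbers (given in binary) rather than arbitrary nonnegative reals. -}

module Defs where

open import Data.Bool.Base using (Bool; true; false)
open import Data.Fin.Base using (Fin; zero; suc; toℕ; combine; remQuot)
open import Data.Fin.Subset using (Subset; ⊥; ⁅_⁆; _∈_; _⊆_; _∪_; ⋃; ∣_∣)
open import Data.Integer.Base using (ℤ; +_; -[1+_])
open import Data.List.Base as List using (List; []; _∷_; drop; length; sum)
open import Data.List.Membership.Propositional using () renaming (_∉_ to _∉ˡ_)
open import Data.List.Relation.Unary.All using (All)
open import Data.Maybe.Base as Maybe using (Maybe; just; nothing; is-just)
open import Data.Nat.Base as ℕ using (ℕ; suc)
open import Data.Nat.Binary.Base as ℕᵇ using (ℕᵇ; 2[1+_]; 1+[2_])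
open import Data.Nat.Logarithm using (⌈log₂_⌉)
open import Data.Product.Base using (_×_; _,_; uncurry; Σ-syntax; ∃-syntax)
open import Data.Rational.Base as ℚ using (ℚ; 0ℚ; ↥_; ↧_)
open import Data.Vec.Base as Vec using (Vec; lookup; replicate; tabulate; _[_]≔_)
open import Relation.Binary.PropositionalEquality.Core using (_≡_; _≢_)

private
  variable
    n k : ℕ

------------------------------------------------------------------------
-- Pairwise spanners

-- Lengths are rational: running time is measured against the bit size of
-- the input, so the numbers occurring in it have to be finite objects.
-- `len u v ≡ nothing` means that u → v is not an edge.
record Graph (n : ℕ) : Set where
  field
    len      : Fin n → Fin n → Maybe ℚ
    loopless : ∀ v → len v v ≡ nothing
    nonneg   : ∀ {u v l} → len u v ≡ just l → 0ℚ ℚ.≤ l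

open Graph public

-- A set of ordered pairs of vertices; (u , v) has index `combine u v`.
EdgeSet : ℕ → Set
EdgeSet n = Subset (n ℕ.* n)

E : Graph n → EdgeSet n
E {n} G = tabulate λ e → is-just (uncurry (len G) (remQuot {n} n e))

-- The condition is for distinct endpoints u and w only: an edge u → u
-- would be a loop.
Quasimetric : Graph n → Set
Quasimetric G = ∀ {u v w l₁ l₂} → u ≢ w →
  len G u v ≡ just l₁ → len G v w ≡ just l₂ →
  ∃[ l ] len G u w ≡ just l × l ℚ.≤ l₁ ℚ.+ l₂

data Path (G : Graph n) (F : EdgeSet n) : Fin n → Fin n → ℚ → Set where
  []   : ∀ {v} → Path G F v v 0ℚ
  cons : ∀ {u v w l L} → combine u v ∈ F → len G u v ≡ just l →
         Path G F v w L → Path G F u w (l ℚ.+ L)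

record Request (n : ℕ) : Set where
  constructor request
  field
    source sink : Fin n
    target      : ℚ

-- The distance from the source to the sink in (V , F) is at most the target.
Satisfies : Graph n → EdgeSet n → Request n → Set
Satisfies G F (request s t d) = ∃[ L ] Path G F s t L × L ℚ.≤ d

Admissible : Graph n → Request n → Set
Admissible G = Satisfies G (E G)

-- Lists of requests are histories: the most recent request comes first.
History : ℕ → Set
History n = List (Request n)

Feasible : Graph n → History n → EdgeSet n → Set
Feasible G rs F = F ⊆ E G × All (Satisfies G F) rs

IsOPT : Graph n → History n → ℕ → Set
IsOPT {n} G rs opt =
  (Σ[ F ∈ EdgeSet n ] Feasible G rs F × ∣ F ∣ ≡ opt) ×
  (∀ F → Feasible G rs F → opt ℕ.≤ ∣ F ∣)

------------------------------------------------------------------------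
-- Model of computation: Jones' WHILE language over binary trees, extended
-- by fair coin flips.  With the unit cost measure below it is equivalent to
-- Turing machines up to a polynomial.

infixr 6 _∙_
data Tree : Set where
  nil : Tree
  _∙_ : Tree → Tree → Tree

size : Tree → ℕ
size nil     = 1
size (s ∙ t) = suc (size s ℕ.+ size t)

data Exp (k : ℕ) : Set where
  var  : Fin k → Exp k
  nil  : Exp k
  cons : Exp k → Exp k → Exp k
  hd   : Exp k → Exp k
  tl   : Exp k → Exp k

infix  5 _≔_
infixr 4 _⨾_
data Cmd (k : ℕ) : Set where
  _≔_   : Fin k → Exp k → Cmd k
  flip  : Fin k → Cmd k
  _⨾_   : Cmd k → Cmd k → Cmd k
  cond  : Exp k → Cmd k → Cmd k → Cmd k
  while : Exp k → Cmd k → Cmd k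

Store : ℕ → Set
Store k = Vec Tree k

head tail : Tree → Tree
head nil     = nil
head (s ∙ t) = s
tail nil     = nil
tail (s ∙ t) = t

eval : Exp k → Store k → Tree
eval (var x)    σ = lookup σ x
eval nil        σ = nil
eval (cons e f) σ = eval e σ ∙ eval f σ
eval (hd e)     σ = head (eval e σ)
eval (tl e)     σ = tail (eval e σ)

cost : Exp k → ℕ
cost (var x)    = 1
cost nil        = 1
cost (cons e f) = suc (cost e ℕ.+ cost f)
cost (hd e)     = suc (cost e)
cost (tl e)     = suc (cost e)

-- nil is false, every other tree is true.
bit : Bool → Tree
bit false = nil
bit true  = nil ∙ nil

Coins : Set
Coins = ℕ → Bool

-- A store together with the number of coins flipped so far.
State : ℕ → Set
State k = Store k × ℕ

-- Run ρ c s s′ t: with coins ρ, command c started in state s halts in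
-- state s′ after time t.
data Run (ρ : Coins) {k : ℕ} : Cmd k → State k → State k → ℕ → Set where
  assign : ∀ {x e σ i} →
    Run ρ (x ≔ e) (σ , i) (σ [ x ]≔ eval e σ , i) (suc (cost e))
  toss : ∀ {x σ i} →
    Run ρ (flip x) (σ , i) (σ [ x ]≔ bit (ρ i) , suc i) 1
  seq : ∀ {c d s s′ s″ t u} →
    Run ρ c s s′ t → Run ρ d s′ s″ u → Run ρ (c ⨾ d) s s″ (t ℕ.+ u)
  cond-true : ∀ {e c d σ i s′ a b t} → eval e σ ≡ a ∙ b →
    Run ρ c (σ , i) s′ t → Run ρ (cond e c d) (σ , i) s′ (suc (cost e ℕ.+ t))
  cond-false : ∀ {e c d σ i s′ t} → eval e σ ≡ nil →
    Run ρ d (σ , i) s′ t → Run ρ (cond e c d) (σ , i) s′ (suc (cost e ℕ.+ t))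
  while-true : ∀ {e c σ i s′ s″ a b t u} → eval e σ ≡ a ∙ b →
    Run ρ c (σ , i) s′ t → Run ρ (while e c) s′ s″ u →
    Run ρ (while e c) (σ , i) s″ (suc (cost e ℕ.+ (t ℕ.+ u)))
  while-false : ∀ {e c σ i} → eval e σ ≡ nil →
    Run ρ (while e c) (σ , i) (σ , i) (suc (cost e))

------------------------------------------------------------------------
-- Encodings; numbers are written in (bijective) binary.

encodeℕᵇ : ℕᵇ → Tree
encodeℕᵇ ℕᵇ.zero  = nil
encodeℕᵇ 2[1+ x ] = bit false ∙ encodeℕᵇ x
encodeℕᵇ 1+[2 x ] = bit true ∙ encodeℕᵇ x

encodeℕ : ℕ → Tree
encodeℕ m = encodeℕᵇ (ℕᵇ.fromℕ m)

encodeℤ : ℤ → Tree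
encodeℤ (+ m)    = bit false ∙ encodeℕ m
encodeℤ -[1+ m ] = bit true ∙ encodeℕ m

encodeℚ : ℚ → Tree
encodeℚ q = encodeℤ (↥ q) ∙ encodeℤ (↧ q)

encodeFin : Fin n → Tree
encodeFin v = encodeℕ (toℕ v)

encodeList : {A : Set} → (A → Tree) → List A → Tree
encodeList enc = List.foldr (λ a t → enc a ∙ t) nil

-- The n × n matrix of edge lengths, with nil for a missing edge.
encodeGraph : Graph n → Tree
encodeGraph {n} G = encodeList row (List.allFin n)
  where
  row : Fin n → Tree
  row u = encodeList (λ v → Maybe.maybe′ encodeℚ nil (len G u v)) (List.allFin n)

encodeRequest : Request n → Tree
encodeRequest (request s t d) = encodeFin s ∙ encodeFin t ∙ encodeℚ d

encodeEdges : List (Fin n × Fin n) → Tree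
encodeEdges = encodeList λ (u , v) → encodeFin u ∙ encodeFin v

edgeSet : List (Fin n × Fin n) → EdgeSet n
edgeSet es = ⋃ (List.map (λ (u , v) → ⁅ combine u v ⁆) es)

inputSize : Graph n → History n → ℕ
inputSize G rs = size (encodeGraph G) ℕ.+ sum (List.map (λ r → size (encodeRequest r)) rs)

------------------------------------------------------------------------
-- Randomized online algorithms

-- `prepare` runs once, on the graph, before the first request; `step` runs
-- in every round, on the new request.  All registers persist between rounds.
record OnlineAlgorithm : Set where
  field
    extra   : ℕ
    prepare : Cmd (2 ℕ.+ extra)
    step    : Cmd (2 ℕ.+ extra)

  input output : Fin (2 ℕ.+ extra)
  input  = zero
  output = suc zero

  Memory : Set
  Memory = State (2 ℕ.+ extra)

  -- Preparation G ρ s t and Round G ρ s r es s′ t: the memory afterwards is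
  -- s and s′ respectively, the time taken is t.
  Preparation : Graph n → Coins → Memory → ℕ → Set
  Preparation G ρ s t =
    Run ρ prepare (replicate _ nil [ input ]≔ encodeGraph G , 0) s t

  -- es lists the edges that the algorithm adds in response to r.
  record Round (G : Graph n) (ρ : Coins) (s : Memory) (r : Request n)
               (es : List (Fin n × Fin n)) (s′ : Memory) (t : ℕ) : Set where
    field
      run     : let (σ , i) = s in
                Run ρ step (σ [ input ]≔ encodeRequest r , i) s′ t
      outputs : let (σ′ , _) = s′ in lookup σ′ output ≡ encodeEdges es
      edges   : edgeSet es ⊆ E G

  -- Execution G ρ rs s E′: after the rounds in rs the memory is s and the
  -- maintained edge set is E′.
  data Execution (G : Graph n) (ρ : Coins) : History n → Memory → EdgeSet n → Set where
    start : ∀ {s t} → Preparation G ρ s t → Execution G ρ [] s ⊥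
    round : ∀ {rs s E′ r es s′ t} → Execution G ρ rs s E′ →
            Round G ρ s r es s′ t → Execution G ρ (r ∷ rs) s′ (E′ ∪ edgeSet es)

open OnlineAlgorithm using (Preparation; Round; Execution)

PolynomialTime : OnlineAlgorithm → Set
PolynomialTime A = ∃[ c ] ∃[ e ]
  let bound = λ N → c ℕ.* N ℕ.^ e ℕ.+ c in
  ∀ {n} (G : Graph n) → Quasimetric G → (ρ : Coins) →
  (∃[ s ] ∃[ t ] Preparation A G ρ s t × t ℕ.≤ bound (inputSize G [])) ×
  (∀ rs r → All (Admissible G) (r ∷ rs) → ∀ {s E′} → Execution A G ρ rs s E′ →
   ∃[ es ] ∃[ s′ ] ∃[ t ] Round A G ρ s r es s′ t × t ℕ.≤ bound (inputSize G (r ∷ rs)))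

-- Pr[ Event ] ≥ 1 - 1 / n ^ a for independent fair coins: outside of a set
-- of at most 2 ^ m / n ^ a outcomes of the first m coins, Event holds.
-- (An inner measure, as Event need not be decidable.)
HighProbability : (a n : ℕ) → (Coins → Set) → Set
HighProbability a n Event = ∃[ m ] Σ[ bad ∈ List (Vec Bool m) ]
  length bad ℕ.* n ℕ.^ a ℕ.≤ 2 ℕ.^ m ×
  (∀ ρ → tabulate (λ (i : Fin m) → ρ (toℕ i)) ∉ˡ bad → Event ρ)

-- x ≤ C · (1 + ⌈log₂ n⌉) ^ b · n ^ (2/3) · opt, raised to the third power.
Within : (C b n : ℕ) → (x opt : ℕ) → Set
Within C b n x opt =
  x ℕ.^ 3 ℕ.≤ (C ℕ.* (1 ℕ.+ ⌈log₂ n ⌉) ℕ.^ b ℕ.* opt) ℕ.^ 3 ℕ.* n ℕ.^ 2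

-- Competitive ratio Õ(n^{2/3}), with failure probability at most 1 / n ^ a.
-- The requests are fixed before the coins are flipped; `drop j rs` is the
-- history before the last j rounds, so that the event is about all times.
Competitive : (a : ℕ) → OnlineAlgorithm → Set
Competitive a A = ∃[ C ] ∃[ b ]
  ∀ {n} (G : Graph n) → Quasimetric G → ∀ rs → All (Admissible G) rs →
  HighProbability a n λ ρ →
    ∀ j {s E′} → Execution A G ρ (drop j rs) s E′ →
    Feasible G (drop j rs) E′ ×
    (∀ opt → IsOPT G (drop j rs) opt → Within C b n ∣ E′ ∣ opt)

{-# OPTIONS --safe #-}

-- The algorithm is deterministic.  In a quasimetric graph every vertex v on an
-- admissible walk from s to t is the middle of an admissible walk s → v → t; let
-- M be the set of these v.  Call the request thin if |M|³ ≤ n.  A greedy hitting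
-- set of the sets M of all potential thick requests has Õ(n^{2/3}) elements, the
-- hubs.  A request buys all edges from s to the hubs and from the hubs to t; as s
-- and t are endpoints of edges of OPT, this costs Õ(n^{2/3}) · OPT in total, and
-- it satisfies every thick request.  If the edges bought so far do not satisfy
-- the request, it is thin and all edges within M ∪ {s , t} are bought.  These are
-- O(n^{2/3}) many, and among them is an edge of OPT that had not been bought
-- before: otherwise OPT's path from s to t would have been available.

module Submission where

open import Defs
open import Algebra.Properties.CommutativeSemigroup using (interchange)
open import Data.Bool.Base using (Bool; true; false; if_then_else_; not; _∧_; _∨_; T)
open import Data.Bool.ListAction using (any)
open import Data.Bool.Properties using (T?; T-∧; T-∨; T-≡)
open import Data.Empty using (⊥; ⊥-elim)
open import Data.Fin.Base as Fin using (Fin; toℕ; combine; remQuot)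
import Data.Fin.Properties as Fin
import Data.Fin.Subset as Subset
import Data.Fin.Subset.Properties as Subset
open import Data.Integer.Base as ℤ using (ℤ; -[1+_]) renaming (+_ to pos)
import Data.Integer.Properties as ℤ
open import Data.List.Base as List using
  ( List; []; _∷_; [_]; _++_; foldl; foldr; map; length; reverse; filterᵇ; concat; concatMap
  ; cartesianProduct; uncons; tabulate; allFin)
open import Data.List.Membership.Propositional using (_∈_; find; lose)
open import Data.List.Membership.Propositional.Properties using
  ( ∈-map⁺; ∈-map⁻; ∈-concatMap⁺; ∈-concatMap⁻; ∈-tabulate⁺; ∈-tabulate⁻; ∈-filter⁺; ∈-filter⁻
  ; ∈-concat⁺′; ∈-concat⁻′; ∈-++⁺ˡ; ∈-++⁺ʳ; ∈-++⁻; ∈-cartesianProduct⁺; ∈-∃++)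
import Data.List.Properties as List
open import Data.List.Relation.Unary.All as All using (All; []; _∷_)
import Data.List.Relation.Unary.All.Properties as All
open import Data.List.Relation.Unary.AllPairs using (AllPairs; []; _∷_)
import Data.List.Relation.Unary.AllPairs.Properties as AllPairs
open import Data.List.Relation.Unary.Any as Any using (here; there)
import Data.List.Relation.Unary.Any.Properties as Any
open import Data.Maybe.Base as Maybe using (Maybe; just; nothing; maybe′; is-just)
open import Data.Nat.Base
open import Data.Nat.Binary.Base as ℕᵇ using (ℕᵇ; 2[1+_]; 1+[2_])
import Data.Nat.Binary.Properties as ℕᵇ
open import Data.Nat.Induction using (<-wellFounded)
open import Data.Nat.ListAction using (product; sum)
import Data.Nat.ListAction.Properties as ListAction
open import Data.Nat.Logarithm using (⌈log₂_⌉)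
open import Data.Nat.Logarithm.Core using (⌈log2⌉)
open import Data.Nat.Properties
open import Data.Nat.Tactic.RingSolver using (solve-∀)
open import Data.Product.Base using (_×_; _,_; proj₁; proj₂; ∃-syntax; Σ-syntax)
open import Data.Rational.Base as ℚ using (ℚ; 0ℚ; ↥_; ↧_; mkℚ)
import Data.Rational.Properties as ℚ
open import Data.Rational.Unnormalised.Base as ℚᵘ using (mkℚᵘ; *≡*; *≤*)
import Data.Rational.Unnormalised.Properties as ℚᵘ
open import Data.Sum.Base using (_⊎_; inj₁; inj₂; [_,_]′)
open import Data.Unit.Base using (⊤; tt)
open import Data.Vec.Base as Vec using ([]; _∷_; lookup; _[_]≔_)
import Data.Vec.Properties as Vec
open import Function.Base using (_∘_; id)
open import Function.Bundles using (Equivalence)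
open import Induction.WellFounded using (Acc) renaming (acc to accessible)
open import Relation.Binary.PropositionalEquality hiding ([_])
open import Relation.Nullary using (¬_; Dec; yes; no)

open Equivalence using (to; from)

-- Targets are arbitrary rationals, but for fixed `s` and `t` the set M grows with the target only
-- at lengths of paths of two edges. So the potential requests can be listed before the first round:
-- at most n^4 of them, whose logarithm is all that the number of hubs feels. The threshold n^(1/3)
-- balances two costs. A thin set spans O(n^(2/3)) edges, paid for by one new edge of OPT; sets of
-- more than n^(1/3) of the n vertices are hit by O(n^(2/3) log n) hubs. Cliques are charged once
-- per edge of OPT, hub edges once per end of an edge of OPT, so the number of requests does not
-- enter.
--
-- The other obstacle is the machine model. The algorithm is assembled from combinators that carry a
-- program together with polynomial bounds on its time and on the size of its result. The latter
-- must be tracked everywhere, since a loop may double its state in every round. Lengths become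
-- naturals over the product of all denominators, so that the program only adds, multiplies and
-- compares, and cube roots appear in the analysis alone.

private
  variable
    n : ℕ

-- Polynomial bounds

infixl 6 _⊞_
infixl 7 _⊠_

-- Kept as syntax: every value is then monotone and dominated by a monomial, which an arbitrary
-- function on ℕ need not be.
data Poly : Set where
  con     : ℕ → Poly
  𝕏       : Poly
  _⊞_ _⊠_ : Poly → Poly → Poly

⟦_⟧ₚ : Poly → ℕ → ℕ
⟦ con k ⟧ₚ N = k
⟦ 𝕏 ⟧ₚ     N = N
⟦ p ⊞ q ⟧ₚ N = ⟦ p ⟧ₚ N + ⟦ q ⟧ₚ N
⟦ p ⊠ q ⟧ₚ N = ⟦ p ⟧ₚ N * ⟦ q ⟧ₚ N

poly-mono : ∀ p {M N} → M ≤ N → ⟦ p ⟧ₚ M ≤ ⟦ p ⟧ₚ N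
poly-mono (con k) M≤N = ≤-refl
poly-mono 𝕏       M≤N = M≤N
poly-mono (p ⊞ q) M≤N = +-mono-≤ (poly-mono p M≤N) (poly-mono q M≤N)
poly-mono (p ⊠ q) M≤N = *-mono-≤ (poly-mono p M≤N) (poly-mono q M≤N)

infixr 9 _⊚_
_⊚_ : Poly → Poly → Poly
con k   ⊚ r = con k
𝕏       ⊚ r = r
(p ⊞ q) ⊚ r = (p ⊚ r) ⊞ (q ⊚ r)
(p ⊠ q) ⊚ r = (p ⊚ r) ⊠ (q ⊚ r)

poly-∘ : ∀ p r N → ⟦ p ⊚ r ⟧ₚ N ≡ ⟦ p ⟧ₚ (⟦ r ⟧ₚ N)
poly-∘ (con k) r N = refl
poly-∘ 𝕏       r N = refl
poly-∘ (p ⊞ q) r N = cong₂ _+_ (poly-∘ p r N) (poly-∘ q r N)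
poly-∘ (p ⊠ q) r N = cong₂ _*_ (poly-∘ p r N) (poly-∘ q r N)

poly-≤-∘ : ∀ p r {M N} → M ≤ ⟦ r ⟧ₚ N → ⟦ p ⟧ₚ M ≤ ⟦ p ⊚ r ⟧ₚ N
poly-≤-∘ p r {M} {N} le = ≤-trans (poly-mono p le) (≤-reflexive (sym (poly-∘ p r N)))

private
  -- The base `suc N` is positive, so powers grow with the exponent and both summands of `p ⊞ q` can
  -- be raised to the exponent e + f.
  poly-≤-power : ∀ p → ∃[ c ] ∃[ e ] ∀ N → ⟦ p ⟧ₚ N ≤ c * suc N ^ e
  poly-≤-power (con k) = k , 0 , λ N → ≤-reflexive (sym (*-identityʳ k))
  poly-≤-power 𝕏 = 1 , 1 , λ N → ≤-trans (n≤1+n N) (≤-reflexive (sym (trans (*-identityˡ _) (*-identityʳ _))))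
  poly-≤-power (p ⊞ q) with poly-≤-power p | poly-≤-power q
  ... | c , e , P | d , f , Q = c + d , e + f , λ N → begin
    ⟦ p ⟧ₚ N + ⟦ q ⟧ₚ N  ≤⟨ +-mono-≤ (P N) (Q N) ⟩
    c * suc N ^ e + d * suc N ^ f  ≤⟨ +-mono-≤ (*-monoʳ-≤ c (^-monoʳ-≤ (suc N) (m≤m+n e f)))
                                                          (*-monoʳ-≤ d (^-monoʳ-≤ (suc N) (m≤n+m f e))) ⟩
    c * suc N ^ (e + f) + d * suc N ^ (e + f) ≡⟨ *-distribʳ-+ (suc N ^ (e + f)) c d ⟨
    (c + d) * suc N ^ (e + f)  ∎
    where open ≤-Reasoning
  poly-≤-power (p ⊠ q) with poly-≤-power p | poly-≤-power q
  ... | c , e , P | d , f , Q = c * d , e + f , λ N → begin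
    ⟦ p ⟧ₚ N * ⟦ q ⟧ₚ N  ≤⟨ *-mono-≤ (P N) (Q N) ⟩
    c * suc N ^ e * (d * suc N ^ f)  ≡⟨ interchange *-commutativeSemigroup c (suc N ^ e) d (suc N ^ f) ⟩
    c * d * (suc N ^ e * suc N ^ f)  ≡⟨ cong (c * d *_) (^-distribˡ-+-* (suc N) e f) ⟨
    c * d * suc N ^ (e + f)  ∎
    where open ≤-Reasoning

  ^-distribʳ-* : ∀ e m n → (m * n) ^ e ≡ m ^ e * n ^ e
  ^-distribʳ-* zero    m n = refl
  ^-distribʳ-* (suc e) m n =
    trans (cong (m * n *_) (^-distribʳ-* e m n)) (interchange *-commutativeSemigroup m n (m ^ e) (n ^ e))

-- For N ≥ 1, suc N ≤ 2 * N, and the factor 2^e moves into the constant; at N = 0 the additive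
-- constant takes over.
poly-≤-monomial : ∀ p → ∃[ c ] ∃[ e ] ∀ N → ⟦ p ⟧ₚ N ≤ c * N ^ e + c
poly-≤-monomial p with poly-≤-power p
... | c , e , P = c * 2 ^ e , e , bound
  where
  open ≤-Reasoning
  bound : ∀ N → ⟦ p ⟧ₚ N ≤ c * 2 ^ e * N ^ e + c * 2 ^ e
  bound zero = begin
    ⟦ p ⟧ₚ 0  ≤⟨ P 0 ⟩
    c * 1 ^ e  ≤⟨ *-monoʳ-≤ c (^-monoˡ-≤ e (s≤s z≤n)) ⟩
    c * 2 ^ e  ≤⟨ m≤n+m _ _ ⟩
    c * 2 ^ e * 0 ^ e + c * 2 ^ e  ∎
  bound N@(suc N-1) = begin
    ⟦ p ⟧ₚ N  ≤⟨ P N ⟩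
    c * suc N ^ e  ≤⟨ *-monoʳ-≤ c (^-monoˡ-≤ e (+-mono-≤ (s≤s z≤n) (m≤m+n N 0))) ⟩
    c * (2 * N) ^ e  ≡⟨ cong (c *_) (^-distribʳ-* e 2 N) ⟩
    c * (2 ^ e * N ^ e)  ≡⟨ *-assoc c _ _ ⟨
    c * 2 ^ e * N ^ e  ≤⟨ m≤m+n _ _ ⟩
    c * 2 ^ e * N ^ e + c * 2 ^ e  ∎

-- A combinator language compiled to WHILE programs

-- Encoded types; `opt A B` is Maybe (A × B), whose values just (a , b) are
-- encoded like the pair itself.

infixr 5 _⊗_
data Ty : Set where
  unit bool nat : Ty
  list          : Ty → Ty
  _⊗_ opt       : Ty → Ty → Ty

⟦_⟧ : Ty → Set
⟦ unit ⟧    = ⊤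
⟦ bool ⟧    = Bool
⟦ nat ⟧     = ℕ
⟦ list A ⟧  = List ⟦ A ⟧
⟦ A ⊗ B ⟧   = ⟦ A ⟧ × ⟦ B ⟧
⟦ opt A B ⟧ = Maybe (⟦ A ⟧ × ⟦ B ⟧)

enc : ∀ A → ⟦ A ⟧ → Tree
enc unit      _              = nil
enc bool      b              = bit b
enc nat       m              = encodeℕ m
enc (list A)  as             = encodeList (enc A) as
enc (A ⊗ B)   (a , b)        = enc A a ∙ enc B b
enc (opt A B) nothing        = nil
enc (opt A B) (just (a , b)) = enc A a ∙ enc B b

∥_∥ : ∀ {A} → ⟦ A ⟧ → ℕ
∥_∥ {A} a = size (enc A a)

-- Register 0 holds the value being computed and register 2 a stack;
-- register 1, the output, is left alone.
Steps : Cmd 3 → Tree × Tree → Tree × Tree → ℕ → Set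
Steps c (x , S) (x′ , S′) T =
  ∃[ t ] t ≤ T × (∀ {ρ i y} → Run ρ c (x ∷ y ∷ S ∷ [] , i) (x′ ∷ y ∷ S′ ∷ [] , i) t)

valueᴿ outputᴿ stackᴿ : Fin 3
valueᴿ  = Fin.zero
outputᴿ = Fin.suc Fin.zero
stackᴿ  = Fin.suc (Fin.suc Fin.zero)

x s : Exp 3
x = var valueᴿ
s = var stackᴿ

infixr 4 _⨟_
_⨟_ : ∀ {c d u v w T U} → Steps c u v T → Steps d v w U → Steps (c ⨾ d) u w (T + U)
(t , t≤ , r) ⨟ (u , u≤ , q) = t + u , +-mono-≤ t≤ u≤ , seq r q

weaken : ∀ {c u v T U} → T ≤ U → Steps c u v T → Steps c u v U
weaken T≤U (t , t≤ , r) = t , ≤-trans t≤ T≤U , r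

-- The stack S is arbitrary and restored, so that programs can be nested. `bound` is what makes
-- running times compose: the second of two programs is timed on the output of the first.
record FP (Γ A : Ty) (f : ⟦ Γ ⟧ → ⟦ A ⟧) : Set where
  field
    code  : Cmd 3
    time  : Poly
    space : Poly
    run   : ∀ γ S → Steps code (enc Γ γ , S) (enc A (f γ) , S) (⟦ time ⟧ₚ (∥_∥ {Γ} γ))
    bound : ∀ γ → ∥_∥ {A} (f γ) ≤ ⟦ space ⟧ₚ (∥_∥ {Γ} γ)

open FP public

private
  variable
    Γ Δ A B C D : Ty

fp-ext : ∀ {f g} → (∀ γ → f γ ≡ g γ) → FP Γ A f → FP Γ A g
fp-ext {Γ} {A} eq F = record
  { code = code F ; time = time F ; space = space F
  ; run = λ γ S → subst (λ a → Steps (code F) (enc Γ γ , S) (enc A a , S) _) (eq γ) (run F γ S)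
  ; bound = λ γ → subst (λ a → ∥_∥ {A} a ≤ _) (eq γ) (bound F γ)
  }

-- A function that is invisible in the encoding is a mere change of type. `_∷_` on pairs, `uncons`,
-- `bits` and `_◂_` are all of this kind.
fp-retype : ∀ {f : ⟦ Γ ⟧ → ⟦ A ⟧} → (∀ γ → enc A (f γ) ≡ enc Γ γ) → FP Γ A f
fp-retype {Γ} {A} eq = record
  { code = valueᴿ ≔ x ; time = con 2 ; space = 𝕏
  ; run = λ γ S → subst (λ a → Steps (valueᴿ ≔ x) (enc Γ γ , S) (a , S) 2) (sym (eq γ)) (2 , ≤-refl , assign)
  ; bound = λ γ → ≤-reflexive (cong size (eq γ))
  }

infixr 9 _∘ᵖ_
_∘ᵖ_ : ∀ {g f} → FP B C g → FP A B f → FP A C (g ∘ f)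
G ∘ᵖ F = record
  { code = code F ⨾ code G
  ; time = time F ⊞ (time G ⊚ space F)
  ; space = space G ⊚ space F
  ; run = λ γ S → run F γ S ⨟ weaken (poly-≤-∘ (time G) (space F) (bound F γ)) (run G _ S)
  ; bound = λ γ → ≤-trans (bound G _) (poly-≤-∘ (space G) (space F) (bound F γ))
  }

idᵖ : FP Γ Γ id
idᵖ = fp-retype (λ γ → refl)

1≤size : ∀ t → 1 ≤ size t
1≤size nil     = s≤s z≤n
1≤size (s ∙ t) = s≤s z≤n

fstᵖ : ∀ {f} → FP Γ (A ⊗ B) f → FP Γ A (proj₁ ∘ f)
fstᵖ {Γ} {A} {B} F = record
  { code = valueᴿ ≔ hd x ; time = con 3 ; space = 𝕏
  ; run = λ γ S → 3 , ≤-refl , assign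
  ; bound = λ (a , b) → ≤-trans (m≤m+n _ (size (enc B b))) (n≤1+n _)
  } ∘ᵖ F

sndᵖ : ∀ {f} → FP Γ (A ⊗ B) f → FP Γ B (proj₂ ∘ f)
sndᵖ {Γ} {A} {B} F = record
  { code = valueᴿ ≔ tl x ; time = con 3 ; space = 𝕏
  ; run = λ γ S → 3 , ≤-refl , assign
  ; bound = λ (a , b) → ≤-trans (m≤n+m _ (size (enc A a))) (n≤1+n _)
  } ∘ᵖ F

push : ∀ {v S} → Steps (stackᴿ ≔ cons x s) (v , S) (v , v ∙ S) 4
push = 4 , ≤-refl , assign

second : ∀ {v u w S} → Steps (valueᴿ ≔ hd (tl s)) (v , u ∙ (w ∙ S)) (w , u ∙ (w ∙ S)) 4
second = 4 , ≤-refl , assign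

pop₂ : ∀ {v u w S} → Steps (stackᴿ ≔ tl (tl s)) (v , u ∙ (w ∙ S)) (v , S) 4
pop₂ = 4 , ≤-refl , assign

infixr 4 _,ᵖ_
-- γ is saved before f consumes it; then f γ waits on the stack above γ, which is fetched from the
-- second place for g.
_,ᵖ_ : ∀ {f g} → FP Γ A f → FP Γ B g → FP Γ (A ⊗ B) (λ γ → f γ , g γ)
F ,ᵖ G = record
  { code = (stackᴿ ≔ cons x s) ⨾ code F ⨾ (stackᴿ ≔ cons x s) ⨾ (valueᴿ ≔ hd (tl s)) ⨾
           code G ⨾ (valueᴿ ≔ cons (hd s) x) ⨾ (stackᴿ ≔ tl (tl s))
  ; time = con 4 ⊞ (time F ⊞ (con 4 ⊞ (con 4 ⊞ (time G ⊞ (con 5 ⊞ con 4)))))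
  ; space = con 1 ⊞ (space F ⊞ space G)
  ; run = λ γ S → push ⨟ run F γ _ ⨟ push ⨟ second ⨟ run G γ _ ⨟ (5 , ≤-refl , assign) ⨟ pop₂
  ; bound = λ γ → s≤s (+-mono-≤ (bound F γ) (bound G γ))
  }

constExp : Tree → Exp 3
constExp nil     = nil
constExp (s ∙ t) = cons (constExp s) (constExp t)

eval-constExp : ∀ t {σ} → eval (constExp t) σ ≡ t
eval-constExp nil     = refl
eval-constExp (s ∙ t) = cong₂ _∙_ (eval-constExp s) (eval-constExp t)

constᵖ : (a : ⟦ A ⟧) → FP Γ A (λ _ → a)
constᵖ {A} {Γ} a = record
  { code = valueᴿ ≔ constExp (enc A a)
  ; time = con (suc (cost (constExp (enc A a)))) ; space = con (∥_∥ {A} a)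
  ; run = λ γ S → _ , ≤-refl , λ {ρ} {i} {y} →
      subst (λ t → Run ρ (valueᴿ ≔ constExp (enc A a)) (enc Γ γ ∷ y ∷ S ∷ [] , i) (t ∷ y ∷ S ∷ [] , i) _)
            (eval-constExp (enc A a) {enc Γ γ ∷ y ∷ S ∷ []}) assign
  ; bound = λ γ → ≤-refl
  }

-- On conditionals the context γ is recovered from the stack, below the value tested.
ifᵖ : ∀ {c : ⟦ Γ ⟧ → Bool} {f : Bool → ⟦ Γ ⟧ → ⟦ A ⟧} →
      FP Γ bool c → (∀ b → FP Γ A (f b)) → FP Γ A (λ γ → f (c γ) γ)
ifᵖ {Γ} {A} {c} {f} C F = record
  { code = (stackᴿ ≔ cons x s) ⨾ code C ⨾ (stackᴿ ≔ cons x s) ⨾ (valueᴿ ≔ hd (tl s)) ⨾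
           cond (hd s) ((stackᴿ ≔ tl (tl s)) ⨾ code (F true))
                       ((stackᴿ ≔ tl (tl s)) ⨾ code (F false))
  ; time = con 4 ⊞ (time C ⊞ (con 4 ⊞ (con 4 ⊞ (con 3 ⊞ (con 4 ⊞ (time (F true) ⊞ time (F false)))))))
  ; space = space (F true) ⊞ space (F false)
  ; run = λ γ S → push ⨟ run C γ _ ⨟ push ⨟ second ⨟ branch γ S (c γ)
  ; bound = λ γ → bnd γ (c γ)
  }
  where
  branch : ∀ γ S b → Steps _ (enc Γ γ , bit b ∙ (enc Γ γ ∙ S)) (enc A (f b γ) , S) _
  branch γ S true with pop₂ ⨟ weaken (m≤m+n _ (⟦ time (F false) ⟧ₚ _)) (run (F true) γ S)
  ... | t , t≤ , r = 3 + t , +-monoʳ-≤ 3 t≤ , cond-true refl r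
  branch γ S false with pop₂ ⨟ weaken (m≤n+m _ (⟦ time (F true) ⟧ₚ _)) (run (F false) γ S)
  ... | t , t≤ , r = 3 + t , +-monoʳ-≤ 3 t≤ , cond-false refl r
  bnd : ∀ γ b → ∥_∥ {A} (f b γ) ≤ ⟦ space (F true) ⊞ space (F false) ⟧ₚ (∥_∥ {Γ} γ)
  bnd γ true  = ≤-trans (bound (F true) γ) (m≤m+n _ _)
  bnd γ false = ≤-trans (bound (F false) γ) (m≤n+m _ _)

maybeᵖ : ∀ {e : ⟦ Γ ⟧ → Maybe (⟦ A ⟧ × ⟦ B ⟧)} {f : ⟦ Γ ⟧ → ⟦ C ⟧} {g : (⟦ Γ ⟧ × ⟦ A ⟧) × ⟦ B ⟧ → ⟦ C ⟧} →
         FP Γ (opt A B) e → FP Γ C f → FP ((Γ ⊗ A) ⊗ B) C g →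
         FP Γ C (λ γ → maybe′ (λ ab → g ((γ , proj₁ ab) , proj₂ ab)) (f γ) (e γ))
maybeᵖ {Γ} {A} {B} {C} {e} {f} {g} E F G = record
  { code = (stackᴿ ≔ cons x s) ⨾ code E ⨾ (stackᴿ ≔ cons x s) ⨾ (valueᴿ ≔ hd (tl s)) ⨾
           cond (hd s) ((valueᴿ ≔ cons (cons x (hd (hd s))) (tl (hd s))) ⨾ (stackᴿ ≔ tl (tl s)) ⨾ code G)
                       ((stackᴿ ≔ tl (tl s)) ⨾ code F)
  ; time = con 4 ⊞ (time E ⊞ (con 4 ⊞ (con 4 ⊞ (con 3 ⊞ (con 10 ⊞ (con 4 ⊞ (time G ⊚ big ⊞ time F)))))))
  ; space = space G ⊚ big ⊞ space F
  ; run = λ γ S → push ⨟ run E γ _ ⨟ push ⨟ second ⨟ branch γ S (e γ) (bound E γ)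
  ; bound = λ γ → bnd γ (e γ) (bound E γ)
  }
  where
  -- `space E` bounds `just (a , b)`, hence a and b together; the 2 counts the nodes of the nested
  -- pair.
  big = con 2 ⊞ 𝕏 ⊞ space E
  big-≤ : ∀ γ a b → ∥_∥ {opt A B} (just (a , b)) ≤ ⟦ space E ⟧ₚ (∥_∥ {Γ} γ) →
          ∥_∥ {(Γ ⊗ A) ⊗ B} ((γ , a) , b) ≤ ⟦ big ⟧ₚ (∥_∥ {Γ} γ)
  big-≤ γ a b le = begin
    suc (suc (∥_∥ {Γ} γ + ∥_∥ {A} a) + ∥_∥ {B} b)  ≡⟨ cong (2 +_) (+-assoc (∥_∥ {Γ} γ) _ _) ⟩
    2 + ∥_∥ {Γ} γ + (∥_∥ {A} a + ∥_∥ {B} b)  ≤⟨ +-monoʳ-≤ (2 + ∥_∥ {Γ} γ) (≤-trans (n≤1+n _) le) ⟩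
    ⟦ big ⟧ₚ (∥_∥ {Γ} γ)  ∎
    where open ≤-Reasoning
  branch : ∀ γ S m → ∥_∥ {opt A B} m ≤ ⟦ space E ⟧ₚ (∥_∥ {Γ} γ) →
           Steps _ (enc Γ γ , enc (opt A B) m ∙ (enc Γ γ ∙ S))
                   (enc C (maybe′ (λ ab → g ((γ , proj₁ ab) , proj₂ ab)) (f γ) m) , S)
                   (3 + (10 + (4 + ⟦ time G ⊚ big ⊞ time F ⟧ₚ (∥_∥ {Γ} γ))))
  branch γ S nothing le with pop₂ ⨟ weaken (m≤n+m _ (⟦ time G ⊚ big ⟧ₚ (∥_∥ {Γ} γ))) (run F γ S)
  ... | t , t≤ , r = 3 + t , +-monoʳ-≤ 3 (≤-trans t≤ (m≤n+m _ 10)) , cond-false refl r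
  branch γ S (just (a , b)) le
    with (10 , ≤-refl , assign) ⨟ pop₂ ⨟
         weaken (≤-trans (poly-≤-∘ (time G) big (big-≤ γ a b le)) (m≤m+n _ (⟦ time F ⟧ₚ (∥_∥ {Γ} γ)))) (run G ((γ , a) , b) S)
  ... | t , t≤ , r = 3 + t , +-monoʳ-≤ 3 t≤ , cond-true refl r
  bnd : ∀ γ m → ∥_∥ {opt A B} m ≤ ⟦ space E ⟧ₚ (∥_∥ {Γ} γ) →
        ∥_∥ {C} (maybe′ (λ ab → g ((γ , proj₁ ab) , proj₂ ab)) (f γ) m) ≤ ⟦ space G ⊚ big ⊞ space F ⟧ₚ (∥_∥ {Γ} γ)
  bnd γ nothing le = ≤-trans (bound F γ) (m≤n+m _ _)
  bnd γ (just (a , b)) le =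
    ≤-trans (bound G _) (≤-trans (poly-≤-∘ (space G) big (big-≤ γ a b le)) (m≤m+n _ _))

module _ {zs : ⟦ Γ ⟧ → List ⟦ A ⟧} {z : ⟦ Γ ⟧ → ⟦ B ⟧} {f : (⟦ Γ ⟧ × ⟦ B ⟧) × ⟦ A ⟧ → ⟦ B ⟧}
         (XS : FP Γ (list A) zs) (Z : FP Γ B z) (F : FP ((Γ ⊗ B) ⊗ A) B f) where

  private
    big : Poly → Poly
    big R = con 2 ⊞ 𝕏 ⊞ R ⊞ space XS

    step : Cmd 3
    step = (valueᴿ ≔ cons (cons (hd (tl s)) x) (hd (hd s))) ⨾ (stackᴿ ≔ cons (tl (hd s)) (tl s)) ⨾ code F

    -- The rest of the list lies on top of the stack and is its own loop condition, as only [] is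
    -- encoded by nil. The hypothesis on prefixes covers exactly the states in which the body is
    -- run. The 20 consists of 3 for the test and 10 and 7 for the two assignments.
    loop : ∀ γ S T b as →
      (∀ pre a suf → as ≡ pre ++ a ∷ suf →
        ⟦ time F ⟧ₚ (∥_∥ {(Γ ⊗ B) ⊗ A} ((γ , foldl (λ b a → f ((γ , b) , a)) b pre) , a)) ≤ T) →
      Steps (while (hd s) step) (enc B b , enc (list A) as ∙ (enc Γ γ ∙ S))
            (enc B (foldl (λ b a → f ((γ , b) , a)) b as) , nil ∙ (enc Γ γ ∙ S))
            (∥_∥ {list A} as * (20 + T))
    loop γ S T b [] H = 3 , ≤-trans (m≤m+n 3 (17 + T)) (m≤m+n (20 + T) 0) , while-false refl
    loop γ S T b (a ∷ as) H
      with (10 , ≤-refl , assign) ⨟ (7 , ≤-refl , assign) ⨟ weaken (H [] a as refl) (run F ((γ , b) , a) _)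
         | loop γ S T (f ((γ , b) , a)) as (λ pre a′ suf eq → H (a ∷ pre) a′ suf (cong (a ∷_) eq))
    ... | t , t≤ , r | u , u≤ , q = 3 + (t + u) , le , while-true refl r q
      where
      le : 3 + (t + u) ≤ suc (∥_∥ {A} a + ∥_∥ {list A} as) * (20 + T)
      le = ≤-trans (+-monoʳ-≤ 3 (+-mono-≤ t≤ u≤))
                   (+-monoʳ-≤ (20 + T) (*-monoˡ-≤ (20 + T) (m≤n+m (∥_∥ {list A} as) (∥_∥ {A} a))))

  -- The unit cost of `cons` allows the size of the result to double in every step: the sizes
  -- of the intermediate results have to be controlled separately.
  foldᵖ : (R : Poly) →
    (∀ γ pre suf → zs γ ≡ pre ++ suf →
      ∥_∥ {B} (foldl (λ b a → f ((γ , b) , a)) (z γ) pre) ≤ ⟦ R ⟧ₚ (∥_∥ {Γ} γ)) →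
    FP Γ B (λ γ → foldl (λ b a → f ((γ , b) , a)) (z γ) (zs γ))
  foldᵖ R H = record
    { code = (stackᴿ ≔ cons x s) ⨾ code XS ⨾ (stackᴿ ≔ cons x s) ⨾ (valueᴿ ≔ hd (tl s)) ⨾
             code Z ⨾ while (hd s) step ⨾ (stackᴿ ≔ tl (tl s))
    ; time = con 4 ⊞ (time XS ⊞ (con 4 ⊞ (con 4 ⊞ (time Z ⊞ (space XS ⊠ (con 20 ⊞ time F ⊚ big R) ⊞ con 4)))))
    ; space = R
    ; run = λ γ S → push ⨟ run XS γ _ ⨟ push ⨟ second ⨟ run Z γ _ ⨟
        weaken (*-monoˡ-≤ _ (bound XS γ)) (loop γ S (⟦ time F ⊚ big R ⟧ₚ (∥_∥ {Γ} γ)) (z γ) (zs γ)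
          (λ pre a suf eq → poly-≤-∘ (time F) (big R) (sizes γ pre a suf eq))) ⨟ pop₂
    ; bound = λ γ → H γ (zs γ) [] (sym (List.++-identityʳ (zs γ)))
    }
    where
    elem-size : ∀ pre a suf → ∥_∥ {A} a ≤ ∥_∥ {list A} (pre ++ a ∷ suf)
    elem-size []        a suf = ≤-trans (m≤m+n _ _) (n≤1+n _)
    elem-size (b ∷ pre) a suf = ≤-trans (elem-size pre a suf) (≤-trans (m≤n+m _ _) (n≤1+n _))
    sizes : ∀ γ pre a suf → zs γ ≡ pre ++ a ∷ suf →
      ∥_∥ {(Γ ⊗ B) ⊗ A} ((γ , foldl (λ b a → f ((γ , b) , a)) (z γ) pre) , a) ≤ ⟦ big R ⟧ₚ (∥_∥ {Γ} γ)
    sizes γ pre a suf eq = s≤s (+-mono-≤ (s≤s (+-monoʳ-≤ _ (H γ pre (a ∷ suf) eq)))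
      (≤-trans (elem-size pre a suf) (≤-trans (≤-reflexive (cong (∥_∥ {list A}) (sym eq))) (bound XS γ))))

  -- A constant factor per round would compound. Growth is therefore measured by a quantity μ within
  -- a factor k of the size, and k is lost only once, at the end. For numbers μ comes from the
  -- number of digits, since the size of a numeral also depends on which digits it has.
  foldᵖ-measured : (μ : ⟦ B ⟧ → ℕ) (k : ℕ) (g : Poly) →
    (∀ b → ∥_∥ {B} b ≤ k * μ b) → (∀ b → μ b ≤ ∥_∥ {B} b) →
    (∀ γ b a → μ (f ((γ , b) , a)) ≤ μ b + ⟦ g ⟧ₚ (∥_∥ {Γ} γ + ∥_∥ {A} a)) →
    FP Γ B (λ γ → foldl (λ b a → f ((γ , b) , a)) (z γ) (zs γ))
  foldᵖ-measured μ k g size≤ μ≤ grow = foldᵖ R λ γ pre suf eq → begin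
    ∥_∥ {B} (fold γ (z γ) pre)  ≤⟨ size≤ _ ⟩
    k * μ (fold γ (z γ) pre)  ≤⟨ *-monoʳ-≤ k (go γ (z γ) pre _ (pre-size γ pre suf eq)) ⟩
    k * (μ (z γ) + ∥_∥ {list A} pre * _)  ≤⟨ *-monoʳ-≤ k (+-mono-≤ (≤-trans (μ≤ _) (bound Z γ))
                                                  (*-mono-≤ (pre-size γ pre suf eq) ≤-refl)) ⟩
    k * (_ + ⟦ space XS ⟧ₚ (∥_∥ {Γ} γ) * ⟦ g ⟧ₚ (∥_∥ {Γ} γ + ⟦ space XS ⟧ₚ (∥_∥ {Γ} γ)))
      ≡⟨ cong (λ w → k * (⟦ space Z ⟧ₚ (∥_∥ {Γ} γ) + ⟦ space XS ⟧ₚ (∥_∥ {Γ} γ) * w)) (poly-∘ g (𝕏 ⊞ space XS) _) ⟨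
    ⟦ R ⟧ₚ (∥_∥ {Γ} γ)  ∎
    where
    open ≤-Reasoning
    R = con k ⊠ (space Z ⊞ space XS ⊠ (g ⊚ (𝕏 ⊞ space XS)))
    fold : ∀ γ → ⟦ B ⟧ → List ⟦ A ⟧ → ⟦ B ⟧
    fold γ = foldl (λ b a → f ((γ , b) , a))
    prefix : ∀ pre suf → ∥_∥ {list A} pre ≤ ∥_∥ {list A} (pre ++ suf)
    prefix []        suf = 1≤size _
    prefix (b ∷ pre) suf = s≤s (+-monoʳ-≤ _ (prefix pre suf))
    pre-size : ∀ γ pre suf → zs γ ≡ pre ++ suf → ∥_∥ {list A} pre ≤ ⟦ space XS ⟧ₚ (∥_∥ {Γ} γ)
    pre-size γ pre suf eq = ≤-trans (prefix pre suf)
      (≤-trans (≤-reflexive (cong (∥_∥ {list A}) (sym eq))) (bound XS γ))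
    go : ∀ γ b as L → ∥_∥ {list A} as ≤ L →
      μ (fold γ b as) ≤ μ b + ∥_∥ {list A} as * ⟦ g ⟧ₚ (∥_∥ {Γ} γ + L)
    go γ b []       L le = m≤m+n _ _
    go γ b (a ∷ as) L le = begin
      μ (fold γ (f ((γ , b) , a)) as)  ≤⟨ go γ _ as L (≤-trans (≤-trans (m≤n+m _ _) (n≤1+n _)) le) ⟩
      μ (f ((γ , b) , a)) + ∥_∥ {list A} as * G  ≤⟨ +-monoˡ-≤ _ (grow γ b a) ⟩
      μ b + ⟦ g ⟧ₚ (∥_∥ {Γ} γ + ∥_∥ {A} a) + ∥_∥ {list A} as * G
        ≤⟨ +-monoˡ-≤ _ (+-monoʳ-≤ (μ b) (poly-mono g (+-monoʳ-≤ _ (≤-trans (≤-trans (m≤m+n _ _) (n≤1+n _)) le)))) ⟩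
      μ b + G + ∥_∥ {list A} as * G  ≡⟨ +-assoc (μ b) G _ ⟩
      μ b + (G + ∥_∥ {list A} as * G)  ≤⟨ +-monoʳ-≤ (μ b) (+-monoʳ-≤ G (*-monoˡ-≤ G (m≤n+m _ (∥_∥ {A} a)))) ⟩
      μ b + ∥_∥ {list A} (a ∷ as) * G  ∎
      where G = ⟦ g ⟧ₚ (∥_∥ {Γ} γ + L)

  foldᵖ-additive : (g : Poly) →
    (∀ γ b a → ∥_∥ {B} (f ((γ , b) , a)) ≤ ∥_∥ {B} b + ⟦ g ⟧ₚ (∥_∥ {Γ} γ + ∥_∥ {A} a)) →
    FP Γ B (λ γ → foldl (λ b a → f ((γ , b) , a)) (z γ) (zs γ))
  foldᵖ-additive g = foldᵖ-measured (∥_∥ {B}) 1 g (λ b → m≤m+n _ 0) (λ b → ≤-refl)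

-- Programs on lists

nilᵖ : FP Γ (list A) (λ _ → [])
nilᵖ = constᵖ []

consᵖ : ∀ {f g} → FP Γ A f → FP Γ (list A) g → FP Γ (list A) (λ γ → f γ ∷ g γ)
consᵖ {A = A} F G = fp-retype {A ⊗ list A} {list A} {λ (a , as) → a ∷ as} (λ γ → refl) ∘ᵖ (F ,ᵖ G)

unconsᵖ : ∀ {g} → FP Γ (list A) g → FP Γ (opt A (list A)) (uncons ∘ g)
unconsᵖ {A = A} G = fp-retype {list A} {opt A (list A)} {uncons} (λ { [] → refl ; (_ ∷ _) → refl }) ∘ᵖ G

notᵖ : ∀ {f} → FP Γ bool f → FP Γ bool (λ γ → not (f γ))
notᵖ F = ifᵖ {f = λ b _ → not b} F (λ b → constᵖ (not b))

infixr 6 _∧ᵖ_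
infixr 5 _∨ᵖ_
_∧ᵖ_ : ∀ {f g} → FP Γ bool f → FP Γ bool g → FP Γ bool (λ γ → f γ ∧ g γ)
_∧ᵖ_ {g = g} F G = ifᵖ {f = λ b γ → b ∧ g γ} F λ { true → G ; false → constᵖ false }

_∨ᵖ_ : ∀ {f g} → FP Γ bool f → FP Γ bool g → FP Γ bool (λ γ → f γ ∨ g γ)
_∨ᵖ_ {g = g} F G = ifᵖ {f = λ b γ → b ∨ g γ} F λ { true → constᵖ true ; false → G }

iteᵖ : ∀ {c f g} → FP Γ bool c → FP Γ A f → FP Γ A g → FP Γ A (λ γ → if c γ then f γ else g γ)
iteᵖ {f = f} {g} C F G = ifᵖ {f = λ b γ → if b then f γ else g γ} C λ { true → F ; false → G }

wkᵖ : ∀ {f} → FP Γ A f → FP (Γ ⊗ B) A (f ∘ proj₁)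
wkᵖ F = F ∘ᵖ fstᵖ idᵖ

wk₁ᵖ : ∀ {f : ⟦ Γ ⟧ × ⟦ A ⟧ → ⟦ C ⟧} → FP (Γ ⊗ A) C f →
       FP ((Γ ⊗ B) ⊗ A) C (λ γ → f (proj₁ (proj₁ γ) , proj₂ γ))
wk₁ᵖ F = F ∘ᵖ (fstᵖ (fstᵖ idᵖ) ,ᵖ sndᵖ idᵖ)

v₀ : FP (Γ ⊗ A) A proj₂
v₀ = sndᵖ idᵖ

v₁ : FP ((Γ ⊗ A) ⊗ B) A (λ γ → proj₂ (proj₁ γ))
v₁ = wkᵖ v₀

reverseᵖ : ∀ {f} → FP Γ (list A) f → FP Γ (list A) (reverse ∘ f)
reverseᵖ {Γ} {A} F = foldᵖ-additive F nilᵖ (consᵖ v₀ v₁) (con 1 ⊞ 𝕏) λ γ b a → begin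
  suc (∥_∥ {A} a + ∥_∥ {list A} b)  ≡⟨ +-comm (suc (∥_∥ {A} a)) _ ⟩
  ∥_∥ {list A} b + suc (∥_∥ {A} a)  ≤⟨ +-monoʳ-≤ (∥_∥ {list A} b) (s≤s (m≤n+m _ _)) ⟩
  ∥_∥ {list A} b + suc (∥_∥ {Γ} γ + ∥_∥ {A} a)  ∎
  where open ≤-Reasoning

foldrᵖ : ∀ {zs z} {f : (⟦ Γ ⟧ × ⟦ B ⟧) × ⟦ A ⟧ → ⟦ B ⟧} →
  FP Γ (list A) zs → FP Γ B z → FP ((Γ ⊗ B) ⊗ A) B f → (g : Poly) →
  (∀ γ b a → ∥_∥ {B} (f ((γ , b) , a)) ≤ ∥_∥ {B} b + ⟦ g ⟧ₚ (∥_∥ {Γ} γ + ∥_∥ {A} a)) →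
  FP Γ B (λ γ → foldr (λ a b → f ((γ , b) , a)) (z γ) (zs γ))
foldrᵖ {zs = zs} XS Z F g grow =
  fp-ext (λ γ → List.reverse-foldl _ _ (zs γ)) (foldᵖ-additive (reverseᵖ XS) Z F g grow)

appendᵖ : ∀ {f g} → FP Γ (list A) f → FP Γ (list A) g → FP Γ (list A) (λ γ → f γ ++ g γ)
appendᵖ {Γ} {A} {f} {g} F G =
  fp-ext (λ γ → sym (List.++-is-foldr (f γ) (g γ))) (foldrᵖ F G (consᵖ v₀ v₁) (con 1 ⊞ 𝕏) λ γ b a → begin
  suc (∥_∥ {A} a + ∥_∥ {list A} b)  ≡⟨ +-comm (suc (∥_∥ {A} a)) _ ⟩
  ∥_∥ {list A} b + suc (∥_∥ {A} a)  ≤⟨ +-monoʳ-≤ (∥_∥ {list A} b) (s≤s (m≤n+m _ _)) ⟩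
  ∥_∥ {list A} b + suc (∥_∥ {Γ} γ + ∥_∥ {A} a)  ∎)
  where open ≤-Reasoning

mapᵖ : ∀ {zs} {f : ⟦ Γ ⟧ × ⟦ A ⟧ → ⟦ B ⟧} → FP Γ (list A) zs → FP (Γ ⊗ A) B f →
       FP Γ (list B) (λ γ → map (λ a → f (γ , a)) (zs γ))
mapᵖ {Γ} {A} {B} {zs} {f} XS F =
  fp-ext (λ γ → sym (List.map-is-foldr (zs γ)))
    (foldrᵖ XS nilᵖ (consᵖ (wk₁ᵖ F) v₁) (con 1 ⊞ (space F ⊚ (con 1 ⊞ 𝕏))) λ γ b a → begin
  suc (∥_∥ {B} (f (γ , a)) + ∥_∥ {list B} b)  ≡⟨ +-comm (suc (∥_∥ {B} (f (γ , a)))) _ ⟩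
  ∥_∥ {list B} b + suc (∥_∥ {B} (f (γ , a)))  ≤⟨ +-monoʳ-≤ (∥_∥ {list B} b) (s≤s (≤-trans (bound F (γ , a)) (poly-≤-∘ (space F) (con 1 ⊞ 𝕏) ≤-refl))) ⟩
  ∥_∥ {list B} b + suc (⟦ space F ⊚ (con 1 ⊞ 𝕏) ⟧ₚ (∥_∥ {Γ} γ + ∥_∥ {A} a))  ∎)
  where open ≤-Reasoning

filterᵇ-is-foldr : ∀ {Y : Set} (p : Y → Bool) xs →
  filterᵇ p xs ≡ foldr (λ a as → if p a then a ∷ as else as) [] xs
filterᵇ-is-foldr p [] = refl
filterᵇ-is-foldr p (a ∷ as) with p a
... | true  = cong (a ∷_) (filterᵇ-is-foldr p as)
... | false = filterᵇ-is-foldr p as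

filterᵖ : ∀ {zs} {p : ⟦ Γ ⟧ × ⟦ A ⟧ → Bool} → FP Γ (list A) zs → FP (Γ ⊗ A) bool p →
       FP Γ (list A) (λ γ → filterᵇ (λ a → p (γ , a)) (zs γ))
filterᵖ {Γ} {A} {zs} {p} XS P =
  fp-ext (λ γ → sym (filterᵇ-is-foldr _ (zs γ)))
    (foldrᵖ XS nilᵖ (iteᵖ (wk₁ᵖ P) (consᵖ v₀ v₁) v₁) (con 1 ⊞ 𝕏) λ γ b a → grow γ b a (p (γ , a)))
  where
  open ≤-Reasoning
  grow : ∀ γ b a c → ∥_∥ {list A} (if c then a ∷ b else b) ≤ ∥_∥ {list A} b + suc (∥_∥ {Γ} γ + ∥_∥ {A} a)
  grow γ b a false = m≤m+n _ _
  grow γ b a true = begin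
    suc (∥_∥ {A} a + ∥_∥ {list A} b)  ≡⟨ +-comm (suc (∥_∥ {A} a)) _ ⟩
    ∥_∥ {list A} b + suc (∥_∥ {A} a)  ≤⟨ +-monoʳ-≤ (∥_∥ {list A} b) (s≤s (m≤n+m _ _)) ⟩
    ∥_∥ {list A} b + suc (∥_∥ {Γ} γ + ∥_∥ {A} a)  ∎

size-++ : ∀ (as bs : ⟦ list A ⟧) → ∥_∥ {list A} (as ++ bs) ≤ ∥_∥ {list A} bs + ∥_∥ {list A} as
size-++ [] bs = m≤m+n _ 1
size-++ {A} (a ∷ as) bs = begin
  suc (∥_∥ {A} a + ∥_∥ {list A} (as ++ bs))  ≤⟨ s≤s (+-monoʳ-≤ (∥_∥ {A} a) (size-++ as bs)) ⟩
  suc (∥_∥ {A} a + (∥_∥ {list A} bs + ∥_∥ {list A} as))  ≡⟨ lemma (∥_∥ {A} a) (∥_∥ {list A} bs) (∥_∥ {list A} as) ⟩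
  ∥_∥ {list A} bs + suc (∥_∥ {A} a + ∥_∥ {list A} as)  ∎
  where
  open ≤-Reasoning
  lemma : ∀ p q r → suc (p + (q + r)) ≡ q + suc (p + r)
  lemma = solve-∀

concatᵖ : ∀ {f} → FP Γ (list (list A)) f → FP Γ (list A) (concat ∘ f)
concatᵖ {Γ} {A} F = foldrᵖ F nilᵖ (appendᵖ v₀ v₁) 𝕏 λ γ b a →
  ≤-trans (size-++ a b) (+-monoʳ-≤ (∥_∥ {list A} b) (m≤n+m _ _))

concatMapᵖ : ∀ {zs} {f : ⟦ Γ ⟧ × ⟦ A ⟧ → List ⟦ B ⟧} → FP Γ (list A) zs → FP (Γ ⊗ A) (list B) f →
       FP Γ (list B) (λ γ → concatMap (λ a → f (γ , a)) (zs γ))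
concatMapᵖ XS F = concatᵖ (mapᵖ XS F)

size-bit : ∀ b → size (bit b) ≤ 3
size-bit true  = ≤-refl
size-bit false = s≤s z≤n

anyᵖ : ∀ {zs} {p : ⟦ Γ ⟧ × ⟦ A ⟧ → Bool} → FP Γ (list A) zs → FP (Γ ⊗ A) bool p →
       FP Γ bool (λ γ → any (λ a → p (γ , a)) (zs γ))
anyᵖ XS P = foldrᵖ (mapᵖ XS P) (constᵖ false) (v₀ ∨ᵖ v₁) (con 3) λ γ b a →
  ≤-trans (size-bit (a ∨ b)) (m≤n+m 3 _)

-- Binary arithmetic

digit : Bool → ℕ
digit true  = 1
digit false = 2

infixr 5 _◂_
-- Bijective base 2, with the digits 1 and 2, least significant first. Each number has exactly one
-- numeral, so results need no normalisation.
_◂_ : Bool → ℕ → ℕ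
b ◂ m = digit b + 2 * m

encode-◂ : ∀ b m → encodeℕ (b ◂ m) ≡ bit b ∙ encodeℕ m
encode-◂ true m = cong encodeℕᵇ {ℕᵇ.fromℕ (true ◂ m)} {1+[2 ℕᵇ.fromℕ m ]} (ℕᵇ.toℕ-injective
  (trans (ℕᵇ.toℕ-fromℕ (true ◂ m)) (cong (λ k → suc (2 * k)) (sym (ℕᵇ.toℕ-fromℕ m)))))
encode-◂ false m = cong encodeℕᵇ {ℕᵇ.fromℕ (false ◂ m)} {2[1+ ℕᵇ.fromℕ m ]} (ℕᵇ.toℕ-injective
  (trans (ℕᵇ.toℕ-fromℕ (false ◂ m)) (trans (sym (*-suc 2 m)) (cong (λ k → 2 * suc k) (sym (ℕᵇ.toℕ-fromℕ m))))))

1≤digit : ∀ b → 1 ≤ digit b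
1≤digit true  = ≤-refl
1≤digit false = s≤s z≤n

value : List Bool → ℕ
value = foldr _◂_ 0

bitsᵇ : ℕᵇ → List Bool
bitsᵇ ℕᵇ.zero  = []
bitsᵇ 2[1+ k ] = false ∷ bitsᵇ k
bitsᵇ 1+[2 k ] = true ∷ bitsᵇ k

bits : ℕ → List Bool
bits m = bitsᵇ (ℕᵇ.fromℕ m)

value-bitsᵇ : ∀ k → value (bitsᵇ k) ≡ ℕᵇ.toℕ k
value-bitsᵇ ℕᵇ.zero  = refl
value-bitsᵇ 2[1+ k ] = trans (cong (λ v → 2 + 2 * v) (value-bitsᵇ k)) (sym (*-suc 2 (ℕᵇ.toℕ k)))
value-bitsᵇ 1+[2 k ] = cong (λ v → 1 + 2 * v) (value-bitsᵇ k)

value-bits : ∀ m → value (bits m) ≡ m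
value-bits m = trans (value-bitsᵇ (ℕᵇ.fromℕ m)) (ℕᵇ.toℕ-fromℕ m)

encode-bitsᵇ : ∀ k → enc (list bool) (bitsᵇ k) ≡ encodeℕᵇ k
encode-bitsᵇ ℕᵇ.zero  = refl
encode-bitsᵇ 2[1+ k ] = cong (nil ∙_) (encode-bitsᵇ k)
encode-bitsᵇ 1+[2 k ] = cong ((nil ∙ nil) ∙_) (encode-bitsᵇ k)

bitsᵖ : ∀ {f} → FP Γ nat f → FP Γ (list bool) (bits ∘ f)
bitsᵖ F = fp-retype {nat} {list bool} {bits} (λ m → encode-bitsᵇ (ℕᵇ.fromℕ m)) ∘ᵖ F

◂ᵖ : ∀ {f g} → FP Γ bool f → FP Γ nat g → FP Γ nat (λ γ → f γ ◂ g γ)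
◂ᵖ F G = fp-retype {bool ⊗ nat} {nat} {λ (b , m) → b ◂ m} (λ (b , m) → encode-◂ b m) ∘ᵖ (F ,ᵖ G)

width : ℕ → ℕ
width m = length (bits m)

size-width : ∀ m → ∥_∥ {nat} m ≤ 4 * suc (width m)
size-width m = subst (λ t → size t ≤ 4 * suc (width m)) (encode-bitsᵇ (ℕᵇ.fromℕ m)) (go (bits m))
  where
  open ≤-Reasoning
  go : ∀ bs → ∥_∥ {list bool} bs ≤ 4 * suc (length bs)
  go [] = s≤s z≤n
  go (b ∷ bs) = begin
    1 + size (bit b) + ∥_∥ {list bool} bs ≤⟨ +-mono-≤ (s≤s (size-bit b)) (go bs) ⟩
    4 + 4 * suc (length bs)  ≡⟨ *-suc 4 (suc (length bs)) ⟨
    4 * suc (suc (length bs))  ∎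

width-size : ∀ m → suc (width m) ≤ ∥_∥ {nat} m
width-size m = subst (λ t → suc (width m) ≤ size t) (encode-bitsᵇ (ℕᵇ.fromℕ m)) (go (bits m))
  where
  go : ∀ bs → suc (length bs) ≤ ∥_∥ {list bool} bs
  go []       = ≤-refl
  go (b ∷ bs) = s≤s (≤-trans (go bs) (m≤n+m _ _))

-- Numerals of w digits range from 2^w - 1 (all digits 1) to 2^(w+1) - 2 (all digits 2). This is the
-- lower end; `<2^width` is the upper one.
2^width≤ : ∀ m → 2 ^ width m ≤ suc m
2^width≤ m = subst (λ v → 2 ^ width m ≤ suc v) (value-bits m) (go (bits m))
  where
  open ≤-Reasoning
  go : ∀ bs → 2 ^ length bs ≤ suc (value bs)
  go []       = ≤-refl
  go (b ∷ bs) = begin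
    2 * 2 ^ length bs  ≤⟨ *-monoʳ-≤ 2 (go bs) ⟩
    2 * suc (value bs)  ≡⟨ *-suc 2 (value bs) ⟩
    suc (true ◂ value bs)  ≤⟨ s≤s (+-monoˡ-≤ (2 * value bs) (1≤digit b)) ⟩
    suc (b ◂ value bs)  ∎

<2^width : ∀ m → 2 + m ≤ 2 ^ suc (width m)
<2^width m = subst (λ v → 2 + v ≤ 2 ^ suc (width m)) (value-bits m) (go (bits m))
  where
  open ≤-Reasoning
  digit≤2 : ∀ b → digit b ≤ 2
  digit≤2 true  = s≤s z≤n
  digit≤2 false = ≤-refl
  go : ∀ bs → 2 + value bs ≤ 2 ^ suc (length bs)
  go []       = ≤-refl
  go (b ∷ bs) = begin
    2 + (b ◂ value bs)  ≤⟨ +-monoʳ-≤ 2 (+-monoˡ-≤ _ (digit≤2 b)) ⟩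
    2 + (2 + 2 * value bs)  ≡⟨ lemma (value bs) ⟩
    2 * (2 + value bs)  ≤⟨ *-monoʳ-≤ 2 (go bs) ⟩
    2 ^ suc (suc (length bs)) ∎
    where
    lemma : ∀ v → 2 + (2 + 2 * v) ≡ 2 * (2 + v)
    lemma = solve-∀

width-≤ : ∀ {m k} → suc m < 2 ^ suc k → width m ≤ k
width-≤ {m} {k} lt = s≤s⁻¹ (≰⇒> λ k<w →
  <⇒≱ lt (≤-trans (^-monoʳ-≤ 2 k<w) (2^width≤ m)))

width-mono : ∀ {m n} → m ≤ n → width m ≤ width n
width-mono {m} {n} m≤n = width-≤ {m} (≤-trans (s≤s (s≤s m≤n)) (<2^width n))

-- The factor is there because a digit 1 takes four nodes and a digit 2 only two: a smaller number
-- may have the larger encoding.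
size-mono : ∀ {m n} → m ≤ n → ∥_∥ {nat} m ≤ 4 * ∥_∥ {nat} n
size-mono {m} {n} m≤n = ≤-trans (size-width m) (*-monoʳ-≤ 4 (≤-trans (s≤s (width-mono m≤n)) (width-size n)))

width-suc : ∀ m → width (suc m) ≤ suc (width m)
width-suc m = width-≤ {suc m} (begin
  1 + (2 + m)  ≤⟨ +-mono-≤ (≤-trans (s≤s z≤n) (<2^width m)) (<2^width m) ⟩
  2 ^ suc (width m) + 2 ^ suc (width m) ≡⟨ cong (2 ^ suc (width m) +_) (+-identityʳ _) ⟨
  2 ^ suc (suc (width m))  ∎)
  where open ≤-Reasoning

-- 0 is allowed as a digit, for the positions above the highest one:
-- ⟪ b , c ⟫ is zero if b is false.
⟪_⟫ : Bool × Bool → ℕ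
⟪ false , _ ⟫ = 0
⟪ true , b ⟫  = digit b

top : List Bool → (Bool × Bool) × List Bool
top []       = (false , false) , []
top (b ∷ bs) = (true , b) , bs

value-top : ∀ bs → value bs ≡ ⟪ proj₁ (top bs) ⟫ + 2 * value (proj₂ (top bs))
value-top []       = refl
value-top (b ∷ bs) = refl

topᵖ : ∀ {f} → FP Γ (list bool) f → FP Γ ((bool ⊗ bool) ⊗ list bool) (top ∘ f)
topᵖ {Γ} {f} F = fp-ext (λ γ → eq (f γ)) (maybeᵖ (unconsᵖ F) (constᵖ ((false , false) , [])) ((constᵖ true ,ᵖ v₁) ,ᵖ v₀))
  where
  eq : ∀ bs → maybe′ (λ (b , bs) → (true , b) , bs) ((false , false) , []) (uncons bs) ≡ top bs
  eq []       = refl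
  eq (b ∷ bs) = refl

top-width : ∀ bs → length (proj₂ (top bs)) ≤ pred (length bs)
top-width []       = z≤n
top-width (b ∷ bs) = ≤-refl

top-size : ∀ bs → ∥_∥ {list bool} (proj₂ (top bs)) ≤ ∥_∥ {list bool} bs
top-size []       = ≤-refl
top-size (b ∷ bs) = ≤-trans (m≤n+m _ _) (n≤1+n _)

Carry : Ty
Carry = bool ⊗ bool

carry : Bool × Bool → ℕ
carry (b , c) = (if b then 1 else 0) + (if c then 1 else 0)

-- Two digits and a carry of at most 2 sum to at most 6 = 2 + 2 * 2, so the new carry is again at
-- most 2; hence the two bits of `Carry`. The value at 0 is a placeholder: the result is used only
-- when at least one digit is present, and digits are positive.
sumDigit : ℕ → Bool × (Bool × Bool)
sumDigit 0 = true , false , false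
sumDigit 1 = true , false , false
sumDigit 2 = false , false , false
sumDigit 3 = true , true , false
sumDigit 4 = false , true , false
sumDigit 5 = true , true , true
sumDigit _ = false , true , true

AddState : Ty
AddState = (Carry ⊗ (list bool ⊗ list bool)) ⊗ list bool

addStep : ⟦ AddState ⟧ → ⟦ AddState ⟧
addStep ((c , (p , q)) , out) =
  let (d , p′) = top p ; (e , q′) = top q ; (o , c′) = sumDigit (carry c + ⟪ d ⟫ + ⟪ e ⟫)
  in if proj₁ d ∨ proj₁ e then ((c′ , (p′ , q′)) , o ∷ out) else ((c , (p , q)) , out)

sumDigit-correct : ∀ c d e → T (proj₁ d ∨ proj₁ e) → let (o , c′) = sumDigit (carry c + ⟪ d ⟫ + ⟪ e ⟫) in
  carry c + ⟪ d ⟫ + ⟪ e ⟫ ≡ digit o + 2 * carry c′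
sumDigit-correct c d e t = table (carry c + ⟪ d ⟫ + ⟪ e ⟫) (lower d e t) (+-mono-≤ (+-mono-≤ (c≤2 c) (≤2 d)) (≤2 e))
  where
  table : ∀ n → 1 ≤ n → n ≤ 6 → n ≡ digit (proj₁ (sumDigit n)) + 2 * carry (proj₂ (sumDigit n))
  table 1 _ _ = refl
  table 2 _ _ = refl
  table 3 _ _ = refl
  table 4 _ _ = refl
  table 5 _ _ = refl
  table 6 _ _ = refl
  table (suc (suc (suc (suc (suc (suc (suc _))))))) _ (s≤s (s≤s (s≤s (s≤s (s≤s (s≤s ()))))))
  c≤2 : ∀ c → carry c ≤ 2
  c≤2 (true , true)   = ≤-refl
  c≤2 (true , false)  = s≤s z≤n
  c≤2 (false , true)  = s≤s z≤n
  c≤2 (false , false) = z≤n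
  ≤2 : ∀ d → ⟪ d ⟫ ≤ 2
  ≤2 (true , true)  = s≤s z≤n
  ≤2 (true , false) = ≤-refl
  ≤2 (false , _)    = z≤n
  lower : ∀ d e → T (proj₁ d ∨ proj₁ e) → 1 ≤ carry c + ⟪ d ⟫ + ⟪ e ⟫
  lower (true , b)  e          _ = ≤-trans (1≤digit b) (≤-trans (m≤n+m _ (carry c)) (m≤m+n _ ⟪ e ⟫))
  lower (false , _) (true , b) _ = ≤-trans (1≤digit b) (m≤n+m _ _)

-- What an addition in progress is going to return.
total : ⟦ AddState ⟧ → ℕ
total ((c , (p , q)) , out) = foldl (λ v b → b ◂ v) (carry c + (value p + value q)) out

addStep-total : ∀ st → total (addStep st) ≡ total st
addStep-total ((c , (p , q)) , out) with proj₁ (proj₁ (top p)) ∨ proj₁ (proj₁ (top q)) in eq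
... | false = refl
... | true  = cong (λ v → foldl (λ v b → b ◂ v) v out) (begin
  digit o + 2 * (carry c′ + (value p′ + value q′))  ≡⟨ lemma₁ (digit o) (carry c′) (value p′ + value q′) ⟩
  digit o + 2 * carry c′ + 2 * (value p′ + value q′)  ≡⟨ cong (_+ 2 * (value p′ + value q′)) (sumDigit-correct c d e (subst T (sym eq) tt)) ⟨
  carry c + ⟪ d ⟫ + ⟪ e ⟫ + 2 * (value p′ + value q′)  ≡⟨ lemma₂ (carry c) ⟪ d ⟫ ⟪ e ⟫ (value p′) (value q′) ⟩
  carry c + (⟪ d ⟫ + 2 * value p′ + (⟪ e ⟫ + 2 * value q′))  ≡⟨ cong (carry c +_) (cong₂ _+_ (value-top p) (value-top q)) ⟨
  carry c + (value p + value q)  ∎)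
  where
  open ≡-Reasoning
  d = proj₁ (top p) ; p′ = proj₂ (top p)
  e = proj₁ (top q) ; q′ = proj₂ (top q)
  o = proj₁ (sumDigit (carry c + ⟪ d ⟫ + ⟪ e ⟫))
  c′ = proj₂ (sumDigit (carry c + ⟪ d ⟫ + ⟪ e ⟫))
  lemma₁ : ∀ o c v → o + 2 * (c + v) ≡ o + 2 * c + 2 * v
  lemma₁ = solve-∀
  lemma₂ : ∀ c d e p q → c + d + e + 2 * (p + q) ≡ c + (d + 2 * p + (e + 2 * q))
  lemma₂ = solve-∀

addStepᵖ : ∀ {f} → FP Γ AddState f → FP Γ AddState (addStep ∘ f)
addStepᵖ F = stepᵖ ∘ᵖ F
  where
  c p q out : FP AddState _ _
  c   = fstᵖ (fstᵖ idᵖ)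
  p   = topᵖ (fstᵖ (sndᵖ (fstᵖ idᵖ)))
  q   = topᵖ (sndᵖ (sndᵖ (fstᵖ idᵖ)))
  out = sndᵖ idᵖ
  tableᵖ : ∀ {a b d₁ d₂ e₁ e₂} → FP Γ bool a → FP Γ bool b → FP Γ bool d₁ → FP Γ bool d₂ →
           FP Γ bool e₁ → FP Γ bool e₂ →
           FP Γ (bool ⊗ Carry) (λ γ → sumDigit (carry (a γ , b γ) + ⟪ d₁ γ , d₂ γ ⟫ + ⟪ e₁ γ , e₂ γ ⟫))
  tableᵖ {a = a} {b} {d₁} {d₂} {e₁} {e₂} A B D₁ D₂ E₁ E₂ =
    -- After the six case distinctions every branch is a constant: the table is looked up rather
    -- than computed.
    ifᵖ {f = λ a γ → sumDigit (carry (a , b γ) + ⟪ d₁ γ , d₂ γ ⟫ + ⟪ e₁ γ , e₂ γ ⟫)} A λ a →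
    ifᵖ {f = λ b γ → sumDigit (carry (a , b) + ⟪ d₁ γ , d₂ γ ⟫ + ⟪ e₁ γ , e₂ γ ⟫)} B λ b →
    ifᵖ {f = λ d₁ γ → sumDigit (carry (a , b) + ⟪ d₁ , d₂ γ ⟫ + ⟪ e₁ γ , e₂ γ ⟫)} D₁ λ d₁ →
    ifᵖ {f = λ d₂ γ → sumDigit (carry (a , b) + ⟪ d₁ , d₂ ⟫ + ⟪ e₁ γ , e₂ γ ⟫)} D₂ λ d₂ →
    ifᵖ {f = λ e₁ γ → sumDigit (carry (a , b) + ⟪ d₁ , d₂ ⟫ + ⟪ e₁ , e₂ γ ⟫)} E₁ λ e₁ →
    ifᵖ {f = λ e₂ γ → sumDigit (carry (a , b) + ⟪ d₁ , d₂ ⟫ + ⟪ e₁ , e₂ ⟫)} E₂ λ e₂ →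
    constᵖ _
  newᵖ = tableᵖ (fstᵖ c) (sndᵖ c) (fstᵖ (fstᵖ p)) (sndᵖ (fstᵖ p)) (fstᵖ (fstᵖ q)) (sndᵖ (fstᵖ q))
  stepᵖ : FP AddState AddState addStep
  stepᵖ = iteᵖ (fstᵖ (fstᵖ p) ∨ᵖ fstᵖ (fstᵖ q))
    ((sndᵖ newᵖ ,ᵖ (sndᵖ p ,ᵖ sndᵖ q)) ,ᵖ consᵖ (fstᵖ newᵖ) out) idᵖ

-- The elements of `clock` merely count rounds, folds being the only loops. `p ++ q` will serve, as
-- it is at least as long as either numeral.
addLoop : List Bool → ⟦ AddState ⟧ → ⟦ AddState ⟧
addLoop clock st = foldl (λ st _ → addStep st) st clock

addLoop-total : ∀ clock st → total (addLoop clock st) ≡ total st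
addLoop-total []          st = refl
addLoop-total (_ ∷ clock) st = trans (addLoop-total clock (addStep st)) (addStep-total st)

left right : ⟦ AddState ⟧ → List Bool
left  st = proj₁ (proj₂ (proj₁ st))
right st = proj₂ (proj₂ (proj₁ st))

addStep-shorter : ∀ st →
  length (left (addStep st)) ≤ pred (length (left st)) × length (right (addStep st)) ≤ pred (length (right st))
addStep-shorter ((c , ([] , []))        , out) = z≤n , z≤n
addStep-shorter ((c , ([] , _ ∷ q))     , out) = z≤n , ≤-refl
addStep-shorter ((c , (_ ∷ p , []))     , out) = ≤-refl , z≤n
addStep-shorter ((c , (_ ∷ p , _ ∷ q))  , out) = ≤-refl , ≤-refl

addLoop-done : ∀ clock st → length (left st) ≤ length clock → length (right st) ≤ length clock →
  left (addLoop clock st) ≡ [] × right (addLoop clock st) ≡ []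
addLoop-done [] ((_ , ([] , [])) , _) _ _ = refl , refl
addLoop-done (_ ∷ clock) st P Q = addLoop-done clock (addStep st)
  (≤-trans (proj₁ (addStep-shorter st)) (pred-mono-≤ P)) (≤-trans (proj₂ (addStep-shorter st)) (pred-mono-≤ Q))

addBits : List Bool → List Bool → ⟦ AddState ⟧
addBits p q = addLoop (p ++ q) (((false , false) , (p , q)) , [])

-- Digits come out least significant first, so the highest is on top of `out`. The sum is rebuilt
-- from there, starting with the last carry, which stands above all digits.
addBits-value : ∀ p q → foldl (λ v b → b ◂ v) (carry (proj₁ (proj₁ (addBits p q)))) (proj₂ (addBits p q)) ≡ value p + value q
addBits-value p q = trans (finish (addBits p q) (addLoop-done (p ++ q) (((false , false) , (p , q)) , [])
    (≤-trans (m≤m+n _ _) (≤-reflexive (sym (List.length-++ p))))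
    (≤-trans (m≤n+m _ _) (≤-reflexive (sym (List.length-++ p))))))
  (addLoop-total (p ++ q) (((false , false) , (p , q)) , []))
  where
  finish : ∀ st → left st ≡ [] × right st ≡ [] →
           foldl (λ v b → b ◂ v) (carry (proj₁ (proj₁ st))) (proj₂ st) ≡ total st
  finish ((c , ([] , [])) , out) (refl , refl) = cong (λ v → foldl (λ v b → b ◂ v) v out) (sym (+-identityʳ (carry c)))

addBitsᵖ : FP (list bool ⊗ list bool) AddState (λ (p , q) → addBits p q)
addBitsᵖ = foldᵖ-additive (appendᵖ (fstᵖ idᵖ) (sndᵖ idᵖ)) ((constᵖ (false , false) ,ᵖ idᵖ) ,ᵖ nilᵖ) (addStepᵖ v₁)
  -- 7 for the new carry, whatever the old one was, and 4 for the new digit.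
  (con 11) λ _ st _ → grow st
  where
  open ≤-Reasoning
  size-carry : ∀ c → ∥_∥ {Carry} c ≤ 7
  size-carry (a , b) = s≤s (+-mono-≤ (size-bit a) (size-bit b))
  bnd : ∀ c p q out c′ o → ∥_∥ {AddState} ((c′ , (proj₂ (top p) , proj₂ (top q))) , o ∷ out)
                           ≤ ∥_∥ {AddState} ((c , (p , q)) , out) + 11
  bnd c p q out c′ o = begin
    ∥_∥ {AddState} ((c′ , (proj₂ (top p) , proj₂ (top q))) , o ∷ out)
      ≤⟨ +-mono-≤ (s≤s (+-mono-≤ (s≤s (size-carry c′)) (s≤s (+-mono-≤ (top-size p) (top-size q)))))
                  (+-monoˡ-≤ O (s≤s (size-bit o))) ⟩
    1 + (8 + (1 + (P + Q))) + (4 + O)  ≡⟨ lemma P Q O ⟩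
    1 + (1 + (1 + (P + Q))) + O + 11  ≤⟨ +-monoˡ-≤ 11 (+-monoˡ-≤ O (s≤s (s≤s (m≤n+m _ (∥_∥ {Carry} c))))) ⟩
    ∥_∥ {AddState} ((c , (p , q)) , out) + 11 ∎
    where
    P = ∥_∥ {list bool} p
    Q = ∥_∥ {list bool} q
    O = ∥_∥ {list bool} out
    lemma : ∀ P Q O → 1 + (8 + (1 + (P + Q))) + (4 + O) ≡ 1 + (1 + (1 + (P + Q))) + O + 11
    lemma = solve-∀
  grow : ∀ st → ∥_∥ {AddState} (addStep st) ≤ ∥_∥ {AddState} st + 11
  grow ((c , (p , q)) , out) with proj₁ (proj₁ (top p)) ∨ proj₁ (proj₁ (top q))
  ... | false = m≤m+n _ 11
  ... | true  = bnd c p q out (proj₂ new) (proj₁ new)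
    where new = sumDigit (carry c + ⟪ proj₁ (top p) ⟫ + ⟪ proj₁ (top q) ⟫)

infixl 6 _+ᵖ_
_+ᵖ_ : ∀ {f g} → FP Γ nat f → FP Γ nat g → FP Γ nat (λ γ → f γ + g γ)
_+ᵖ_ {f = f} {g} F G = fp-ext (λ γ → trans (addBits-value (bits (f γ)) (bits (g γ)))
                                           (cong₂ _+_ (value-bits (f γ)) (value-bits (g γ))))
  (rebuild ∘ᵖ addBitsᵖ ∘ᵖ (bitsᵖ F ,ᵖ bitsᵖ G))
  where
  open ≤-Reasoning
  carryᵖ : ∀ {a b} → FP Δ bool a → FP Δ bool b → FP Δ nat (λ δ → carry (a δ , b δ))
  carryᵖ {b = b} A B = ifᵖ {f = λ a δ → carry (a , b δ)} A λ a → ifᵖ {f = λ b δ → carry (a , b)} B λ b → constᵖ _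
  rebuild : FP AddState nat (λ ((c , _) , out) → foldl (λ v b → b ◂ v) (carry c) out)
  rebuild = foldᵖ-additive (sndᵖ idᵖ) (carryᵖ (fstᵖ (fstᵖ (fstᵖ idᵖ))) (sndᵖ (fstᵖ (fstᵖ idᵖ))))
    (◂ᵖ v₀ v₁) (con 4) λ _ v b → begin
      ∥_∥ {nat} (b ◂ v)  ≡⟨ cong size (encode-◂ b v) ⟩
      suc (size (bit b) + ∥_∥ {nat} v)  ≤⟨ s≤s (+-monoˡ-≤ _ (size-bit b)) ⟩
      4 + ∥_∥ {nat} v  ≡⟨ +-comm 4 _ ⟩
      ∥_∥ {nat} v + 4  ∎

LeState : Ty
LeState = bool ⊗ (list bool ⊗ list bool)

gap : Bool → ℕ
gap c = if c then 0 else 1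

leStep : ⟦ LeState ⟧ → ⟦ LeState ⟧
leStep (c , (p , q)) =
  let (d , p′) = top p ; (e , q′) = top q in (gap c + ⟪ d ⟫ ≤ᵇ ⟪ e ⟫) , (p′ , q′)

-- The lower digits decide between ≤ and <.
Below : ⟦ LeState ⟧ → Set
Below (c , (p , q)) = gap c + value p ≤ value q

private
  T⇒≡ : ∀ {b} → T b → b ≡ true
  T⇒≡ {true} _ = refl

  ¬T⇒≡ : ∀ {b} → (T b → ⊥) → b ≡ false
  ¬T⇒≡ {true}  ¬t = ⊥-elim (¬t tt)
  ¬T⇒≡ {false} ¬t = refl

  half : ∀ {a b x y} → a + 2 * x ≤ b + 2 * y → b ≤ suc a → x ≤ y
  half {a} {b} {x} {y} le b≤ = ≮⇒≥ λ y<x → <⇒≱ (begin-strict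
    b + 2 * y  ≤⟨ +-monoˡ-≤ _ b≤ ⟩
    suc a + 2 * y  <⟨ n<1+n _ ⟩
    2 + a + 2 * y  ≡⟨ lemma a y ⟩
    a + 2 * suc y  ≤⟨ +-monoʳ-≤ a (*-monoʳ-≤ 2 y<x) ⟩
    a + 2 * x  ∎) le
    where
    open ≤-Reasoning
    lemma : ∀ a y → 2 + a + 2 * y ≡ a + 2 * suc y
    lemma = solve-∀

  half-< : ∀ {a b x y} → a + 2 * x ≤ b + 2 * y → b < a → x < y
  half-< {a} {b} {x} {y} le b<a = *-cancelˡ-< 2 x y (+-cancelˡ-< b (2 * x) (2 * y) (≤-trans (+-monoˡ-< (2 * x) b<a) le))

  unhalf-< : ∀ {a b x y} → x < y → a ≤ 2 + b → a + 2 * x ≤ b + 2 * y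
  unhalf-< {a} {b} {x} {y} x<y a≤ = begin
    a + 2 * x  ≤⟨ +-monoˡ-≤ _ a≤ ⟩
    2 + b + 2 * x  ≡⟨ lemma b x ⟩
    b + 2 * suc x  ≤⟨ +-monoʳ-≤ b (*-monoʳ-≤ 2 x<y) ⟩
    b + 2 * y  ∎
    where
    open ≤-Reasoning
    lemma : ∀ a y → 2 + a + 2 * y ≡ a + 2 * suc y
    lemma = solve-∀

-- Dropping a digit d of p and e of q is exact as long as gap c + d ≤ e + 2 and e ≤ gap c + d + 1.
-- Only the digit 0 of an exhausted numeral endangers this: if p is exhausted, its upper part is 0
-- and below anything; if q is, nothing is strictly below its upper part.
leStep-below : ∀ st → (Below (leStep st) → Below st) × (Below st → Below (leStep st))
leStep-below (c , (p , q)) with gap c + ⟪ proj₁ (top p) ⟫ ≤ᵇ ⟪ proj₁ (top q) ⟫ in eq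
... | b = backward b eq , forward b eq
  where
  d = ⟪ proj₁ (top p) ⟫ ; p′ = proj₂ (top p)
  e = ⟪ proj₁ (top q) ⟫ ; q′ = proj₂ (top q)
  open ≤-Reasoning
  split-p : gap c + value p ≡ gap c + d + 2 * value p′
  split-p = trans (cong (gap c +_) (value-top p)) (sym (+-assoc (gap c) d _))
  gap≤1 : ∀ c → gap c ≤ 1
  gap≤1 true  = z≤n
  gap≤1 false = ≤-refl
  digit⁰≤2 : ∀ d → ⟪ d ⟫ ≤ 2
  digit⁰≤2 (true , true)  = s≤s z≤n
  digit⁰≤2 (true , false) = ≤-refl
  digit⁰≤2 (false , _)    = z≤n
  backward : ∀ b → (gap c + d ≤ᵇ e) ≡ b → Below (b , (p′ , q′)) → Below (c , (p , q))
  backward true eq lt = begin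
    gap c + value p  ≡⟨ split-p ⟩
    gap c + d + 2 * value p′  ≤⟨ +-mono-≤ (≤ᵇ⇒≤ (gap c + d) e (subst T (sym eq) tt)) (*-monoʳ-≤ 2 lt) ⟩
    e + 2 * value q′  ≡⟨ value-top q ⟨
    value q  ∎
  backward false eq lt = begin
    gap c + value p  ≡⟨ split-p ⟩
    gap c + d + 2 * value p′  ≤⟨ unhalf-< lt (carries q lt) ⟩
    e + 2 * value q′  ≡⟨ value-top q ⟨
    value q  ∎
    where
    carries : ∀ q → suc (value p′) ≤ value (proj₂ (top q)) → gap c + d ≤ 2 + ⟪ proj₁ (top q) ⟫
    carries (b ∷ q) _ = ≤-trans (+-mono-≤ (gap≤1 c) (digit⁰≤2 (proj₁ (top p))))
                                (+-monoʳ-≤ 2 (1≤digit b))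
  forward : ∀ b → (gap c + d ≤ᵇ e) ≡ b → Below (c , (p , q)) → Below (b , (p′ , q′))
  forward false eq lt = half-< {gap c + d} {e} (subst₂ _≤_ split-p (value-top q) lt)
    (≰⇒> λ le → subst T eq (≤⇒≤ᵇ le))
  forward true eq lt = carried p (subst₂ _≤_ split-p (value-top q) lt)
    where
    carried : ∀ p → gap c + ⟪ proj₁ (top p) ⟫ + 2 * value (proj₂ (top p)) ≤ e + 2 * value q′ →
              value (proj₂ (top p)) ≤ value q′
    carried []      _  = z≤n
    carried (b ∷ p) le = half {gap c + digit b} {e} le (≤-trans (digit⁰≤2 (proj₁ (top q)))
                           (s≤s (≤-trans (1≤digit b) (m≤n+m _ (gap c)))))

leLoop : List Bool → ⟦ LeState ⟧ → ⟦ LeState ⟧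
leLoop clock st = foldl (λ st _ → leStep st) st clock

leLoop-below : ∀ clock st → length (proj₁ (proj₂ st)) ≤ length clock → length (proj₂ (proj₂ st)) ≤ length clock →
  (T (proj₁ (leLoop clock st)) → Below st) × (Below st → T (proj₁ (leLoop clock st)))
leLoop-below [] (true  , ([] , [])) _ _ = (λ _ → z≤n) , λ _ → tt
leLoop-below [] (false , ([] , [])) _ _ = (λ ()) , λ ()
leLoop-below (_ ∷ clock) st@(c , (p , q)) P Q =
  let (f , g) = leLoop-below clock (leStep st) (≤-trans (top-width p) (pred-mono-≤ P)) (≤-trans (top-width q) (pred-mono-≤ Q))
      (f′ , g′) = leStep-below st
  in f′ ∘ f , g ∘ g′

leBits : List Bool → List Bool → Bool
leBits p q = proj₁ (leLoop (p ++ q) (true , (p , q)))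

leBits-correct : ∀ m n → leBits (bits m) (bits n) ≡ (m ≤ᵇ n)
leBits-correct m n with m ≤ᵇ n in eq
... | true  = T⇒≡ (proj₂ spec (subst₂ _≤_ (sym (value-bits m)) (sym (value-bits n)) (≤ᵇ⇒≤ m n (subst T (sym eq) tt))))
  where spec = leLoop-below (bits m ++ bits n) (true , (bits m , bits n))
                 (≤-trans (m≤m+n _ _) (≤-reflexive (sym (List.length-++ (bits m)))))
                 (≤-trans (m≤n+m _ _) (≤-reflexive (sym (List.length-++ (bits m)))))
... | false = ¬T⇒≡ λ t → subst T eq (≤⇒≤ᵇ (subst₂ _≤_ (value-bits m) (value-bits n) (proj₁ spec t)))
  where spec = leLoop-below (bits m ++ bits n) (true , (bits m , bits n))
                 (≤-trans (m≤m+n _ _) (≤-reflexive (sym (List.length-++ (bits m)))))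
                 (≤-trans (m≤n+m _ _) (≤-reflexive (sym (List.length-++ (bits m)))))

infix 4 _≤ᵖ_
_≤ᵖ_ : ∀ {f g} → FP Γ nat f → FP Γ nat g → FP Γ bool (λ γ → f γ ≤ᵇ g γ)
_≤ᵖ_ {f = f} {g} F G = fp-ext (λ γ → leBits-correct (f γ) (g γ)) (leBitsᵖ ∘ᵖ (bitsᵖ F ,ᵖ bitsᵖ G))
  where
  open ≤-Reasoning
  digitLeᵖ : ∀ {c d₁ d₂ e₁ e₂} → FP Δ bool c → FP Δ bool d₁ → FP Δ bool d₂ → FP Δ bool e₁ → FP Δ bool e₂ →
             FP Δ bool (λ γ → gap (c γ) + ⟪ d₁ γ , d₂ γ ⟫ ≤ᵇ ⟪ e₁ γ , e₂ γ ⟫)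
  digitLeᵖ {c = c} {d₁} {d₂} {e₁} {e₂} C D₁ D₂ E₁ E₂ =
    ifᵖ {f = λ c γ → gap c + ⟪ d₁ γ , d₂ γ ⟫ ≤ᵇ ⟪ e₁ γ , e₂ γ ⟫} C λ c →
    ifᵖ {f = λ d₁ γ → gap c + ⟪ d₁ , d₂ γ ⟫ ≤ᵇ ⟪ e₁ γ , e₂ γ ⟫} D₁ λ d₁ →
    ifᵖ {f = λ d₂ γ → gap c + ⟪ d₁ , d₂ ⟫ ≤ᵇ ⟪ e₁ γ , e₂ γ ⟫} D₂ λ d₂ →
    ifᵖ {f = λ e₁ γ → gap c + ⟪ d₁ , d₂ ⟫ ≤ᵇ ⟪ e₁ , e₂ γ ⟫} E₁ λ e₁ →
    ifᵖ {f = λ e₂ γ → gap c + ⟪ d₁ , d₂ ⟫ ≤ᵇ ⟪ e₁ , e₂ ⟫} E₂ λ e₂ →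
    constᵖ _
  p q : FP LeState _ _
  p = topᵖ (fstᵖ (sndᵖ idᵖ))
  q = topᵖ (sndᵖ (sndᵖ idᵖ))
  leStepᵖ : FP LeState LeState leStep
  leStepᵖ = digitLeᵖ (fstᵖ idᵖ) (fstᵖ (fstᵖ p)) (sndᵖ (fstᵖ p)) (fstᵖ (fstᵖ q)) (sndᵖ (fstᵖ q)) ,ᵖ (sndᵖ p ,ᵖ sndᵖ q)
  grow : ∀ st → ∥_∥ {LeState} (leStep st) ≤ ∥_∥ {LeState} st + 3
  grow st@(c , (p , q)) = begin
    ∥_∥ {LeState} (leStep st)
      ≤⟨ s≤s (+-mono-≤ (size-bit (proj₁ (leStep st))) (s≤s (+-mono-≤ (top-size p) (top-size q)))) ⟩
    1 + 3 + ∥_∥ {list bool ⊗ list bool} (p , q)  ≡⟨ +-comm (1 + 3) _ ⟩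
    ∥_∥ {list bool ⊗ list bool} (p , q) + (1 + 3)  ≡⟨ +-suc (∥_∥ {list bool ⊗ list bool} (p , q)) 3 ⟩
    suc (∥_∥ {list bool ⊗ list bool} (p , q) + 3)  ≤⟨ s≤s (+-monoˡ-≤ 3 (m≤n+m (∥_∥ {list bool ⊗ list bool} (p , q)) (size (bit c)))) ⟩
    ∥_∥ {LeState} st + 3  ∎
  leBitsᵖ : FP (list bool ⊗ list bool) bool (λ (p , q) → leBits p q)
  leBitsᵖ = fstᵖ (foldᵖ-additive (appendᵖ (fstᵖ idᵖ) (sndᵖ idᵖ)) (constᵖ true ,ᵖ idᵖ) (leStepᵖ ∘ᵖ v₁)
    (con 3) λ _ st _ → grow st)

infix 4 _==_
_==_ : ℕ → ℕ → Bool
m == n = (m ≤ᵇ n) ∧ (n ≤ᵇ m)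

_==ᵖ_ : ∀ {f g} → FP Γ nat f → FP Γ nat g → FP Γ bool (λ γ → f γ == g γ)
F ==ᵖ G = (F ≤ᵖ G) ∧ᵖ (G ≤ᵖ F)

_⊓ᵖ_ : ∀ {f g} → FP Γ nat f → FP Γ nat g → FP Γ nat (λ γ → f γ ⊓ g γ)
_⊓ᵖ_ {f = f} {g} F G = fp-ext (λ γ → eq (f γ) (g γ)) (iteᵖ (F ≤ᵖ G) F G)
  where
  eq : ∀ m n → (if m ≤ᵇ n then m else n) ≡ m ⊓ n
  eq m n with m ≤ᵇ n in e
  ... | true  = sym (m≤n⇒m⊓n≡m (≤ᵇ⇒≤ m n (subst T (sym e) tt)))
  ... | false = sym (m≥n⇒m⊓n≡n (≰⇒≥ λ le → subst T e (≤⇒≤ᵇ le)))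

width-* : ∀ m n → width (m * n) ≤ width m + suc (width n)
width-* m n = width-≤ {m * n} (begin-strict
    suc (m * n)  <⟨ m<m+n _ (s≤s z≤n) ⟩
    suc (m * n) + suc (2 + 2 * m + 2 * n)  ≡⟨ lemma m n ⟩
    (2 + m) * (2 + n)  ≤⟨ *-mono-≤ (<2^width m) (<2^width n) ⟩
    2 ^ suc (width m) * 2 ^ suc (width n)  ≡⟨ ^-distribˡ-+-* 2 (suc (width m)) (suc (width n)) ⟨
    2 ^ suc (width m + suc (width n))  ∎)
  where
  open ≤-Reasoning
  lemma : ∀ m n → suc (m * n) + suc (2 + 2 * m + 2 * n) ≡ (2 + m) * (2 + n)
  lemma = solve-∀

infixl 7 _*ᵖ_
-- Horner's scheme from the highest digit of the left factor. Each round adds at most 2 + width n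
-- digits, a crude bound, but additive.
_*ᵖ_ : ∀ {f g} → FP Γ nat f → FP Γ nat g → FP Γ nat (λ γ → f γ * g γ)
_*ᵖ_ {f = f} {g} F G = fp-ext (λ γ → trans (horner (bits (f γ)) (g γ)) (cong (_* g γ) (value-bits (f γ))))
  (mulᵖ ∘ᵖ (F ,ᵖ G))
  where
  open ≤-Reasoning
  digitTimes : Bool → ℕ → ℕ
  digitTimes b n = if b then n else n + n
  horner : ∀ bs n → foldr (λ b acc → digitTimes b n + (acc + acc)) 0 bs ≡ value bs * n
  horner [] n = refl
  horner (b ∷ bs) n = begin-equality
    digitTimes b n + (acc + acc)  ≡⟨ cong₂ _+_ (eq b) (cong₂ _+_ (horner bs n) (horner bs n)) ⟩
    digit b * n + (value bs * n + value bs * n)  ≡⟨ lemma (digit b) (value bs) n ⟩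
    (b ◂ value bs) * n  ∎
    where
    acc = foldr (λ b acc → digitTimes b n + (acc + acc)) 0 bs
    lemma : ∀ d v n → d * n + (v * n + v * n) ≡ (d + 2 * v) * n
    lemma = solve-∀
    eq : ∀ b → digitTimes b n ≡ digit b * n
    eq true  = sym (*-identityˡ n)
    eq false = cong (n +_) (sym (+-identityʳ n))
  digitTimes≤ : ∀ b n → digitTimes b n ≤ n + n
  digitTimes≤ true  n = m≤m+n n n
  digitTimes≤ false n = ≤-refl
  grow : ∀ b n acc → suc (width (digitTimes b n + (acc + acc))) ≤ suc (width acc) + (2 + width n)
  grow b n acc = s≤s (width-≤ {digitTimes b n + (acc + acc)} (begin-strict
    suc (digitTimes b n + (acc + acc))  ≤⟨ s≤s (+-monoˡ-≤ _ (digitTimes≤ b n)) ⟩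
    suc (n + n + (acc + acc))  <⟨ m<m+n _ (s≤s z≤n) ⟩
    suc (n + n + (acc + acc)) + suc (6 + 2 * (n + acc) + 2 * (acc * n))
                                                ≡⟨ lemma n acc ⟩
    2 * ((2 + acc) * (2 + n))  ≤⟨ *-monoʳ-≤ 2 (*-mono-≤ (<2^width acc) (<2^width n)) ⟩
    2 * (2 ^ suc (width acc) * 2 ^ suc (width n)) ≡⟨ cong (2 *_) (^-distribˡ-+-* 2 (suc (width acc)) (suc (width n))) ⟨
    2 ^ suc (suc (width acc) + suc (width n))  ≡⟨ cong (λ k → 2 ^ suc k) (sym (+-suc (width acc) (suc (width n)))) ⟩
    2 ^ suc (width acc + (2 + width n))  ∎))
    where
    lemma : ∀ n a → suc (n + n + (a + a)) + suc (6 + 2 * (n + a) + 2 * (a * n)) ≡ 2 * ((2 + a) * (2 + n))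
    lemma = solve-∀
  mulᵖ : FP (nat ⊗ nat) nat (λ (m , n) → foldr (λ b acc → digitTimes b n + (acc + acc)) 0 (bits m))
  mulᵖ = fp-ext (λ (m , n) → List.reverse-foldl _ _ (bits m))
    (foldᵖ-measured (reverseᵖ (bitsᵖ (fstᵖ idᵖ))) (constᵖ 0)
      (iteᵖ v₀ (sndᵖ (wkᵖ (fstᵖ idᵖ))) (sndᵖ (wkᵖ (fstᵖ idᵖ)) +ᵖ sndᵖ (wkᵖ (fstᵖ idᵖ))) +ᵖ (v₁ +ᵖ v₁))
      (suc ∘ width) 4 (con 2 ⊞ 𝕏) size-width width-size
      λ (m , n) acc b → ≤-trans (grow b n acc) (+-monoʳ-≤ (suc (width acc)) (+-monoʳ-≤ 2 (begin
        width n  ≤⟨ n≤1+n _ ⟩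
        suc (width n)  ≤⟨ width-size n ⟩
        ∥_∥ {nat} n  ≤⟨ m≤n+m _ (∥_∥ {nat} m) ⟩
        ∥_∥ {nat} m + ∥_∥ {nat} n  ≤⟨ n≤1+n _ ⟩
        ∥_∥ {nat ⊗ nat} (m , n)  ≤⟨ m≤m+n _ _ ⟩
        ∥_∥ {nat ⊗ nat} (m , n) + size (bit b) ∎))))

lengthᵖ : ∀ {zs} → FP Γ (list A) zs → FP Γ nat (length ∘ zs)
lengthᵖ {zs = zs} XS = fp-ext (λ γ → eq 0 (zs γ))
  (foldᵖ-measured XS (constᵖ 0) (fp-ext (λ γ → +-comm _ 1) (v₁ +ᵖ constᵖ 1)) (suc ∘ width) 4 (con 1) size-width width-size
    λ _ m _ → ≤-trans (s≤s (width-suc m)) (≤-reflexive (+-comm 1 _)))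
  where
  eq : ∀ {Y : Set} k (ys : List Y) → foldl (λ n _ → suc n) k ys ≡ k + length ys
  eq k []       = sym (+-identityʳ k)
  eq k (_ ∷ ys) = trans (eq (suc k) ys) (sym (+-suc k (length ys)))

Key WEdge Hop Int Rat Entry RawGraph RawRequest Plan Memory : Ty
Key        = nat ⊗ nat
WEdge      = Key ⊗ nat
Hop        = Key ⊗ (nat ⊗ nat)
Int        = bool ⊗ nat
Rat        = Int ⊗ Int
Entry      = Key ⊗ (nat ⊗ nat)
RawGraph   = list (list (opt Int Int))
RawRequest = nat ⊗ (nat ⊗ Rat)
Plan       = list nat ⊗ (list WEdge ⊗ (nat ⊗ (list Hop ⊗ list nat)))
Memory     = Plan ⊗ list Key

-- The algorithm

enumerate : {Y : Set} → List Y → List (ℕ × Y)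
enumerate ys = reverse (proj₂ (foldl (λ st y → suc (proj₁ st) , (proj₁ st , y) ∷ proj₂ st) (0 , []) ys))

size-ℕ : ∀ m → ∥_∥ {nat} m ≤ 4 * suc m
size-ℕ m = ≤-trans (size-width m) (*-monoʳ-≤ 4 (s≤s (width≤ m)))
  where
  width≤ : ∀ m → width m ≤ m
  width≤ zero    = z≤n
  width≤ (suc m) = ≤-trans (width-suc m) (s≤s (width≤ m))

length≤size : ∀ (as : ⟦ list A ⟧) → length as ≤ ∥_∥ {list A} as
length≤size []           = z≤n
length≤size {A} (a ∷ as) = s≤s (≤-trans (length≤size {A} as) (m≤n+m _ _))

-- Each round stores the counter, which is part of the state and not bounded by context and element.
-- Hence the states are bounded directly, through i ≤ N for every index i.
enumerateᵖ : ∀ {zs} → FP Γ (list A) zs → FP Γ (list (nat ⊗ A)) (enumerate ∘ zs)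
enumerateᵖ {Γ} {A} {zs} XS = reverseᵖ (sndᵖ numbered ∘ᵖ XS)
  where
  open ≤-Reasoning
  R = con 2 ⊞ con 4 ⊠ (con 1 ⊞ 𝕏) ⊞ 𝕏 ⊠ (con 6 ⊞ con 4 ⊠ 𝕏) ⊞ 𝕏
  numbering : List ⟦ A ⟧ → ℕ × List (ℕ × ⟦ A ⟧)
  numbering = foldl (λ st y → suc (proj₁ st) , (proj₁ st , y) ∷ proj₂ st) (0 , [])
  go : ∀ N as i out → i + length as ≤ N →
    ∥_∥ {nat ⊗ list (nat ⊗ A)} (foldl (λ st y → suc (proj₁ st) , (proj₁ st , y) ∷ proj₂ st) (i , out) as)
    ≤ 1 + 4 * suc N + (∥_∥ {list (nat ⊗ A)} out + length as * (6 + 4 * N) + ∥_∥ {list A} as)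
  go N [] i out le = s≤s (+-mono-≤ (≤-trans (size-ℕ i) (*-monoʳ-≤ 4 (s≤s (≤-trans (m≤m+n i 0) le))))
                                   (≤-trans (m≤m+n _ 0) (m≤m+n _ 1)))
  go N (a ∷ as) i out le = begin
    ∥_∥ {nat ⊗ list (nat ⊗ A)} (foldl (λ st y → suc (proj₁ st) , (proj₁ st , y) ∷ proj₂ st) (suc i , (i , a) ∷ out) as)
      ≤⟨ go N as (suc i) ((i , a) ∷ out) (≤-trans (≤-reflexive (sym (+-suc i (length as)))) le) ⟩
    1 + 4 * suc N + (1 + (1 + (∥_∥ {nat} i + α)) + ω + length as * (6 + 4 * N) + ∥_∥ {list A} as)
      ≤⟨ +-monoʳ-≤ (1 + 4 * suc N) (+-monoˡ-≤ _ (+-monoˡ-≤ _ (+-monoˡ-≤ ω (s≤s (s≤s (+-monoˡ-≤ α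
           (≤-trans (size-ℕ i) (*-monoʳ-≤ 4 (s≤s (≤-trans (m≤m+n i _) le)))))))))) ⟩
    1 + 4 * suc N + (1 + (1 + (4 * suc N + α)) + ω + length as * (6 + 4 * N) + ∥_∥ {list A} as)
      ≤⟨ +-monoʳ-≤ (1 + 4 * suc N) (≤-trans (n≤1+n _) (≤-reflexive (lemma N α ω (length as * (6 + 4 * N)) (∥_∥ {list A} as)))) ⟩
    1 + 4 * suc N + (ω + suc (length as) * (6 + 4 * N) + suc (α + ∥_∥ {list A} as))  ∎
    where
    α = ∥_∥ {A} a
    ω = ∥_∥ {list (nat ⊗ A)} out
    lemma : ∀ N α ω l s → 1 + (1 + (1 + (4 * suc N + α)) + ω + l + s) ≡ ω + ((6 + 4 * N) + l) + suc (α + s)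
    lemma = solve-∀
  numbered : FP (list A) (nat ⊗ list (nat ⊗ A)) numbering
  numbered = foldᵖ idᵖ (constᵖ (0 , [])) (fp-ext (λ γ → +-comm _ 1) (fstᵖ v₁ +ᵖ constᵖ 1) ,ᵖ consᵖ (fstᵖ v₁ ,ᵖ v₀) (sndᵖ v₁)) R
    λ as pre suf eq → let N = ∥_∥ {list A} as ; pre≤ = prefix as pre suf eq ; len≤ = ≤-trans (length≤size {A} pre) pre≤ in begin
      ∥_∥ {nat ⊗ list (nat ⊗ A)} (numbering pre)  ≤⟨ go N pre 0 [] len≤ ⟩
      1 + 4 * suc N + (1 + length pre * (6 + 4 * N) + ∥_∥ {list A} pre)
        ≤⟨ +-monoʳ-≤ (1 + 4 * suc N) (+-mono-≤ (s≤s (*-monoˡ-≤ (6 + 4 * N) len≤)) pre≤) ⟩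
      1 + 4 * suc N + (1 + N * (6 + 4 * N) + N)  ≡⟨ lemma N ⟩
      ⟦ R ⟧ₚ N ∎
    where
    lemma : ∀ N → 1 + 4 * suc N + (1 + N * (6 + 4 * N) + N) ≡ 2 + 4 * (1 + N) + N * (6 + 4 * N) + N
    lemma = solve-∀
    prefix : ∀ as pre suf → as ≡ pre ++ suf → ∥_∥ {list A} pre ≤ ∥_∥ {list A} as
    prefix _ []        suf refl = 1≤size _
    prefix _ (b ∷ pre) suf refl = s≤s (+-monoʳ-≤ _ (prefix _ pre suf refl))

-- Widths add up under multiplication, up to 1 per factor. So the product of all denominators has
-- polynomial size and can serve as the common denominator.
productᵖ : ∀ {zs} → FP Γ (list nat) zs → FP Γ nat (product ∘ zs)
productᵖ {Γ} {zs} XS = fp-ext (λ γ → List.reverse-foldl _ _ (zs γ))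
  (foldᵖ-measured (reverseᵖ XS) (constᵖ 1) (v₀ *ᵖ v₁) (suc ∘ width) 4 𝕏 size-width width-size grow)
  where
  open ≤-Reasoning
  grow : ∀ γ acc m → suc (width (m * acc)) ≤ suc (width acc) + (∥_∥ {Γ} γ + ∥_∥ {nat} m)
  grow γ acc m = begin
    suc (width (m * acc))  ≤⟨ s≤s (width-* m acc) ⟩
    suc (width m) + suc (width acc)  ≡⟨ +-comm (suc (width m)) _ ⟩
    suc (width acc) + suc (width m)  ≤⟨ +-monoʳ-≤ (suc (width acc)) (≤-trans (width-size m) (m≤n+m _ _)) ⟩
    suc (width acc) + (∥_∥ {Γ} γ + ∥_∥ {nat} m)  ∎

infix 4 _==²_
_==²_ : ℕ × ℕ → ℕ × ℕ → Bool
k ==² l = (proj₁ k == proj₁ l) ∧ (proj₂ k == proj₂ l)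

_==²ᵖ_ : ∀ {f g} → FP Γ Key f → FP Γ Key g → FP Γ bool (λ γ → f γ ==² g γ)
F ==²ᵖ G = (fstᵖ F ==ᵖ fstᵖ G) ∧ᵖ (sndᵖ F ==ᵖ sndᵖ G)

entries : ⟦ RawGraph ⟧ → List ⟦ Entry ⟧
entries g = concatMap (λ row → concatMap (λ cell →
    maybe′ (λ pq → [ (proj₁ row , proj₁ cell) , (proj₂ (proj₁ pq) , proj₂ (proj₂ pq)) ]) [] (proj₂ cell))
  (enumerate (proj₂ row))) (enumerate g)

entriesᵖ : FP RawGraph (list Entry) entries
entriesᵖ = concatMapᵖ (enumerateᵖ idᵖ) (concatMapᵖ (enumerateᵖ (sndᵖ v₀))
  (maybeᵖ (sndᵖ v₀) nilᵖ (consᵖ ((fstᵖ (wkᵖ (wkᵖ v₁)) ,ᵖ fstᵖ (wkᵖ v₁)) ,ᵖ (sndᵖ v₁ ,ᵖ sndᵖ v₀)) nilᵖ)))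

-- The numerator of the length of k over the product of all denominators.
numerator : List ⟦ Entry ⟧ → ℕ × ℕ → ℕ
numerator es k = product (map (λ e → if proj₁ e ==² k then proj₁ (proj₂ e) else proj₂ (proj₂ e)) es)

denominator : List ⟦ Entry ⟧ → ℕ
denominator es = product (map (λ e → proj₂ (proj₂ e)) es)

weighted : List ⟦ Entry ⟧ → List ⟦ WEdge ⟧
weighted es = map (λ e → proj₁ e , numerator es (proj₁ e)) es

weightedᵖ : FP (list Entry) (list WEdge) weighted
weightedᵖ = mapᵖ idᵖ (fstᵖ v₀ ,ᵖ productᵖ (mapᵖ (fstᵖ idᵖ) (iteᵖ (fstᵖ v₀ ==²ᵖ fstᵖ v₁) (fstᵖ (sndᵖ v₀)) (sndᵖ (sndᵖ v₀)))))

denominatorᵖ : FP (list Entry) nat denominator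
denominatorᵖ = productᵖ (mapᵖ idᵖ (sndᵖ (sndᵖ v₀)))

-- All paths s → v → t of two edges, as ((s , t) , (v , length)).
hops : List ⟦ WEdge ⟧ → List ⟦ Hop ⟧
hops es = concatMap (λ e → concatMap (λ f →
    if proj₂ (proj₁ e) == proj₁ (proj₁ f)
    then [ (proj₁ (proj₁ e) , proj₂ (proj₁ f)) , (proj₂ (proj₁ e) , proj₂ e + proj₂ f) ] else [])
  es) es

hopsᵖ : FP (list WEdge) (list Hop) hops
hopsᵖ = concatMapᵖ idᵖ (concatMapᵖ (fstᵖ idᵖ)
  (iteᵖ (sndᵖ (fstᵖ v₁) ==ᵖ fstᵖ (fstᵖ v₀))
    (consᵖ ((fstᵖ (fstᵖ v₁) ,ᵖ sndᵖ (fstᵖ v₀)) ,ᵖ (sndᵖ (fstᵖ v₁) ,ᵖ (sndᵖ v₁ +ᵖ sndᵖ v₀))) nilᵖ) nilᵖ))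

-- Is there a path s → v → t of length at most T / q, for k = (s , t)?
near : List ⟦ Hop ⟧ → ℕ × ℕ → ℕ → ℕ → ℕ → Bool
near H k q T v = any (λ h → (proj₁ h ==² k) ∧ (proj₁ (proj₂ h) == v) ∧ (proj₂ (proj₂ h) * q ≤ᵇ T)) H

nearᵖ : ∀ {h k q T v} → FP Γ (list Hop) h → FP Γ Key k → FP Γ nat q → FP Γ nat T → FP Γ nat v →
        FP Γ bool (λ γ → near (h γ) (k γ) (q γ) (T γ) (v γ))
nearᵖ H K Q T V = anyᵖ H ((fstᵖ v₀ ==²ᵖ wkᵖ K) ∧ᵖ (fstᵖ (sndᵖ v₀) ==ᵖ wkᵖ V) ∧ᵖ (sndᵖ (sndᵖ v₀) *ᵖ wkᵖ Q ≤ᵖ wkᵖ T))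

mids : List ℕ → List ⟦ Hop ⟧ → ℕ × ℕ → ℕ → ℕ → List ℕ
mids V H k q T = filterᵇ (near H k q T) V

midsᵖ : ∀ {h k q T v} → FP Γ (list nat) v → FP Γ (list Hop) h → FP Γ Key k → FP Γ nat q → FP Γ nat T →
        FP Γ (list nat) (λ γ → mids (v γ) (h γ) (k γ) (q γ) (T γ))
midsᵖ V H K Q T = filterᵖ V (nearᵖ (wkᵖ H) (wkᵖ K) (wkᵖ Q) (wkᵖ T) v₀)

-- A hop τ stands for the request between its endpoints whose target is its own length, hence the
-- denominator 1. Between two consecutive such lengths M does not change, so hops represent all
-- requests with nonempty M.
hit : List ⟦ Hop ⟧ → ⟦ Hop ⟧ → ℕ → Bool
hit H τ v = near H (proj₁ τ) 1 (proj₂ (proj₂ τ)) v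

hitᵖ : ∀ {h τ v} → FP Γ (list Hop) h → FP Γ Hop τ → FP Γ nat v → FP Γ bool (λ γ → hit (h γ) (τ γ) (v γ))
hitᵖ H τ V = nearᵖ H (fstᵖ τ) (constᵖ 1) (sndᵖ (sndᵖ τ)) V

-- Comparing cubes avoids computing n^(1/3).
thick : List ℕ → List ℕ → Bool
thick V M = not (length M * length M * length M ≤ᵇ length V)

candidates : List ℕ → List ⟦ Hop ⟧ → List ⟦ Hop ⟧
candidates V H = filterᵇ (λ τ → thick V (filterᵇ (hit H τ) V)) H

candidatesᵖ : FP (list nat ⊗ list Hop) (list Hop) (λ (V , H) → candidates V H)
candidatesᵖ = filterᵖ (sndᵖ idᵖ) (notᵖ (M *ᵖ M *ᵖ M ≤ᵖ lengthᵖ (wkᵖ (fstᵖ idᵖ))))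
  where M = lengthᵖ (filterᵖ (wkᵖ (fstᵖ idᵖ)) (hitᵖ (wkᵖ (wkᵖ (sndᵖ idᵖ))) v₁ v₀))

count : List ⟦ Hop ⟧ → List ⟦ Hop ⟧ → ℕ → ℕ
count H R v = length (filterᵇ (λ τ → hit H τ v) R)

countᵖ : ∀ {h r v} → FP Γ (list Hop) h → FP Γ (list Hop) r → FP Γ nat v → FP Γ nat (λ γ → count (h γ) (r γ) (v γ))
countᵖ H R V = lengthᵖ (filterᵖ R (hitᵖ (wkᵖ H) v₀ (wkᵖ V)))

best : List ⟦ Hop ⟧ → List ⟦ Hop ⟧ → List ℕ → ℕ
best H R = foldl (λ b v → if count H R b ≤ᵇ count H R v then v else b) 0

bestᵖ : ∀ {v h r} → FP Γ (list Hop) h → FP Γ (list Hop) r → FP Γ (list nat) v →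
        FP Γ nat (λ γ → best (h γ) (r γ) (v γ))
bestᵖ {Γ} {h = h} {r} H R V = foldᵖ-additive V (constᵖ 0) (iteᵖ (countᵖ (wkᵖ (wkᵖ H)) (wkᵖ (wkᵖ R)) v₁ ≤ᵖ countᵖ (wkᵖ (wkᵖ H)) (wkᵖ (wkᵖ R)) v₀) v₀ v₁) 𝕏
  λ γ b v → one-of (count (h γ) (r γ) b ≤ᵇ count (h γ) (r γ) v) γ b v
  where
  one-of : ∀ c γ b v → ∥_∥ {nat} (if c then v else b) ≤ ∥_∥ {nat} b + (∥_∥ {Γ} γ + ∥_∥ {nat} v)
  one-of true  γ b v = ≤-trans (m≤n+m (∥_∥ {nat} v) (∥_∥ {Γ} γ)) (m≤n+m _ (∥_∥ {nat} b))
  one-of false γ b v = m≤m+n _ _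

-- `uncons` serves to test whether sets remain; otherwise the idle rounds at the end of the clock
-- would go on adding hubs.
greedyStep : List ℕ → List ⟦ Hop ⟧ → List ⟦ Hop ⟧ × List ℕ → List ⟦ Hop ⟧ × List ℕ
greedyStep V H st = maybe′ (λ _ → filterᵇ (λ τ → not (hit H τ (best H (proj₁ st) V))) (proj₁ st) , best H (proj₁ st) V ∷ proj₂ st)
                           st (uncons (proj₁ st))

greedy : List ℕ → List ⟦ Hop ⟧ → List ⟦ Hop ⟧ → List ⟦ Hop ⟧ × List ℕ → List ⟦ Hop ⟧ × List ℕ
greedy V H clock st = foldl (λ st _ → greedyStep V H st) st clock

hubs : List ℕ → List ⟦ Hop ⟧ → List ℕ
hubs V H = proj₂ (greedy V H (candidates V H) (candidates V H , []))

filterᵇ-size : ∀ (p : ⟦ A ⟧ → Bool) as → ∥_∥ {list A} (filterᵇ p as) ≤ ∥_∥ {list A} as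
filterᵇ-size p [] = ≤-refl
filterᵇ-size {A} p (a ∷ as) with p a
... | true  = s≤s (+-monoʳ-≤ _ (filterᵇ-size {A} p as))
... | false = ≤-trans (filterᵇ-size {A} p as) (≤-trans (m≤n+m _ _) (n≤1+n _))

best-size : ∀ H R V → ∥_∥ {nat} (best H R V) ≤ ∥_∥ {list nat} V
best-size H R V = go 0 V (1≤size _) ≤-refl
  where
  N = ∥_∥ {list nat} V
  choose : ∀ (c : Bool) {b v} → ∥_∥ {nat} b ≤ N → ∥_∥ {nat} v ≤ N → ∥_∥ {nat} (if c then v else b) ≤ N
  choose true  b≤ v≤ = v≤
  choose false b≤ v≤ = b≤
  go : ∀ b vs → ∥_∥ {nat} b ≤ N → ∥_∥ {list nat} vs ≤ N →
       ∥_∥ {nat} (foldl (λ b v → if count H R b ≤ᵇ count H R v then v else b) b vs) ≤ N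
  go b []       b≤ vs≤ = b≤
  go b (v ∷ vs) b≤ vs≤ = go _ vs
    (choose (count H R b ≤ᵇ count H R v) b≤ (≤-trans (≤-trans (m≤m+n _ _) (n≤1+n _)) vs≤))
    (≤-trans (≤-trans (m≤n+m _ (∥_∥ {nat} v)) (n≤1+n _)) vs≤)

hubsᵖ : FP (list nat ⊗ list Hop) (list nat) (λ (V , H) → hubs V H)
hubsᵖ = sndᵖ (foldᵖ-additive candidatesᵖ (candidatesᵖ ,ᵖ nilᵖ) (maybeᵖ (unconsᵖ (fstᵖ v₁)) v₁
    (filterᵖ (wkᵖ (wkᵖ (fstᵖ v₁))) (notᵖ (hitᵖ (wkᵖ H) v₀ (wkᵖ b))) ,ᵖ consᵖ b (wkᵖ (wkᵖ (sndᵖ v₁)))))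
  (con 1 ⊞ 𝕏) λ (V , H) st a → grow V H st (proj₁ st) ≤-refl (∥_∥ {Hop} a))
  where
  V : ∀ {A B C D} → FP (((((list nat ⊗ list Hop) ⊗ A) ⊗ B) ⊗ C) ⊗ D) (list nat) _
  V = wkᵖ (wkᵖ (wkᵖ (wkᵖ (fstᵖ idᵖ))))
  H : ∀ {A B C D} → FP (((((list nat ⊗ list Hop) ⊗ A) ⊗ B) ⊗ C) ⊗ D) (list Hop) _
  H = wkᵖ (wkᵖ (wkᵖ (wkᵖ (sndᵖ idᵖ))))
  b = bestᵖ H (wkᵖ (wkᵖ (fstᵖ v₁))) V
  open ≤-Reasoning
  grow : ∀ V H st rs → ∥_∥ {list Hop} rs ≤ ∥_∥ {list Hop} (proj₁ st) → ∀ z →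
    ∥_∥ {list Hop ⊗ list nat} (maybe′ (λ _ → filterᵇ (λ τ → not (hit H τ (best H (proj₁ st) V))) (proj₁ st) , best H (proj₁ st) V ∷ proj₂ st)
                           st (uncons rs)) ≤ ∥_∥ {list Hop ⊗ list nat} st + suc (∥_∥ {list nat ⊗ list Hop} (V , H) + z)
  grow V H st []      le z = m≤m+n _ _
  grow V H st@(R , hs) (_ ∷ _) le z = begin
    1 + ∥_∥ {list Hop} (filterᵇ _ R) + (1 + ∥_∥ {nat} (best H R V) + ∥_∥ {list nat} hs)
      ≤⟨ +-mono-≤ (s≤s (filterᵇ-size {Hop} _ R)) (s≤s (+-monoˡ-≤ _ (best-size H R V))) ⟩
    1 + ∥_∥ {list Hop} R + (1 + ∥_∥ {list nat} V + ∥_∥ {list nat} hs)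
      ≡⟨ lemma (∥_∥ {list Hop} R) (∥_∥ {list nat} V) (∥_∥ {list nat} hs) ⟩
    ∥_∥ {list Hop ⊗ list nat} st + (1 + ∥_∥ {list nat} V)
      ≤⟨ +-monoʳ-≤ (∥_∥ {list Hop ⊗ list nat} st) (s≤s (≤-trans (≤-trans (m≤m+n (∥_∥ {list nat} V) (∥_∥ {list Hop} H)) (n≤1+n _)) (m≤m+n (∥_∥ {list nat ⊗ list Hop} (V , H)) z))) ⟩
    ∥_∥ {list Hop ⊗ list nat} st + suc (∥_∥ {list nat ⊗ list Hop} (V , H) + z) ∎
    where
    lemma : ∀ r v h → 1 + r + (1 + v + h) ≡ 1 + (r + h) + (1 + v)
    lemma = solve-∀

vertices : ⟦ RawGraph ⟧ → List ℕ
vertices g = map proj₁ (enumerate g)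

plan : ⟦ RawGraph ⟧ → ⟦ Plan ⟧
plan g = vertices g , (es , (denominator (entries g) , (hops es , hubs (vertices g) (hops es))))
  where es = weighted (entries g)

planᵖ : FP RawGraph Plan plan
planᵖ = V ,ᵖ (es ,ᵖ (denominatorᵖ ∘ᵖ entriesᵖ ,ᵖ (hopsᵖ ∘ᵖ es ,ᵖ hubsᵖ ∘ᵖ (V ,ᵖ hopsᵖ ∘ᵖ es))))
  where
  V  = mapᵖ (enumerateᵖ idᵖ) (fstᵖ v₀)
  es = weightedᵖ ∘ᵖ entriesᵖ

member : ℕ × ℕ → List (ℕ × ℕ) → Bool
member k B = any (_==² k) B

memberᵖ : ∀ {k b} → FP Γ Key k → FP Γ (list Key) b → FP Γ bool (λ γ → member (k γ) (b γ))
memberᵖ K B = anyᵖ B (v₀ ==²ᵖ wkᵖ K)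

element : ℕ → List ℕ → Bool
element v M = any (_== v) M

elementᵖ : ∀ {v m} → FP Γ nat v → FP Γ (list nat) m → FP Γ bool (λ γ → element (v γ) (m γ))
elementᵖ V M = anyᵖ M (v₀ ==ᵖ wkᵖ V)

-- Old and new purchases are selected afresh from `es`, instead of extending B. Thus the list never
-- outgrows the edge list, however many rounds there are.
buy : (ℕ × ℕ → Bool) → List ⟦ WEdge ⟧ → List (ℕ × ℕ) → List (ℕ × ℕ)
buy P es B = map proj₁ (filterᵇ (λ e → member (proj₁ e) B ∨ P (proj₁ e)) es)

buyᵖ : ∀ {es b} {P : ⟦ Γ ⟧ × (ℕ × ℕ) → Bool} → FP (Γ ⊗ Key) bool P → FP Γ (list WEdge) es → FP Γ (list Key) b →
       FP Γ (list Key) (λ γ → buy (λ k → P (γ , k)) (es γ) (b γ))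
buyᵖ P E B = mapᵖ (filterᵖ E (memberᵖ (fstᵖ v₀) (wkᵖ B) ∨ᵖ P ∘ᵖ (fstᵖ idᵖ ,ᵖ fstᵖ v₀))) (fstᵖ v₀)

-- ∞ is a finite cap, `suc T` when in use: lengths beyond the target T need not be told apart.
-- Capped entries give the tables of all rounds of Floyd-Warshall the same size bound.
dist : ℕ → List ⟦ WEdge ⟧ → ℕ × ℕ → ℕ
dist ∞ W k = foldr (λ e m → if proj₁ e ==² k then proj₂ e ⊓ m else m) ∞ W

distᵖ : ∀ {i w k} → FP Γ nat i → FP Γ (list WEdge) w → FP Γ Key k → FP Γ nat (λ γ → dist (i γ) (w γ) (k γ))
distᵖ {Γ} {k = k} I W K = foldrᵖ W I (iteᵖ (fstᵖ v₀ ==²ᵖ wkᵖ (wkᵖ K)) (sndᵖ v₀ ⊓ᵖ v₁) v₁) 𝕏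
  λ γ m e → grow γ m e (proj₁ e ==² k γ)
  where
  grow : ∀ γ m e c → ∥_∥ {nat} (if c then proj₂ e ⊓ m else m) ≤ ∥_∥ {nat} m + (∥_∥ {Γ} γ + ∥_∥ {WEdge} e)
  grow γ m e false = m≤m+n _ _
  grow γ m e@(_ , y) true with ⊓-sel y m
  ... | inj₁ eq rewrite eq = ≤-trans (≤-trans (m≤n+m _ (∥_∥ {Key} (proj₁ e))) (n≤1+n _)) (≤-trans (m≤n+m _ (∥_∥ {Γ} γ)) (m≤n+m _ (∥_∥ {nat} m)))
  ... | inj₂ eq rewrite eq = m≤m+n _ _

-- The entries of length 0 are the empty paths. The factor q allows a comparison with T without
-- division.
weights : List ℕ → ℕ → List ⟦ WEdge ⟧ → List (ℕ × ℕ) → List ⟦ WEdge ⟧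
weights V q es B = map (λ v → (v , v) , 0) V ++ map (λ e → proj₁ e , proj₂ e * q) (filterᵇ (λ e → member (proj₁ e) B) es)

weightsᵖ : ∀ {v q es b} → FP Γ (list nat) v → FP Γ nat q → FP Γ (list WEdge) es → FP Γ (list Key) b →
           FP Γ (list WEdge) (λ γ → weights (v γ) (q γ) (es γ) (b γ))
weightsᵖ V Q E B = appendᵖ (mapᵖ V ((v₀ ,ᵖ v₀) ,ᵖ constᵖ 0))
  (mapᵖ (filterᵖ E (memberᵖ (fstᵖ v₀) (wkᵖ B))) (fstᵖ v₀ ,ᵖ sndᵖ v₀ *ᵖ wkᵖ Q))

pairs : List ℕ → List (ℕ × ℕ)
pairs V = concatMap (λ u → map (λ v → u , v) V) V

abstract
  pairsᵖ : FP (list nat) (list Key) pairs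
  pairsᵖ = concatMapᵖ idᵖ (mapᵖ (fstᵖ idᵖ) (v₁ ,ᵖ v₀))

-- One round of the Floyd–Warshall algorithm: paths may now pass through w.
through : ℕ → List ℕ → List ⟦ WEdge ⟧ → ℕ → List ⟦ WEdge ⟧
through ∞ V W w = map (λ k → k , dist ∞ W k ⊓ (dist ∞ W (proj₁ k , w) + dist ∞ W (w , proj₂ k))) (pairs V)

shortest : ℕ → List ℕ → List ⟦ WEdge ⟧ → List ⟦ WEdge ⟧
shortest ∞ V W = foldl (through ∞ V) W V

dist≤∞ : ∀ ∞ W k → dist ∞ W k ≤ ∞
dist≤∞ ∞ []      k = ≤-refl
dist≤∞ ∞ (e ∷ W) k with proj₁ e ==² k
... | true  = ≤-trans (m⊓n≤n _ _) (dist≤∞ ∞ W k)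
... | false = dist≤∞ ∞ W k

shortestᵖ : ∀ {i v w} → FP Γ nat i → FP Γ (list nat) v → FP Γ (list WEdge) w →
            FP Γ (list WEdge) (λ γ → shortest (i γ) (v γ) (w γ))
shortestᵖ {Γ} I V W = folded ∘ᵖ ((I ,ᵖ V) ,ᵖ W)
  where
  open ≤-Reasoning
  context : Ty
  context = (nat ⊗ list nat) ⊗ list WEdge
  throughᵖ : FP ((context ⊗ list WEdge) ⊗ nat) (list WEdge) _
  throughᵖ = mapᵖ (wkᵖ (wkᵖ (pairsᵖ ∘ᵖ sndᵖ (fstᵖ idᵖ))))
    (v₀ ,ᵖ (distᵖ ∞ dᵖ v₀ ⊓ᵖ (distᵖ ∞ dᵖ (fstᵖ v₀ ,ᵖ v₁) +ᵖ distᵖ ∞ dᵖ (v₁ ,ᵖ sndᵖ v₀))))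
    where
    ∞ = wkᵖ (wkᵖ (wkᵖ (fstᵖ (fstᵖ idᵖ))))
    dᵖ = wkᵖ v₁
  map-size : ∀ (h : ℕ × ℕ → ℕ) N ks → (∀ k → ∥_∥ {nat} (h k) ≤ N) →
    ∥_∥ {list WEdge} (map (λ k → k , h k) ks) ≤ ∥_∥ {list Key} ks * (2 + N)
  map-size h N []       le = s≤s z≤n
  map-size h N (k ∷ ks) le = begin
    1 + (1 + (κ + ∥_∥ {nat} (h k)) + ∥_∥ {list WEdge} (map (λ k → k , h k) ks))
      ≤⟨ s≤s (+-mono-≤ (s≤s (+-monoʳ-≤ κ (le k))) (map-size h N ks le)) ⟩
    1 + (1 + (κ + N) + ρ * (2 + N))
      ≤⟨ m≤m+n _ (κ + κ * N) ⟩
    1 + (1 + (κ + N) + ρ * (2 + N)) + (κ + κ * N)  ≡⟨ lemma κ N ρ ⟩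
    suc (κ + ρ) * (2 + N)  ∎
    where
    κ = ∥_∥ {Key} k
    ρ = ∥_∥ {list Key} ks
    lemma : ∀ k n r → 1 + (1 + (k + n) + r * (2 + n)) + (k + k * n) ≡ suc (k + r) * (2 + n)
    lemma = solve-∀
  grow : ∀ ∞ V W D w → ∥_∥ {list WEdge} (through ∞ V D w) ≤
    ∥_∥ {list WEdge} D + ⟦ space pairsᵖ ⊠ (con 2 ⊞ con 4 ⊠ 𝕏) ⟧ₚ (∥_∥ {context} ((∞ , V) , W) + ∥_∥ {nat} w)
  grow ∞ V W D w = ≤-trans (map-size _ (4 * ∥_∥ {nat} ∞) (pairs V)
      (λ k → size-mono (≤-trans (m⊓n≤m _ _) (dist≤∞ ∞ D k))))
    (≤-trans (*-mono-≤ (≤-trans (bound pairsᵖ V) (poly-mono (space pairsᵖ) V≤)) (+-monoʳ-≤ 2 (*-monoʳ-≤ 4 ∞≤)))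
             (m≤n+m _ (∥_∥ {list WEdge} D)))
    where
    V≤ : ∥_∥ {list nat} V ≤ ∥_∥ {context} ((∞ , V) , W) + ∥_∥ {nat} w
    V≤ = ≤-trans (≤-trans (≤-trans (m≤n+m _ (∥_∥ {nat} ∞)) (n≤1+n _)) (≤-trans (m≤m+n _ _) (n≤1+n _))) (m≤m+n _ _)
    ∞≤ : ∥_∥ {nat} ∞ ≤ ∥_∥ {context} ((∞ , V) , W) + ∥_∥ {nat} w
    ∞≤ = ≤-trans (≤-trans (≤-trans (m≤m+n _ (∥_∥ {list nat} V)) (n≤1+n _)) (≤-trans (m≤m+n _ _) (n≤1+n _))) (m≤m+n _ _)
  folded : FP context (list WEdge) (λ ((i , v) , w) → shortest i v w)
  folded = foldᵖ-additive (sndᵖ (fstᵖ idᵖ)) (sndᵖ idᵖ) throughᵖ (space pairsᵖ ⊠ (con 2 ⊞ con 4 ⊠ 𝕏))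
    λ ((∞ , V) , W) D w → grow ∞ V W D w

connected : List ℕ → List ⟦ WEdge ⟧ → List (ℕ × ℕ) → ℕ × ℕ → ℕ → ℕ → Bool
connected V es B k q T = dist (suc T) (shortest (suc T) V (weights V q es B)) k ≤ᵇ T

connectedᵖ : ∀ {v es b k q T} → FP Γ (list nat) v → FP Γ (list WEdge) es → FP Γ (list Key) b → FP Γ Key k →
  FP Γ nat q → FP Γ nat T → FP Γ bool (λ γ → connected (v γ) (es γ) (b γ) (k γ) (q γ) (T γ))
connectedᵖ {T = T} V E B K Q τ = distᵖ ∞ (shortestᵖ ∞ V (weightsᵖ V Q E B)) K ≤ᵖ τ
  where ∞ = fp-ext (λ γ → +-comm (T γ) 1) (τ +ᵖ constᵖ 1)

toHubs : List ℕ → ℕ → ℕ → ℕ × ℕ → Bool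
toHubs hs s t k = (proj₁ k == s) ∧ element (proj₂ k) hs ∨ (proj₂ k == t) ∧ element (proj₁ k) hs

inside : List ℕ → ℕ × ℕ → Bool
inside M k = element (proj₁ k) M ∧ element (proj₂ k) M

-- The edges bought so far, after a request from s to t with target distance T / (q * Q).
serve : ⟦ Plan ⟧ → List (ℕ × ℕ) → ℕ → ℕ → ℕ → ℕ → List (ℕ × ℕ)
serve (V , (es , (Q , (H , hs)))) B s t q T =
  if s == t then B else if connected V es B′ (s , t) q T then B′ else buy (inside (s ∷ t ∷ mids V H (s , t) q T)) es B′
  where B′ = buy (toHubs hs s t) es B

-- The target of an admissible request is nonnegative, so p and q are its numerator and denominator.
-- Over the denominator q * Q its numerator is p * Q.
answer : ⟦ Memory ⊗ RawRequest ⟧ → List (ℕ × ℕ)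
answer ((P , B) , (s , (t , ((_ , p) , (_ , q))))) = serve P B s t q (p * proj₁ (proj₂ (proj₂ P)))

answerᵖ : FP (Memory ⊗ RawRequest) (list Key) answer
answerᵖ = iteᵖ (s′ ==ᵖ t′) bought (decide ∘ᵖ (idᵖ ,ᵖ buyᵖ
    (((fstᵖ v₀ ==ᵖ wkᵖ s′) ∧ᵖ elementᵖ (sndᵖ v₀) (wkᵖ hs)) ∨ᵖ ((sndᵖ v₀ ==ᵖ wkᵖ t′) ∧ᵖ elementᵖ (fstᵖ v₀) (wkᵖ hs))) es bought))
  where
  Input = Memory ⊗ RawRequest
  V  = fstᵖ {Input} (fstᵖ (fstᵖ idᵖ))
  es = fstᵖ {Input} (sndᵖ (fstᵖ (fstᵖ idᵖ)))
  Q  = fstᵖ {Input} (sndᵖ (sndᵖ (fstᵖ (fstᵖ idᵖ))))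
  H  = fstᵖ {Input} (sndᵖ (sndᵖ (sndᵖ (fstᵖ (fstᵖ idᵖ)))))
  hs = sndᵖ {Input} (sndᵖ (sndᵖ (sndᵖ (fstᵖ (fstᵖ idᵖ)))))
  bought = sndᵖ {Input} (fstᵖ idᵖ)
  s′ = fstᵖ {Input} (sndᵖ idᵖ)
  t′ = fstᵖ {Input} (sndᵖ (sndᵖ idᵖ))
  q  = sndᵖ {Input} (sndᵖ (sndᵖ (sndᵖ (sndᵖ idᵖ))))
  τ  = sndᵖ {Input} (fstᵖ (sndᵖ (sndᵖ (sndᵖ idᵖ)))) *ᵖ Q
  st = s′ ,ᵖ t′
  decide = iteᵖ (connectedᵖ (wkᵖ V) (wkᵖ es) v₀ (wkᵖ st) (wkᵖ q) (wkᵖ τ)) v₀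
    (buyᵖ (elementᵖ (fstᵖ v₀) (wkᵖ core) ∧ᵖ elementᵖ (sndᵖ v₀) (wkᵖ core)) (wkᵖ es) v₀)
    where core = consᵖ (wkᵖ s′) (consᵖ (wkᵖ t′) (midsᵖ (wkᵖ V) (wkᵖ H) (wkᵖ st) (wkᵖ q) (wkᵖ τ)))

-- Cube roots, logarithms and the final estimate

cube-cancel-≤ : ∀ {a b} → a * a * a ≤ b * b * b → a ≤ b
cube-cancel-≤ {a} {b} le = ≮⇒≥ λ b<a → <⇒≱ (*-mono-< (*-mono-< b<a b<a) b<a) le

-- r is the least number whose cube reaches m. If r = p + 1 with p ≥ 1, then p^3 < m and r ≤ 2 p, so
-- rounding up costs at most the factor 8.
cubeRoot : ∀ m → ∃[ r ] m ≤ r * r * r × r * r * r ≤ 8 * m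
cubeRoot m = let (r , le , small) = least m in r , le , small-bound r small
  where
  open ≤-Reasoning
  least : ∀ m → ∃[ r ] m ≤ r * r * r × (r ≡ 0 ⊎ ∃[ p ] r ≡ suc p × p * p * p < m)
  least zero    = 0 , z≤n , inj₁ refl
  least (suc m) with least m
  ... | r , le , small with suc m ≤? r * r * r
  ...   | yes m<r³ = r , m<r³ , weaken-small small
    where
    weaken-small : r ≡ 0 ⊎ ∃[ p ] r ≡ suc p × p * p * p < m → r ≡ 0 ⊎ ∃[ p ] r ≡ suc p × p * p * p < suc m
    weaken-small (inj₁ eq)            = inj₁ eq
    weaken-small (inj₂ (p , eq , lt)) = inj₂ (p , eq , m<n⇒m<1+n lt)
  ...   | no  m≮r³ = suc r , ≤-trans (s≤s le) (*-mono-< (*-mono-< (n<1+n r) (n<1+n r)) (n<1+n r)) ,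
                     inj₂ (r , refl , ≰⇒> m≮r³)
  small-bound : ∀ r → r ≡ 0 ⊎ ∃[ p ] r ≡ suc p × p * p * p < m → r * r * r ≤ 8 * m
  small-bound _ (inj₁ refl) = z≤n
  small-bound _ (inj₂ (zero , refl , lt))    = ≤-trans (≤-trans lt (m≤m+n m _)) ≤-refl
  small-bound _ (inj₂ (suc p , refl , lt)) = begin
    suc (suc p) * suc (suc p) * suc (suc p)  ≤⟨ *-mono-≤ (*-mono-≤ dbl dbl) dbl ⟩
    2 * suc p * (2 * suc p) * (2 * suc p)  ≡⟨ lemma (suc p) ⟩
    8 * (suc p * suc p * suc p)  ≤⟨ *-monoʳ-≤ 8 (<⇒≤ lt) ⟩
    8 * m  ∎
    where
    lemma : ∀ p → 2 * p * (2 * p) * (2 * p) ≡ 8 * (p * p * p)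
    lemma = solve-∀
    dbl : suc (suc p) ≤ 2 * suc p
    dbl = s≤s (≤-trans (s≤s (m≤m+n p (p + 0))) (≤-reflexive (sym (+-suc p (p + 0)))))

-- Induction along the recursion of `⌈log2⌉` from 2 + n to 1 + ⌈n/2⌉, twice which is at least 2 + n.
n≤2^⌈log₂n⌉ : ∀ n → n ≤ 2 ^ ⌈log₂ n ⌉
n≤2^⌈log₂n⌉ n = go n (<-wellFounded n)
  where
  open ≤-Reasoning
  go : ∀ n (a : Acc _<_ n) → n ≤ 2 ^ ⌈log2⌉ n a
  go 0             _        = z≤n
  go 1             _        = ≤-refl
  go (suc (suc n)) (accessible rs) = begin
    2 + n  ≡⟨ cong (2 +_) (⌊n/2⌋+⌈n/2⌉≡n n) ⟨
    2 + (⌊ n /2⌋ + ⌈ n /2⌉)  ≤⟨ +-monoʳ-≤ 2 (+-monoˡ-≤ ⌈ n /2⌉ (⌊n/2⌋≤⌈n/2⌉ n)) ⟩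
    2 + (⌈ n /2⌉ + ⌈ n /2⌉)  ≡⟨ lemma ⌈ n /2⌉ ⟩
    2 * suc ⌈ n /2⌉  ≤⟨ *-monoʳ-≤ 2 (go (suc ⌈ n /2⌉) _) ⟩
    2 * 2 ^ ⌈log2⌉ (suc ⌈ n /2⌉) _  ∎
    where
    lemma : ∀ h → 2 + (h + h) ≡ 2 * suc h
    lemma = solve-∀

-- B is n^(2/3) rounded up to an integer.
module Ratio (n : ℕ) .{{_ : NonZero n}} (B : ℕ) (n²≤B³ : n * n ≤ B * B * B) (B³≤8n² : B * B * B ≤ 8 * (n * n)) where
  open ≤-Reasoning

  1≤B : 1 ≤ B
  1≤B = n≢0⇒n>0 λ { refl → <⇒≱ (*-mono-≤ (>-nonZero⁻¹ n) (>-nonZero⁻¹ n)) n²≤B³ }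

  -- m^6 ≤ n^2 ≤ B^3 gives m^2 ≤ B. In m^2 + 4 m + 4 the three terms are at most B, 4 B and 4 B. The
  -- 2 accounts for the endpoints of the request.
  thin-bound : ∀ m → m * m * m ≤ n → (2 + m) * (2 + m) ≤ 9 * B
  thin-bound m m³≤n = begin
    (2 + m) * (2 + m)  ≡⟨ lemma m ⟩
    m * m + 4 * m + 4  ≤⟨ +-mono-≤ (+-mono-≤ m²≤B (*-monoʳ-≤ 4 (≤-trans (m≤m² m) m²≤B))) (*-monoʳ-≤ 4 1≤B) ⟩
    B + 4 * B + 4 * B  ≡⟨ lemma′ B ⟩
    9 * B  ∎
    where
    lemma : ∀ m → (2 + m) * (2 + m) ≡ m * m + 4 * m + 4
    lemma = solve-∀
    lemma′ : ∀ b → b + 4 * b + 4 * b ≡ 9 * b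
    lemma′ = solve-∀
    lemma″ : ∀ m → m * m * (m * m) * (m * m) ≡ m * m * m * (m * m * m)
    lemma″ = solve-∀
    m≤m² : ∀ m → m ≤ m * m
    m≤m² zero    = z≤n
    m≤m² (suc m) = m≤m*n (suc m) (suc m)
    m²≤B : m * m ≤ B
    m²≤B = cube-cancel-≤ (≤-trans (≤-reflexive (lemma″ m)) (≤-trans (*-mono-≤ m³≤n m³≤n) n²≤B³))

  -- With ℓ the logarithm, 2 h + 9 B ≤ 11 B + 8 ℓ B ≤ 11 (1 + ℓ) B. Cubing turns B^3 into 8 n^2, and
  -- the cube root 2 of 8 makes 22 of 11.
  within : ∀ {h cost OPT} → h ≤ suc (4 * ⌈log₂ n ⌉ * B) → cost ≤ OPT * (h + h + 9 * B) → Within 22 1 n cost OPT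
  within {h} {cost} {OPT} h≤ cost≤ = begin
    cost ^ 3  ≤⟨ ^-monoˡ-≤ 3 cost≤′ ⟩
    (11 * (1 + ℓ) * OPT * B) ^ 3  ≡⟨ lemma₁ (11 * (1 + ℓ) * OPT) B ⟩
    (11 * (1 + ℓ) * OPT) ^ 3 * (B * B * B)  ≤⟨ *-monoʳ-≤ ((11 * (1 + ℓ) * OPT) ^ 3) B³≤8n² ⟩
    (11 * (1 + ℓ) * OPT) ^ 3 * (8 * (n * n))  ≡⟨ lemma₂ (11 * (1 + ℓ) * OPT) n ⟩
    (2 * (11 * (1 + ℓ) * OPT)) ^ 3 * n ^ 2  ≡⟨ cong (λ a → a ^ 3 * n ^ 2) (double ℓ OPT) ⟩
    (22 * (1 + ℓ) ^ 1 * OPT) ^ 3 * n ^ 2  ∎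
    where
    ℓ = ⌈log₂ n ⌉
    lemma₁ : ∀ a b → a * b * (a * b * (a * b * 1)) ≡ a * (a * (a * 1)) * (b * b * b)
    lemma₁ = solve-∀
    lemma₂ : ∀ a n → a * (a * (a * 1)) * (8 * (n * n)) ≡ 2 * a * (2 * a * (2 * a * 1)) * (n * (n * 1))
    lemma₂ = solve-∀
    double : ∀ l o → 2 * (11 * (1 + l) * o) ≡ 22 * ((1 + l) * 1) * o
    double = solve-∀
    lemma₃ : ∀ l b → b + 4 * l * b + (b + 4 * l * b) + 9 * b + 3 * l * b ≡ 11 * (1 + l) * b
    lemma₃ = solve-∀
    lemma₄ : ∀ o l b → o * (11 * (1 + l) * b) ≡ 11 * (1 + l) * o * b
    lemma₄ = solve-∀
    h≤′ : h ≤ B + 4 * ℓ * B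
    h≤′ = ≤-trans h≤ (+-monoˡ-≤ (4 * ℓ * B) 1≤B)
    cost≤′ : cost ≤ 11 * (1 + ℓ) * OPT * B
    cost≤′ = begin
      cost  ≤⟨ cost≤ ⟩
      OPT * (h + h + 9 * B)  ≤⟨ *-monoʳ-≤ OPT (+-monoˡ-≤ (9 * B) (+-mono-≤ h≤′ h≤′)) ⟩
      OPT * (B + 4 * ℓ * B + (B + 4 * ℓ * B) + 9 * B)  ≤⟨ *-monoʳ-≤ OPT (m≤m+n _ (3 * ℓ * B)) ⟩
      OPT * (B + 4 * ℓ * B + (B + 4 * ℓ * B) + 9 * B + 3 * ℓ * B)  ≡⟨ cong (OPT *_) (lemma₃ ℓ B) ⟩
      OPT * (11 * (1 + ℓ) * B)  ≡⟨ lemma₄ OPT ℓ B ⟩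
      11 * (1 + ℓ) * OPT * B  ∎

-- Boolean tests, and the input as encoded data

==⇒≡ : ∀ {m n} → T (m == n) → m ≡ n
==⇒≡ {m} {n} t = let (p , q) = to T-∧ t in ≤-antisym (≤ᵇ⇒≤ m n p) (≤ᵇ⇒≤ n m q)

==-refl : ∀ m → T (m == m)
==-refl m = from T-∧ (≤⇒≤ᵇ {m} ≤-refl , ≤⇒≤ᵇ {m} ≤-refl)

==²⇒≡ : ∀ {k l} → T (k ==² l) → k ≡ l
==²⇒≡ {k} {l} t = let (p , q) = to T-∧ t in
  cong₂ _,_ (==⇒≡ {proj₁ k} {proj₁ l} p) (==⇒≡ {proj₂ k} {proj₂ l} q)

==²-refl : ∀ k → T (k ==² k)
==²-refl (u , v) = from T-∧ (==-refl u , ==-refl v)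

member⇒∈ : ∀ {k} B → T (member k B) → k ∈ B
member⇒∈ {k} B t = Any.map (λ {l} → sym ∘ ==²⇒≡ {l} {k}) (Any.any⁻ (_==² k) B t)

∈⇒member : ∀ {k B} → k ∈ B → T (member k B)
∈⇒member {k} k∈B = Any.any⁺ (_==² k) (Any.map (λ { refl → ==²-refl k }) k∈B)

element⇒∈ : ∀ {v} M → T (element v M) → v ∈ M
element⇒∈ {v} M t = Any.map (λ {w} → sym ∘ ==⇒≡ {w} {v}) (Any.any⁻ (_== v) M t)

∈⇒element : ∀ {v M} → v ∈ M → T (element v M)
∈⇒element {v} v∈M = Any.any⁺ (_== v) (Any.map (λ { refl → ==-refl v }) v∈M)

∈-filterᵇ⁺ : ∀ {Y : Set} (p : Y → Bool) {y ys} → y ∈ ys → T (p y) → y ∈ filterᵇ p ys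
∈-filterᵇ⁺ p = ∈-filter⁺ (T? ∘ p)

∈-filterᵇ⁻ : ∀ {Y : Set} (p : Y → Bool) {y} ys → y ∈ filterᵇ p ys → y ∈ ys × T (p y)
∈-filterᵇ⁻ p ys = ∈-filter⁻ (T? ∘ p)

rawℤ : ℤ → ⟦ Int ⟧
rawℤ (pos m)    = false , m
rawℤ -[1+ m ] = true , m

rawℚ : ℚ → ⟦ Rat ⟧
rawℚ q = rawℤ (↥ q) , rawℤ (↧ q)

encode-rawℤ : ∀ i → enc Int (rawℤ i) ≡ encodeℤ i
encode-rawℤ (pos m)    = refl
encode-rawℤ -[1+ m ] = refl

encode-rawℚ : ∀ q → enc Rat (rawℚ q) ≡ encodeℚ q
encode-rawℚ q = cong₂ _∙_ (encode-rawℤ (↥ q)) (encode-rawℤ (↧ q))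

rawGraph : Graph n → ⟦ RawGraph ⟧
rawGraph {n} G = map (λ u → map (λ v → Maybe.map rawℚ (len G u v)) (allFin n)) (allFin n)

rawRequest : Request n → ⟦ RawRequest ⟧
rawRequest (request s t d) = toℕ s , (toℕ t , rawℚ d)

encodeList-map : {Y Z : Set} (e : Z → Tree) (f : Y → Z) (ys : List Y) → encodeList e (map f ys) ≡ encodeList (e ∘ f) ys
encodeList-map e f []       = refl
encodeList-map e f (y ∷ ys) = cong (e (f y) ∙_) (encodeList-map e f ys)

encodeList-cong : {Y : Set} {e e′ : Y → Tree} → (∀ y → e y ≡ e′ y) → ∀ ys → encodeList e ys ≡ encodeList e′ ys
encodeList-cong eq []       = refl
encodeList-cong eq (y ∷ ys) = cong₂ _∙_ (eq y) (encodeList-cong eq ys)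

encode-rawGraph : (G : Graph n) → enc RawGraph (rawGraph G) ≡ encodeGraph G
encode-rawGraph {n} G = trans (encodeList-map _ _ (allFin n)) (encodeList-cong
  (λ u → trans (encodeList-map _ _ (allFin n)) (encodeList-cong (λ v → cell (len G u v)) (allFin n))) (allFin n))
  where
  cell : ∀ m → enc (opt Int Int) (Maybe.map rawℚ m) ≡ maybe′ encodeℚ nil m
  cell nothing  = refl
  cell (just q) = encode-rawℚ q

encode-rawRequest : (r : Request n) → enc RawRequest (rawRequest r) ≡ encodeRequest r
encode-rawRequest (request s t d) = cong (λ w → encodeFin s ∙ (encodeFin t ∙ w)) (encode-rawℚ d)

encodeℕ-injective : ∀ {k m} → encodeℕ k ≡ encodeℕ m → k ≡ m
encodeℕ-injective {k} {m} eq = trans (sym (ℕᵇ.toℕ-fromℕ k)) (trans (cong ℕᵇ.toℕ (go _ _ eq)) (ℕᵇ.toℕ-fromℕ m))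
  where
  parts : ∀ {p q r t} → p ∙ q ≡ r ∙ t → p ≡ r × q ≡ t
  parts refl = refl , refl
  go : ∀ k m → encodeℕᵇ k ≡ encodeℕᵇ m → k ≡ m
  go ℕᵇ.zero  ℕᵇ.zero  _  = refl
  go 2[1+ k ] 2[1+ m ] eq = cong 2[1+_] (go k m (proj₂ (parts eq)))
  go 1+[2 k ] 1+[2 m ] eq = cong 1+[2_] (go k m (proj₂ (parts eq)))
  go ℕᵇ.zero  2[1+ m ] ()
  go ℕᵇ.zero  1+[2 m ] ()
  go 2[1+ k ] ℕᵇ.zero  ()
  go 2[1+ k ] 1+[2 m ] ()
  go 1+[2 k ] ℕᵇ.zero  ()
  go 1+[2 k ] 2[1+ m ] ()

-- Lengths over a common denominator

enumerate-tabulate : {Y : Set} (f : Fin n → Y) → enumerate (tabulate f) ≡ tabulate (λ i → toℕ i , f i)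
enumerate-tabulate {Y = Y} f =
  trans (cong reverse (trans (go 0 f []) (List.++-identityʳ _))) (List.reverse-involutive _)
  where
  go : ∀ {n} k (f : Fin n → Y) out →
    proj₂ (foldl (λ st y → suc (proj₁ st) , (proj₁ st , y) ∷ proj₂ st) (k , out) (tabulate f)) ≡
    reverse (tabulate (λ i → k + toℕ i , f i)) ++ out
  go {zero}  k f out = refl
  go {suc n} k f out = begin
    _  ≡⟨ go (suc k) (f ∘ Fin.suc) _ ⟩
    reverse (tabulate (λ i → suc k + toℕ i , f (Fin.suc i))) ++ (k , f Fin.zero) ∷ out
      ≡⟨ cong₂ (λ ys k′ → reverse ys ++ (k′ , f Fin.zero) ∷ out) (List.tabulate-cong (λ i → cong (_, f (Fin.suc i)) (sym (+-suc k (toℕ i))))) (sym (+-identityʳ k)) ⟩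
    reverse rest ++ (k + 0 , f Fin.zero) ∷ out  ≡⟨ List.++-assoc (reverse rest) [ k + 0 , f Fin.zero ] out ⟨
    (reverse rest ++ [ k + 0 , f Fin.zero ]) ++ out  ≡⟨ cong (_++ out) (List.unfold-reverse _ rest) ⟨
    reverse ((k + 0 , f Fin.zero) ∷ rest) ++ out  ∎
    where
    open ≡-Reasoning
    rest = tabulate (λ i → k + suc (toℕ i) , f (Fin.suc i))

-- The two products differ only in the factor belonging to k, which is p in one and q in the other;
-- as keys are distinct, no second factor is replaced.
numerator-scales : ∀ {es k p q} → AllPairs (λ e e′ → proj₁ e ≢ proj₁ e′) es → (k , (p , q)) ∈ es →
  numerator es k * q ≡ p * denominator es
numerator-scales {e ∷ es} {k} {p} {q} (e≢ ∷ _) (here refl) = begin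
  (if k ==² k then p else q) * numerator es k * q
    ≡⟨ cong (λ b → (if b then p else q) * numerator es k * q) (to T-≡ (==²-refl k)) ⟩
  p * numerator es k * q  ≡⟨ cong (λ x → p * x * q) (others es e≢) ⟩
  p * denominator es * q  ≡⟨ lemma p (denominator es) q ⟩
  p * (q * denominator es)  ∎
  where
  open ≡-Reasoning
  lemma : ∀ p d q → p * d * q ≡ p * (q * d)
  lemma = solve-∀
  others : ∀ es → All (λ e′ → k ≢ proj₁ e′) es → numerator es k ≡ denominator es
  others []       []         = refl
  others (e ∷ es) (k≢ ∷ k≢s) = cong₂ _*_
    (cong (λ b → if b then proj₁ (proj₂ e) else proj₂ (proj₂ e)) (¬T⇒≡ (k≢ ∘ sym ∘ ==²⇒≡ {proj₁ e} {k}))) (others es k≢s)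
numerator-scales {e@(k′ , (p′ , q′)) ∷ es} {k} {p} {q} (e≢ ∷ es≢) (there k∈es) = begin
  (if k′ ==² k then p′ else q′) * numerator es k * q
    ≡⟨ cong (λ b → (if b then p′ else q′) * numerator es k * q) (¬T⇒≡ (All.lookup e≢ k∈es ∘ ==²⇒≡ {k′} {k})) ⟩
  q′ * numerator es k * q  ≡⟨ *-assoc q′ _ q ⟩
  q′ * (numerator es k * q)  ≡⟨ cong (q′ *_) (numerator-scales es≢ k∈es) ⟩
  q′ * (p * denominator es)  ≡⟨ lemma q′ p (denominator es) ⟩
  p * (q′ * denominator es)  ∎
  where
  open ≡-Reasoning
  lemma : ∀ a b c → a * (b * c) ≡ b * (a * c)
  lemma = solve-∀

ι : ℕ → ℚ
ι m = ℚ.fromℚᵘ (mkℚᵘ (pos m) 0)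

private
  toℚᵘ-ι : ∀ m → ℚ.toℚᵘ (ι m) ℚᵘ.≃ mkℚᵘ (pos m) 0
  toℚᵘ-ι m = ℚ.toℚᵘ-fromℚᵘ (mkℚᵘ (pos m) 0)

ι-+ : ∀ k m → ι (k + m) ≡ ι k ℚ.+ ι m
ι-+ k m = ℚ.toℚᵘ-injective (begin
  ℚ.toℚᵘ (ι (k + m))  ≈⟨ toℚᵘ-ι (k + m) ⟩
  mkℚᵘ (pos (k + m)) 0  ≈⟨ *≡* (cong (ℤ._* pos 1) (trans (ℤ.pos-+ k m) (sym (cong₂ ℤ._+_ (ℤ.*-identityʳ (pos k)) (ℤ.*-identityʳ (pos m)))))) ⟩
  mkℚᵘ (pos k) 0 ℚᵘ.+ mkℚᵘ (pos m) 0  ≈⟨ ℚᵘ.+-cong (toℚᵘ-ι k) (toℚᵘ-ι m) ⟨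
  ℚ.toℚᵘ (ι k) ℚᵘ.+ ℚ.toℚᵘ (ι m)  ≈⟨ ℚ.toℚᵘ-homo-+ (ι k) (ι m) ⟨
  ℚ.toℚᵘ (ι k ℚ.+ ι m)  ∎)
  where open ℚᵘ.≃-Reasoning

ι-* : ∀ k m → ι (k * m) ≡ ι k ℚ.* ι m
ι-* k m = ℚ.toℚᵘ-injective (begin
  ℚ.toℚᵘ (ι (k * m))  ≈⟨ toℚᵘ-ι (k * m) ⟩
  mkℚᵘ (pos (k * m)) 0  ≈⟨ *≡* (cong (ℤ._* pos 1) (ℤ.pos-* k m)) ⟩
  mkℚᵘ (pos k) 0 ℚᵘ.* mkℚᵘ (pos m) 0  ≈⟨ ℚᵘ.*-cong (toℚᵘ-ι k) (toℚᵘ-ι m) ⟨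
  ℚ.toℚᵘ (ι k) ℚᵘ.* ℚ.toℚᵘ (ι m)  ≈⟨ ℚ.toℚᵘ-homo-* (ι k) (ι m) ⟨
  ℚ.toℚᵘ (ι k ℚ.* ι m)  ∎)
  where open ℚᵘ.≃-Reasoning

ι-mono : ∀ {k m} → k ≤ m → ι k ℚ.≤ ι m
ι-mono {k} {m} k≤m = ℚ.toℚᵘ-cancel-≤ (begin
  ℚ.toℚᵘ (ι k)  ≃⟨ toℚᵘ-ι k ⟩
  mkℚᵘ (pos k) 0  ≤⟨ *≤* (ℤ.*-monoʳ-≤-nonNeg (pos 1) (ℤ.+≤+ k≤m)) ⟩
  mkℚᵘ (pos m) 0  ≃⟨ toℚᵘ-ι m ⟨
  ℚ.toℚᵘ (ι m)  ∎)
  where open ℚᵘ.≤-Reasoning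

ι-cancel : ∀ {k m} → ι k ℚ.≤ ι m → k ≤ m
ι-cancel {k} {m} le with (begin
  mkℚᵘ (pos k) 0  ≃⟨ toℚᵘ-ι k ⟨
  ℚ.toℚᵘ (ι k)  ≤⟨ ℚ.toℚᵘ-mono-≤ le ⟩
  ℚ.toℚᵘ (ι m)  ≃⟨ toℚᵘ-ι m ⟩
  mkℚᵘ (pos m) 0  ∎)
  where open ℚᵘ.≤-Reasoning
... | *≤* le′ = ℤ.drop‿+≤+ (ℤ.*-cancelʳ-≤-pos (pos k) (pos m) (pos 1) le′)

ι-positive : ∀ m → .{{NonZero m}} → ℚ.Positive (ι m)
ι-positive (suc m) = ℚ.positive (ℚ.<-≤-trans (ℚ.*<* (ℤ.+<+ (s≤s z≤n))) (ι-mono {1} {suc m} (s≤s z≤n)))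

*-ι-denominator : ∀ q {k m} → ↥ q ≡ pos k → ↧ q ≡ pos m → q ℚ.* ι m ≡ ι k
*-ι-denominator q@(mkℚ _ d _) {k} refl refl = ℚ.toℚᵘ-injective (begin
  ℚ.toℚᵘ (q ℚ.* ι (suc d))  ≈⟨ ℚ.toℚᵘ-homo-* q (ι (suc d)) ⟩
  mkℚᵘ (pos k) d ℚᵘ.* ℚ.toℚᵘ (ι (suc d))  ≈⟨ ℚᵘ.*-congˡ {mkℚᵘ (pos k) d} (toℚᵘ-ι (suc d)) ⟩
  mkℚᵘ (pos k) d ℚᵘ.* mkℚᵘ (pos (suc d)) 0  ≈⟨ *≡* (trans (ℤ.*-identityʳ _) (cong (λ e → pos k ℤ.* pos e) (sym (*-identityʳ (suc d))))) ⟩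
  mkℚᵘ (pos k) 0  ≈⟨ toℚᵘ-ι k ⟨
  ℚ.toℚᵘ (ι k)  ∎)
  where open ℚᵘ.≃-Reasoning

-- Analysis of the greedy hitting set

indicator : Bool → ℕ
indicator b = if b then 1 else 0

length-filterᵇ-∷ : ∀ {Y : Set} (p : Y → Bool) y ys → length (filterᵇ p (y ∷ ys)) ≡ indicator (p y) + length (filterᵇ p ys)
length-filterᵇ-∷ p y ys with p y
... | true  = refl
... | false = refl

sum-map-+ : ∀ {Y : Set} (f g : Y → ℕ) ys → sum (map (λ y → f y + g y) ys) ≡ sum (map f ys) + sum (map g ys)
sum-map-+ f g []       = refl
sum-map-+ f g (y ∷ ys) = trans (cong (f y + g y +_) (sum-map-+ f g ys)) (lemma (f y) (g y) (sum (map f ys)) (sum (map g ys)))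
  where
  lemma : ∀ a b c d → a + b + (c + d) ≡ a + c + (b + d)
  lemma = solve-∀

sum-indicator : ∀ {Y : Set} (p : Y → Bool) ys → sum (map (indicator ∘ p) ys) ≡ length (filterᵇ p ys)
sum-indicator p []       = refl
sum-indicator p (y ∷ ys) = trans (cong (indicator (p y) +_) (sum-indicator p ys)) (sym (length-filterᵇ-∷ p y ys))

double-count : ∀ {Y Z : Set} (p : Y → Z → Bool) ys zs →
  sum (map (λ z → length (filterᵇ (λ y → p y z) ys)) zs) ≡ sum (map (λ y → length (filterᵇ (p y) zs)) ys)
double-count p [] []       = refl
double-count p [] (_ ∷ zs) = double-count p [] zs
double-count p (y ∷ ys) zs = begin
  sum (map (λ z → length (filterᵇ (λ y → p y z) (y ∷ ys))) zs)
    ≡⟨ cong sum (List.map-cong (λ z → length-filterᵇ-∷ (λ y → p y z) y ys) zs) ⟩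
  sum (map (λ z → indicator (p y z) + length (filterᵇ (λ y → p y z) ys)) zs)
    ≡⟨ sum-map-+ (indicator ∘ p y) _ zs ⟩
  sum (map (indicator ∘ p y) zs) + sum (map (λ z → length (filterᵇ (λ y → p y z) ys)) zs)
    ≡⟨ cong₂ _+_ (sum-indicator (p y) zs) (double-count p ys zs) ⟩
  length (filterᵇ (p y) zs) + sum (map (λ y → length (filterᵇ (p y) zs)) ys)  ∎
  where open ≡-Reasoning

sum-≤ : ∀ {Y : Set} (f : Y → ℕ) N ys → (∀ {y} → y ∈ ys → f y ≤ N) → sum (map f ys) ≤ length ys * N
sum-≤ f N []       le = z≤n
sum-≤ f N (y ∷ ys) le = +-mono-≤ (le (here refl)) (sum-≤ f N ys (le ∘ there))

length-filterᵇ-split : ∀ {Y : Set} (p : Y → Bool) ys →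
  length (filterᵇ (not ∘ p) ys) + length (filterᵇ p ys) ≡ length ys
length-filterᵇ-split p [] = refl
length-filterᵇ-split p (y ∷ ys) with p y
... | true  = trans (+-suc _ _) (cong suc (length-filterᵇ-split p ys))
... | false = cong suc (length-filterᵇ-split p ys)

module Greedy (V : List ℕ) (H : List ⟦ Hop ⟧) where

  Thick : ⟦ Hop ⟧ → Set
  Thick τ = T (thick V (filterᵇ (hit H τ) V))

  best-maximal : ∀ R {v} → v ∈ V → count H R v ≤ count H R (best H R V)
  best-maximal R = proj₂ (go 0 V)
    where
    go : ∀ b vs → let m = foldl (λ b v → if count H R b ≤ᵇ count H R v then v else b) b vs in
      count H R b ≤ count H R m × (∀ {v} → v ∈ vs → count H R v ≤ count H R m)
    go b []       = ≤-refl , λ ()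
    go b (w ∷ vs) with count H R b ≤ᵇ count H R w in eq | go (if count H R b ≤ᵇ count H R w then w else b) vs
    ... | true  | w≤ , vs≤ = ≤-trans (≤ᵇ⇒≤ _ _ (subst T (sym eq) _)) w≤ , λ { (here refl) → w≤ ; (there v∈) → vs≤ v∈ }
    ... | false | b≤ , vs≤ = b≤ , λ { (here refl) → ≤-trans (≰⇒≥ λ le → subst T eq (≤⇒≤ᵇ le)) b≤ ; (there v∈) → vs≤ v∈ }

  module Analysis .{{_ : NonZero (length V)}} (B : ℕ) .{{_ : NonZero B}}
                  (n²≤B³ : length V * length V ≤ B * B * B) where

    private
      N : ℕ
      N = length V

    -- (m B)^3 = m^3 B^3 ≥ N * N^2 = N^3. So a thick set contains at least the fraction 1 / B of all
    -- vertices.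
    large : ∀ m → N < m * m * m → N ≤ m * B
    large m N<m³ = ≮⇒≥ λ mB<N → <⇒≱ (cube mB<N) (begin
      N * N * N  ≡⟨ *-assoc N N N ⟩
      N * (N * N)  ≤⟨ *-mono-≤ (<⇒≤ N<m³) n²≤B³ ⟩
      m * m * m * (B * B * B)  ≡⟨ lemma m B ⟩
      m * B * (m * B) * (m * B)  ∎)
      where
      open ≤-Reasoning
      lemma : ∀ m b → m * m * m * (b * b * b) ≡ m * b * (m * b) * (m * b)
      lemma = solve-∀
      cube : ∀ {a b} → a < b → a * a * a < b * b * b
      cube a<b = *-mono-< (*-mono-< a<b a<b) a<b

    thick⇒large : ∀ {τ} → Thick τ → N ≤ length (filterᵇ (hit H τ) V) * B
    thick⇒large {τ} th = large m (≰⇒> λ le → not-both (≤⇒≤ᵇ le) th)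
      where
      m = length (filterᵇ (hit H τ) V)
      not-both : ∀ {b} → T b → T (not b) → ⊥
      not-both {true} _ ()

    -- Averaging: the best vertex hits at least a fraction 1 / B of the remaining sets.
    best-hits : ∀ R → All Thick R → length R ≤ count H R (best H R V) * B
    best-hits R ths = *-cancelˡ-≤ N (begin
      N * length R  ≡⟨ *-comm N _ ⟩
      length R * N  ≤⟨ sum-large R ths ⟩
      sum (map (λ τ → length (filterᵇ (hit H τ) V)) R) * B
                                                ≡⟨ cong (_* B) (double-count (hit H) R V) ⟨
      sum (map (count H R) V) * B  ≤⟨ *-monoˡ-≤ B (sum-≤ (count H R) _ V (best-maximal R)) ⟩
      N * count H R (best H R V) * B  ≡⟨ *-assoc N _ B ⟩
      N * (count H R (best H R V) * B)  ∎)
      where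
      open ≤-Reasoning
      sum-large : ∀ R → All Thick R → length R * N ≤ sum (map (λ τ → length (filterᵇ (hit H τ) V)) R) * B
      sum-large []      []         = z≤n
      sum-large (τ ∷ R) (th ∷ ths) = begin
        N + length R * N  ≤⟨ +-mono-≤ (thick⇒large {τ} th) (sum-large R ths) ⟩
        length (filterᵇ (hit H τ) V) * B + sum (map (λ τ → length (filterᵇ (hit H τ) V)) R) * B
                                                ≡⟨ *-distribʳ-+ B (length (filterᵇ (hit H τ) V)) _ ⟨
        (length (filterᵇ (hit H τ) V) + sum (map (λ τ → length (filterᵇ (hit H τ) V)) R)) * B ∎

    -- If each step removes at least r / B of the r remaining sets, fewer than k steps are left:
    -- B steps halve the number.
    Steps≤ : ℕ → ℕ → Set
    Steps≤ k r = r ≡ 0 ⊎ (∃[ j ] ∃[ i ] r * B ≤ 2 ^ j * (B + i) × j * B + i < k)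

    Steps≤-start : ∀ {r} j → r ≤ 2 ^ j → Steps≤ (suc (j * B)) r
    Steps≤-start {r} j r≤ = inj₂ (j , 0 , (begin
      r * B  ≤⟨ *-monoˡ-≤ B r≤ ⟩
      2 ^ j * B  ≡⟨ cong (2 ^ j *_) (+-identityʳ B) ⟨
      2 ^ j * (B + 0)  ∎) , s≤s (≤-reflexive (+-identityʳ (j * B))))
      where open ≤-Reasoning

    -- 2^j * (B + i) / B interpolates linearly between 2^j and 2^(j+1). If r > 2^j, then c * B ≥ r >
    -- 2^j, so r * B drops by at least 2^j, as the bound does when i drops by one. If r ≤ 2^j, the
    -- rest of the block is skipped. At i = 0 the bound is read as the upper end i = B of block j -
    -- 1; for j = 0 it says r ≤ 1, and the step removes the last set.
    Steps≤-step : ∀ {k r r′ c} → Steps≤ (suc k) r → r′ + c ≡ r → r ≤ c * B → 1 ≤ r → Steps≤ k r′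
    Steps≤-step (inj₁ refl) _ _ ()
    Steps≤-step {k} {r} {r′} {c} (inj₂ (j , i , le , lt)) eq r≤ 1≤r = go j i le (s≤s⁻¹ lt)
      where
      open ≤-Reasoning
      1≤c : 1 ≤ c
      1≤c = n≢0⇒n>0 λ { refl → <⇒≱ 1≤r r≤ }
      go : ∀ j i → r * B ≤ 2 ^ j * (B + i) → j * B + i ≤ k → Steps≤ k r′
      go zero zero le lt = inj₁ (n≤0⇒n≡0 (+-cancelʳ-≤ c r′ 0 (begin
        r′ + c  ≡⟨ eq ⟩
        r  ≤⟨ *-cancelʳ-≤ r 1 B (≤-trans le (≤-reflexive (cong (_+ 0) (+-identityʳ B)))) ⟩
        1  ≤⟨ 1≤c ⟩
        c  ∎)))
      go (suc j) zero le lt = halved B refl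
        where
        halved : ∀ b → b ≡ B → Steps≤ k r′
        halved zero    refl = ⊥-elim (≢-nonZero⁻¹ B refl)
        halved (suc b) e    = go j (suc b) (begin
          r * B  ≤⟨ le ⟩
          2 * 2 ^ j * (B + 0)  ≡⟨ lemma (2 ^ j) B ⟩
          2 ^ j * (B + B)  ≡⟨ cong (λ x → 2 ^ j * (B + x)) (sym e) ⟩
          2 ^ j * (B + suc b)  ∎)
          (begin
          j * B + suc b  ≡⟨ cong (j * B +_) e ⟩
          j * B + B  ≡⟨ +-comm (j * B) B ⟩
          B + j * B  ≡⟨ +-identityʳ _ ⟨
          B + j * B + 0  ≤⟨ lt ⟩
          k  ∎)
          where
          lemma : ∀ p b → 2 * p * (b + 0) ≡ p * (b + b)
          lemma = solve-∀
      go j (suc i) le lt with r ≤? 2 ^ j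
      ... | yes r≤2^j = go j 0 (≤-trans (*-monoˡ-≤ B r≤2^j) (≤-reflexive (cong (2 ^ j *_) (sym (+-identityʳ B)))))
                               (≤-trans (+-monoʳ-≤ (j * B) z≤n) lt)
      ... | no  r≰2^j = inj₂ (j , i , +-cancelʳ-≤ (2 ^ j) (r′ * B) (2 ^ j * (B + i)) (begin
        r′ * B + 2 ^ j  ≤⟨ +-monoʳ-≤ (r′ * B) (≤-trans (≰⇒≥ r≰2^j) r≤) ⟩
        r′ * B + c * B  ≡⟨ *-distribʳ-+ B r′ c ⟨
        (r′ + c) * B  ≡⟨ cong (_* B) eq ⟩
        r * B  ≤⟨ le ⟩
        2 ^ j * (B + suc i)  ≡⟨ cong (2 ^ j *_) (+-suc B i) ⟩
        2 ^ j * suc (B + i)  ≡⟨ *-suc (2 ^ j) (B + i) ⟩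
        2 ^ j + 2 ^ j * (B + i)  ≡⟨ +-comm (2 ^ j) _ ⟩
        2 ^ j * (B + i) + 2 ^ j  ∎) , ≤-trans (≤-reflexive (sym (+-suc (j * B) i))) lt)

    remove : List ⟦ Hop ⟧ → List ⟦ Hop ⟧
    remove R = filterᵇ (λ τ → not (hit H τ (best H R V))) R

    remove-thick : ∀ {R} → All Thick R → All Thick (remove R)
    remove-thick {R} ths = All.tabulate λ τ∈ → All.lookup ths (proj₁ (∈-filterᵇ⁻ _ R τ∈))

    remove-length : ∀ R → length (remove R) + count H R (best H R V) ≡ length R
    remove-length R = length-filterᵇ-split (λ τ → hit H τ (best H R V)) R

    -- Once no set is left, rounds add no hub; what counts is k, not the length of the clock.
    greedy-length : ∀ clock R hs k → All Thick R → Steps≤ k (length R) →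
      length (proj₂ (greedy V H clock (R , hs))) ≤ length hs + k
    greedy-length []          R           hs k ths st = m≤m+n _ k
    greedy-length (_ ∷ clock) []          hs k ths st = greedy-length clock [] hs k ths st
    greedy-length (_ ∷ clock) (τ ∷ R) hs zero ths (inj₂ (_ , _ , _ , ()))
    greedy-length (_ ∷ clock) R@(τ ∷ R′) hs (suc k) ths st =
      ≤-trans (greedy-length clock (remove R) (best H R V ∷ hs) k (remove-thick ths)
                (Steps≤-step st (remove-length R) (best-hits R ths) (s≤s z≤n)))
              (≤-reflexive (sym (+-suc (length hs) k)))

    hubs-length : ∀ j → length H ≤ 2 ^ j → length (hubs V H) ≤ suc (j * B)
    hubs-length j le = greedy-length (candidates V H) (candidates V H) [] (suc (j * B))
      (All.tabulate λ τ∈ → proj₂ (∈-filterᵇ⁻ _ H τ∈))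
      (Steps≤-start j (≤-trans (List.length-filter _ H) le))

    Hit : ⟦ Hop ⟧ → List ℕ → Set
    Hit τ hs = ∃[ h ] h ∈ hs × T (hit H τ h)

    -- The best vertex hits at least one remaining set, so sets run out no later than the clock. A
    -- set leaves R only when it is hit by the vertex just chosen.
    greedy-hits : ∀ clock R hs τ → All Thick R → length R ≤ length clock → τ ∈ R ⊎ Hit τ hs →
      Hit τ (proj₂ (greedy V H clock (R , hs)))
    greedy-hits []          []         hs τ ths le (inj₁ ())
    greedy-hits []          []         hs τ ths le (inj₂ h) = h
    greedy-hits (_ ∷ clock) []         hs τ ths le h = greedy-hits clock [] hs τ ths z≤n h
    greedy-hits (_ ∷ clock) R@(_ ∷ _) hs τ ths le h =
      greedy-hits clock (remove R) (best H R V ∷ hs) τ (remove-thick ths) (s≤s⁻¹ (≤-trans shorter le)) (after h)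
      where
      1≤count : 1 ≤ count H R (best H R V)
      1≤count = n≢0⇒n>0 λ eq → <⇒≱ (s≤s z≤n) (≤-trans (best-hits R ths) (≤-reflexive (cong (_* B) eq)))
      shorter : suc (length (remove R)) ≤ length R
      shorter = ≤-trans (≤-trans (≤-reflexive (+-comm 1 _)) (+-monoʳ-≤ (length (remove R)) 1≤count)) (≤-reflexive (remove-length R))
      after : τ ∈ R ⊎ Hit τ hs → τ ∈ remove R ⊎ Hit τ (best H R V ∷ hs)
      after (inj₂ (h , h∈ , t)) = inj₂ (h , there h∈ , t)
      after (inj₁ τ∈) = decide (hit H τ (best H R V)) refl
        where
        decide : ∀ b → hit H τ (best H R V) ≡ b → τ ∈ remove R ⊎ Hit τ (best H R V ∷ hs)
        decide true  eq = inj₂ (best H R V , here refl , subst T (sym eq) _)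
        decide false eq = inj₁ (∈-filterᵇ⁺ (λ τ → not (hit H τ (best H R V))) τ∈ (subst (T ∘ not) (sym eq) _))

    hubs-hit : ∀ {τ} → τ ∈ H → Thick τ → Hit τ (hubs V H)
    hubs-hit {τ} τ∈ th = greedy-hits (candidates V H) (candidates V H) [] τ
      (All.tabulate λ τ∈ → proj₂ (∈-filterᵇ⁻ _ H τ∈)) ≤-refl (inj₁ (∈-filterᵇ⁺ (λ τ → thick V (filterᵇ (hit H τ) V)) τ∈ th))

-- Correctness of the Floyd-Warshall algorithm

dist-≤ : ∀ {∞ k y} W → (k , y) ∈ W → dist ∞ W k ≤ y
dist-≤ {k = k} (_ ∷ W) (here refl) rewrite to T-≡ (==²-refl k) = m⊓n≤m _ _
dist-≤ {k = k} (e ∷ W) (there k∈) with proj₁ e ==² k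
... | true  = ≤-trans (m⊓n≤n _ _) (dist-≤ W k∈)
... | false = dist-≤ W k∈

dist-attained : ∀ ∞ W k → dist ∞ W k ≡ ∞ ⊎ (k , dist ∞ W k) ∈ W
dist-attained ∞ []      k = inj₁ refl
dist-attained ∞ ((l , y) ∷ W) k with l ==² k in eq | dist-attained ∞ W k
... | false | inj₁ p = inj₁ p
... | false | inj₂ p = inj₂ (there p)
... | true  | rec with ⊓-sel y (dist ∞ W k)
...   | inj₁ min rewrite min = inj₂ (here (cong (_, y) (sym (==²⇒≡ {l} {k} (subst T (sym eq) _)))))
...   | inj₂ min rewrite min with rec
...     | inj₁ p = inj₁ p
...     | inj₂ p = inj₂ (there p)

∈-pairs : ∀ {V u v} → u ∈ V → v ∈ V → (u , v) ∈ pairs V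
∈-pairs {V} {u} u∈ v∈ = ∈-concatMap⁺ _ (lose u∈ (∈-map⁺ (u ,_) v∈))

module FloydWarshall (∞ : ℕ) (V : List ℕ) where

  -- Replaces the usual invariant on paths with restricted inner vertices. A round establishes the
  -- triangle inequality at its vertex and later rounds keep it; with all triangles, distances are
  -- below path lengths by induction on the path.
  Triangle : List ⟦ WEdge ⟧ → ℕ → Set
  Triangle D w = ∀ {u v} → u ∈ V → v ∈ V → dist ∞ D (u , v) ≤ dist ∞ D (u , w) + dist ∞ D (w , v)

  via : List ⟦ WEdge ⟧ → ℕ → ℕ → ℕ → ℕ
  via D w u v = dist ∞ D (u , v) ⊓ (dist ∞ D (u , w) + dist ∞ D (w , v))

  dist-through : ∀ D w {u v} → u ∈ V → v ∈ V → dist ∞ (through ∞ V D w) (u , v) ≡ via D w u v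
  dist-through D w {u} {v} u∈ v∈ = ≤-antisym
    (dist-≤ (through ∞ V D w) (∈-map⁺ (λ k → k , via D w (proj₁ k) (proj₂ k)) (∈-pairs u∈ v∈)))
    (below (dist-attained ∞ (through ∞ V D w) (u , v)))
    where
    below : dist ∞ (through ∞ V D w) (u , v) ≡ ∞ ⊎ ((u , v) , dist ∞ (through ∞ V D w) (u , v)) ∈ through ∞ V D w →
            via D w u v ≤ dist ∞ (through ∞ V D w) (u , v)
    below (inj₁ eq) = ≤-trans (m⊓n≤m _ _) (≤-trans (dist≤∞ ∞ D (u , v)) (≤-reflexive (sym eq)))
    below (inj₂ k∈) = same (∈-map⁻ (λ k → k , via D w (proj₁ k) (proj₂ k)) k∈)
      where
      same : ∃[ k ] k ∈ pairs V × ((u , v) , dist ∞ (through ∞ V D w) (u , v)) ≡ (k , via D w (proj₁ k) (proj₂ k)) →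
             via D w u v ≤ dist ∞ (through ∞ V D w) (u , v)
      same (k , _ , eq) = ≤-reflexive (trans (cong (λ k → via D w (proj₁ k) (proj₂ k)) (cong proj₁ eq)) (sym (cong proj₂ eq)))

  through-≤ : ∀ D w {u v} → u ∈ V → v ∈ V → dist ∞ (through ∞ V D w) (u , v) ≤ dist ∞ D (u , v)
  through-≤ D w u∈ v∈ = ≤-trans (≤-reflexive (dist-through D w u∈ v∈)) (m⊓n≤m _ _)

  -- If one leg is rerouted through w, the triangle at y is applied to the pair formed by w and the
  -- far endpoint. If both are, the closed walk w → y → w is cut out.
  through-triangle : ∀ D w {y} → w ∈ V → y ∈ V → Triangle D y → Triangle (through ∞ V D w) y
  through-triangle D w {y} w∈ y∈ tri {u} {v} u∈ v∈
    rewrite dist-through D w u∈ v∈ | dist-through D w u∈ y∈ | dist-through D w y∈ v∈ =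
    cases (⊓-sel (δ u y) (δ u w + δ w y)) (⊓-sel (δ y v) (δ y w + δ w v))
    where
    open ≤-Reasoning
    δ : ℕ → ℕ → ℕ
    δ u v = dist ∞ D (u , v)
    lemma₁ : ∀ a b c → a + b + c ≡ a + (b + c)
    lemma₁ = solve-∀
    lemma₂ : ∀ a b c d → a + b + (c + d) ≡ a + d + (b + c)
    lemma₂ = solve-∀
    cases : via D w u y ≡ δ u y ⊎ via D w u y ≡ δ u w + δ w y → via D w y v ≡ δ y v ⊎ via D w y v ≡ δ y w + δ w v →
            via D w u v ≤ via D w u y + via D w y v
    cases (inj₁ p) (inj₁ q) rewrite p | q = ≤-trans (m⊓n≤m _ _) (tri u∈ v∈)
    cases (inj₁ p) (inj₂ q) rewrite p | q = begin
      via D w u v  ≤⟨ m⊓n≤n (δ u v) _ ⟩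
      δ u w + δ w v  ≤⟨ +-monoˡ-≤ (δ w v) (tri u∈ w∈) ⟩
      δ u y + δ y w + δ w v  ≡⟨ lemma₁ (δ u y) (δ y w) (δ w v) ⟩
      δ u y + (δ y w + δ w v)  ∎
    cases (inj₂ p) (inj₁ q) rewrite p | q = begin
      via D w u v  ≤⟨ m⊓n≤n (δ u v) _ ⟩
      δ u w + δ w v  ≤⟨ +-monoʳ-≤ (δ u w) (tri w∈ v∈) ⟩
      δ u w + (δ w y + δ y v)  ≡⟨ lemma₁ (δ u w) (δ w y) (δ y v) ⟨
      δ u w + δ w y + δ y v  ∎
    cases (inj₂ p) (inj₂ q) rewrite p | q = begin
      via D w u v  ≤⟨ m⊓n≤n (δ u v) _ ⟩
      δ u w + δ w v  ≤⟨ m≤m+n _ _ ⟩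
      δ u w + δ w v + (δ w y + δ y w)  ≡⟨ lemma₂ (δ u w) (δ w y) (δ y w) (δ w v) ⟨
      δ u w + δ w y + (δ y w + δ w v)  ∎

  -- The round of w leaves distances to and from w unchanged, since a detour through w only adds the
  -- distance from w to itself.
  through-triangle-new : ∀ D w → w ∈ V → Triangle (through ∞ V D w) w
  through-triangle-new D w w∈ {u} {v} u∈ v∈
    rewrite dist-through D w u∈ v∈ | dist-through D w u∈ w∈ | dist-through D w w∈ v∈ =
    ≤-trans (m⊓n≤n (dist ∞ D (u , v)) _) (+-mono-≤
      (unchanged (m≤m+n (dist ∞ D (u , w)) (dist ∞ D (w , w)))) (unchanged (m≤n+m (dist ∞ D (w , v)) (dist ∞ D (w , w)))))
    where
    unchanged : ∀ {a b} → a ≤ b → a ≤ a ⊓ b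
    unchanged a≤b = ⊓-glb ≤-refl a≤b

  run-≤ : ∀ ws D → (∀ {w} → w ∈ ws → w ∈ V) → ∀ {u v} → u ∈ V → v ∈ V →
    dist ∞ (foldl (through ∞ V) D ws) (u , v) ≤ dist ∞ D (u , v)
  run-≤ []       D ws⊆ u∈ v∈ = ≤-refl
  run-≤ (w ∷ ws) D ws⊆ u∈ v∈ = ≤-trans (run-≤ ws (through ∞ V D w) (ws⊆ ∘ there) u∈ v∈) (through-≤ D w u∈ v∈)

  run-triangle : ∀ ws D → (∀ {w} → w ∈ ws → w ∈ V) → ∀ {y} → y ∈ V → Triangle D y →
    Triangle (foldl (through ∞ V) D ws) y
  run-triangle []       D ws⊆ y∈ tri = tri
  run-triangle (w ∷ ws) D ws⊆ y∈ tri =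
    run-triangle ws (through ∞ V D w) (ws⊆ ∘ there) y∈ (through-triangle D w (ws⊆ (here refl)) y∈ tri)

  run-triangle-new : ∀ ws D → (∀ {w} → w ∈ ws → w ∈ V) → ∀ {y} → y ∈ ws →
    Triangle (foldl (through ∞ V) D ws) y
  run-triangle-new (w ∷ ws) D ws⊆ (here refl) =
    run-triangle ws (through ∞ V D w) (ws⊆ ∘ there) (ws⊆ (here refl)) (through-triangle-new D w (ws⊆ (here refl)))
  run-triangle-new (w ∷ ws) D ws⊆ (there y∈)  = run-triangle-new ws (through ∞ V D w) (ws⊆ ∘ there) y∈

  shortest-≤ : ∀ W {u v} → u ∈ V → v ∈ V → dist ∞ (shortest ∞ V W) (u , v) ≤ dist ∞ W (u , v)
  shortest-≤ W = run-≤ V W id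

  shortest-triangle : ∀ W {y} → y ∈ V → Triangle (shortest ∞ V W) y
  shortest-triangle W = run-triangle-new V W id

  module Realised (P : ℕ → ℕ → ℕ → Set) (P-+ : ∀ {u v w y z} → P u v y → P v w z → P u w (y + z)) where

    -- `P u v y` will say that y is the scaled length of a path from u to v. An entry equal to the
    -- cap ∞ need not come from any path.
    Sound : List ⟦ WEdge ⟧ → Set
    Sound D = ∀ {u v} → u ∈ V → v ∈ V → dist ∞ D (u , v) < ∞ → P u v (dist ∞ D (u , v))

    through-sound : ∀ D w → w ∈ V → Sound D → Sound (through ∞ V D w)
    through-sound D w w∈ sound {u} {v} u∈ v∈ lt rewrite dist-through D w u∈ v∈
      with ⊓-sel (dist ∞ D (u , v)) (dist ∞ D (u , w) + dist ∞ D (w , v))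
    ... | inj₁ eq rewrite eq = sound u∈ v∈ lt
    ... | inj₂ eq rewrite eq = P-+ (sound u∈ w∈ (≤-<-trans (m≤m+n _ _) lt)) (sound w∈ v∈ (≤-<-trans (m≤n+m _ _) lt))

    shortest-sound : ∀ W → Sound W → Sound (shortest ∞ V W)
    shortest-sound W sound = go V W id sound
      where
      go : ∀ ws D → (∀ {w} → w ∈ ws → w ∈ V) → Sound D → Sound (foldl (through ∞ V) D ws)
      go []       D ws⊆ snd = snd
      go (w ∷ ws) D ws⊆ snd = go ws (through ∞ V D w) (ws⊆ ∘ there) (through-sound D w (ws⊆ (here refl)) snd)

-- Vertices as numbers, lists of keys as edge sets

num den : ℚ → ℕ
num l = proj₂ (rawℤ (↥ l))
den l = proj₂ (rawℤ (↧ l))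

den-nonZero : ∀ l → NonZero (den l)
den-nonZero (mkℚ _ _ _) = _

↥-num : ∀ {l} → 0ℚ ℚ.≤ l → ↥ l ≡ pos (num l)
↥-num {mkℚ (pos k) _ _}    _ = refl
↥-num {mkℚ -[1+ k ] d _} le with ℚ.nonNegative le
... | ()

↧-den : ∀ l → ↧ l ≡ pos (den l)
↧-den (mkℚ _ _ _) = refl

*-cancelʳ-≡-pos : ∀ r .{{_ : ℚ.Positive r}} {p q} → p ℚ.* r ≡ q ℚ.* r → p ≡ q
*-cancelʳ-≡-pos r eq = ℚ.≤-antisym (ℚ.*-cancelʳ-≤-pos r (ℚ.≤-reflexive eq)) (ℚ.*-cancelʳ-≤-pos r (ℚ.≤-reflexive (sym eq)))

key : Fin n → Fin n → ℕ × ℕ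
key u v = toℕ u , toℕ v

key-injective : ∀ {u v u′ v′ : Fin n} → key u v ≡ key u′ v′ → u ≡ u′ × v ≡ v′
key-injective eq = Fin.toℕ-injective (cong proj₁ eq) , Fin.toℕ-injective (cong proj₂ eq)

length-concat : ∀ {Y : Set} k (yss : List (List Y)) → All (λ ys → length ys ≤ k) yss → length (concat yss) ≤ length yss * k
length-concat k []         []         = z≤n
length-concat k (ys ∷ yss) (le ∷ les) = ≤-trans (≤-reflexive (List.length-++ ys)) (+-mono-≤ le (length-concat k yss les))

∈-buy⁺ : ∀ P es B {k y} → (k , y) ∈ es → k ∈ B ⊎ T (P k) → k ∈ buy P es B
∈-buy⁺ P es B {k} {y} e∈ reason = ∈-map⁺ proj₁ (∈-filterᵇ⁺ (λ e → member (proj₁ e) B ∨ P (proj₁ e)) e∈ (from T-∨ (why reason)))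
  where
  why : k ∈ B ⊎ T (P k) → T (member k B) ⊎ T (P k)
  why (inj₁ k∈) = inj₁ (∈⇒member k∈)
  why (inj₂ t)  = inj₂ t

∈-buy⁻ : ∀ P es B {k} → k ∈ buy P es B → (∃[ y ] (k , y) ∈ es) × (k ∈ B ⊎ T (P k))
∈-buy⁻ P es B {k} k∈ = unpack (∈-map⁻ proj₁ k∈)
  where
  unpack : ∃[ e ] e ∈ filterᵇ (λ e → member (proj₁ e) B ∨ P (proj₁ e)) es × k ≡ proj₁ e →
           (∃[ y ] (k , y) ∈ es) × (k ∈ B ⊎ T (P k))
  unpack ((k , y) , e∈ , refl) = let (e∈es , t) = ∈-filterᵇ⁻ _ es e∈ in (y , e∈es) , why (to T-∨ t)
    where
    why : T (member k B) ⊎ T (P k) → k ∈ B ⊎ T (P k)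
    why (inj₁ m) = inj₁ (member⇒∈ B m)
    why (inj₂ t) = inj₂ t

listSet : ∀ n → List (ℕ × ℕ) → EdgeSet n
listSet n B = Vec.tabulate λ e → let (u , v) = remQuot {n} n e in member (key u v) B

∈-listSet⁺ : ∀ {n B} {u v : Fin n} → key u v ∈ B → combine u v Subset.∈ listSet n B
∈-listSet⁺ {n} {B} {u} {v} k∈ = Vec.lookup⇒[]= (combine u v) (listSet n B)
  (trans (Vec.lookup∘tabulate _ (combine u v))
    (trans (cong (λ p → member (key (proj₁ p) (proj₂ p)) B) (Fin.remQuot-combine {n} u v)) (to T-≡ (∈⇒member k∈))))

∈-listSet⁻ : ∀ {n B} {u v : Fin n} → combine u v Subset.∈ listSet n B → key u v ∈ B
∈-listSet⁻ {n} {B} {u} {v} e∈ = member⇒∈ B (from T-≡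
  (trans (sym (trans (Vec.lookup∘tabulate _ (combine u v))
    (cong (λ p → member (key (proj₁ p) (proj₂ p)) B) (Fin.remQuot-combine {n} u v)))) (Vec.[]=⇒lookup e∈)))

maximal : ∀ {Y : Set} (f : Y → ℕ) {y} ys → y ∈ ys → ∃[ m ] m ∈ ys × (∀ {z} → z ∈ ys → f z ≤ f m)
maximal f (y ∷ [])      _ = y , here refl , λ { (here refl) → ≤-refl }
maximal f (y ∷ ys@(z ∷ _)) _ with maximal f ys (here refl)
... | m , m∈ , m≥ with ≤-total (f y) (f m)
...   | inj₁ y≤m = m , there m∈ , λ { (here refl) → y≤m ; (there z∈) → m≥ z∈ }
...   | inj₂ m≤y = y , here refl , λ { (here refl) → ≤-refl ; (there z∈) → ≤-trans (m≥ z∈) m≤y }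

length-filterᵇ-mono : ∀ {Y : Set} (p q : Y → Bool) ys → (∀ y → T (p y) → T (q y)) →
  length (filterᵇ p ys) ≤ length (filterᵇ q ys)
length-filterᵇ-mono p q []       imp = z≤n
length-filterᵇ-mono p q (y ∷ ys) imp with p y | q y | imp y
... | true  | true  | _ = s≤s (length-filterᵇ-mono p q ys imp)
... | true  | false | i = ⊥-elim (i _)
... | false | true  | _ = m≤n⇒m≤1+n (length-filterᵇ-mono p q ys imp)
... | false | false | _ = length-filterᵇ-mono p q ys imp

nonempty : ∀ {Y : Set} (ys : List Y) → 0 < length ys → ∃[ y ] y ∈ ys
nonempty (y ∷ ys) _ = y , here refl

≤ᵇ-not : ∀ {m n} → ¬ (m ≤ n) → T (not (m ≤ᵇ n))
≤ᵇ-not {m} {n} m≰n with m ≤ᵇ n in eq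
... | true  = m≰n (≤ᵇ⇒≤ m n (subst T (sym eq) _))
... | false = _

serve-cases : ∀ (P : List (ℕ × ℕ) → Set) V es Q H hs B s t q τ →
  let B₁ = buy (toHubs hs s t) es B in
  (T (s == t) → P B) →
  (¬ T (s == t) → T (connected V es B₁ (s , t) q τ) → P B₁) →
  (¬ T (s == t) → ¬ T (connected V es B₁ (s , t) q τ) → P (buy (inside (s ∷ t ∷ mids V H (s , t) q τ)) es B₁)) →
  P (serve (V , (es , (Q , (H , hs)))) B s t q τ)
serve-cases P V es Q H hs B s t q τ p p₁ p₂ with s == t
... | true  = p _
... | false with connected V es (buy (toHubs hs s t) es B) (s , t) q τ
...   | true  = p₁ id _
...   | false = p₂ id id

-- The algorithm as a program

abstract
  startᵖ : FP RawGraph Memory (λ g → plan g , [])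
  startᵖ = planᵖ ,ᵖ nilᵖ

  reply : ⟦ Memory ⊗ RawRequest ⟧ → List (ℕ × ℕ)
  reply = answer

  replyᵖ : FP (Memory ⊗ RawRequest) (list Key) reply
  replyᵖ = answerᵖ

  reply-serve : ∀ {P V es Q H hs} B (s t : Fin n) d → P ≡ (V , (es , (Q , (H , hs)))) →
    reply ((P , B) , rawRequest (request s t d)) ≡
    serve (V , (es , (Q , (H , hs)))) B (toℕ s) (toℕ t) (den d) (num d * Q)
  reply-serve B s t d refl = refl

-- A reply lists all the edges bought so far, which does not change the maintained set.
spanner : OnlineAlgorithm
spanner = record
  { extra   = 1
  ; prepare = code startᵖ ⨾ (stackᴿ ≔ x)
  -- The stack register holds the memory between rounds. `replyᵖ` takes it for an unknown stack and
  -- restores it, so `hd s` is still the plan afterwards.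
  ; step    = (valueᴿ ≔ cons s x) ⨾ code replyᵖ ⨾ (outputᴿ ≔ x) ⨾ (stackᴿ ≔ cons (hd s) x)
  }

open OnlineAlgorithm spanner using (Preparation; Round; Execution; start; round)

memory : ⟦ RawGraph ⟧ → List (ℕ × ℕ) → Tree
memory g B = enc Memory (plan g , B)

prepares : ∀ (G : Graph n) ρ → ∃[ t ] Preparation G ρ (memory (rawGraph G) [] ∷ nil ∷ memory (rawGraph G) [] ∷ [] , 0) t ×
  t ≤ ⟦ time startᵖ ⊞ con 2 ⟧ₚ (size (encodeGraph G))
prepares G ρ = let (t , t≤ , r) = run startᵖ (rawGraph G) nil in t + 2 ,
  seq (subst (λ g → Run ρ (code startᵖ) (g ∷ nil ∷ nil ∷ [] , 0) (memory (rawGraph G) [] ∷ nil ∷ nil ∷ [] , 0) t) (encode-rawGraph G) r) assign ,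
  +-monoˡ-≤ 2 (subst (λ g → t ≤ ⟦ time startᵖ ⟧ₚ (size g)) (encode-rawGraph G) t≤)

replies : ∀ (G : Graph n) ρ B (r : Request n) {z y i} →
  let B′ = reply ((plan (rawGraph G) , B) , rawRequest r) in
  ∃[ t ] Run ρ (OnlineAlgorithm.step spanner) ((z ∷ y ∷ memory (rawGraph G) B ∷ []) [ valueᴿ ]≔ encodeRequest r , i)
             (enc (list Key) B′ ∷ enc (list Key) B′ ∷ memory (rawGraph G) B′ ∷ [] , i) t ×
  t ≤ ⟦ con 11 ⊞ time replyᵖ ⟧ₚ (1 + (size (memory (rawGraph G) B) + size (encodeRequest r)))
replies G ρ B r {z} {y} {i} =
  let (t , t≤ , r′) = run replyᵖ ((plan (rawGraph G) , B) , rawRequest r) (memory (rawGraph G) B) in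
  4 + (t + (2 + 5)) ,
  seq (assign {x = valueᴿ} {e = cons s x})
    (seq (subst (λ z → Run ρ (code replyᵖ) (memory (rawGraph G) B ∙ z ∷ y ∷ memory (rawGraph G) B ∷ [] , i)
           (enc (list Key) (reply ((plan (rawGraph G) , B) , rawRequest r)) ∷ y ∷ memory (rawGraph G) B ∷ [] , i) t) (encode-rawRequest r) r′)
      (seq assign assign)) ,
  ≤-trans (≤-reflexive (lemma t)) (+-monoʳ-≤ 11
    (subst (λ z → t ≤ ⟦ time replyᵖ ⟧ₚ (1 + (size (memory (rawGraph G) B) + size z))) (encode-rawRequest r) t≤))
  where
  lemma : ∀ t → 4 + (t + (2 + 5)) ≡ 11 + t
  lemma = solve-∀

-- Competitiveness is claimed for every execution. With the coins fixed, determinism identifies each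
-- of them with the run constructed here.
run-deterministic : ∀ {ρ k} {c : Cmd k} {a b b′ t t′} → Run ρ c a b t → Run ρ c a b′ t′ → b ≡ b′
run-deterministic assign assign = refl
run-deterministic toss   toss   = refl
run-deterministic (seq p q) (seq p′ q′) with run-deterministic p p′
... | refl = run-deterministic q q′
run-deterministic (cond-true _ p)  (cond-true _ p′)  = run-deterministic p p′
run-deterministic (cond-false _ p) (cond-false _ p′) = run-deterministic p p′
run-deterministic (cond-true e _)  (cond-false e′ _) with trans (sym e) e′
... | ()
run-deterministic (cond-false e _) (cond-true e′ _)  with trans (sym e) e′
... | ()
run-deterministic (while-true _ p q) (while-true _ p′ q′) with run-deterministic p p′
... | refl = run-deterministic q q′
run-deterministic (while-false _)    (while-false _) = refl
run-deterministic (while-true e _ _) (while-false e′) with trans (sym e) e′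
... | ()
run-deterministic (while-false e) (while-true e′ _ _) with trans (sym e) e′
... | ()

-- The purchases as a function of the history, so that feasibility and cost can be argued without
-- reference to runs.
bought : Graph n → History n → List (ℕ × ℕ)
bought G []       = []
bought G (r ∷ rs) = reply ((plan (rawGraph G) , bought G rs) , rawRequest r)

pairKeys : List (Fin n × Fin n) → List (ℕ × ℕ)
pairKeys = map (λ (u , v) → key u v)

encode-pairKeys : (es : List (Fin n × Fin n)) → enc (list Key) (pairKeys es) ≡ encodeEdges es
encode-pairKeys = encodeList-map (enc Key) (λ (u , v) → key u v)

-- A round specifies its edges through their encoding in the output register; injectivity recovers
-- them from there.
encode-keys-injective : ∀ ks ls → enc (list Key) ks ≡ enc (list Key) ls → ks ≡ ls
encode-keys-injective []       []       _  = refl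
encode-keys-injective ((u , v) ∷ ks) ((u′ , v′) ∷ ls) eq =
  let (e , rest) = parts eq ; (eu , ev) = parts e in
  cong₂ _∷_ (cong₂ _,_ (encodeℕ-injective eu) (encodeℕ-injective ev)) (encode-keys-injective ks ls rest)
  where
  parts : ∀ {p q r t} → p ∙ q ≡ r ∙ t → p ≡ r × q ≡ t
  parts refl = refl , refl

∈-edgeSet⁻ : ∀ {e} (es : List (Fin n × Fin n)) → e Subset.∈ edgeSet es → ∃[ u ] ∃[ v ] e ≡ combine u v × (u , v) ∈ es
∈-edgeSet⁻ []             e∈ = ⊥-elim (Subset.∉⊥ e∈)
∈-edgeSet⁻ ((u , v) ∷ es) e∈ with Subset.x∈p∪q⁻ _ _ e∈
... | inj₁ e∈₁ = u , v , Subset.x∈⁅y⁆⇒x≡y _ e∈₁ , here refl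
... | inj₂ e∈₂ = let (u , v , eq , uv∈) = ∈-edgeSet⁻ es e∈₂ in u , v , eq , there uv∈

∈-edgeSet⁺ : ∀ {u v} (es : List (Fin n × Fin n)) → (u , v) ∈ es → combine u v Subset.∈ edgeSet es
∈-edgeSet⁺ (_ ∷ es) (here refl) = Subset.x∈p∪q⁺ (inj₁ (Subset.x∈⁅x⁆ _))
∈-edgeSet⁺ (_ ∷ es) (there e∈)  = Subset.x∈p∪q⁺ (inj₂ (∈-edgeSet⁺ es e∈))

∈-pairKeys⁻ : ∀ {u v : Fin n} es → key u v ∈ pairKeys es → (u , v) ∈ es
∈-pairKeys⁻ es k∈ with ∈-map⁻ (λ (u , v) → key u v) k∈
... | (u′ , v′) , e∈ , eq with key-injective eq
...   | refl , refl = e∈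

∈-E : ∀ (G : Graph n) {u v l} → len G u v ≡ just l → combine u v Subset.∈ E G
∈-E {n} G {u} {v} eq = Vec.lookup⇒[]= (combine u v) (E G)
  (trans (Vec.lookup∘tabulate _ (combine u v))
    (trans (cong (λ p → is-just (len G (proj₁ p) (proj₂ p))) (Fin.remQuot-combine {n} u v)) (cong is-just eq)))

component-size : ∀ {P V es rest} → P ≡ (V , (es , rest)) → ∥_∥ {list WEdge} es ≤ ∥_∥ {Plan} P
component-size {V = V} {es} {rest} refl = ≤-trans
  (≤-trans (m≤m+n (∥_∥ {list WEdge} es) (∥_∥ {nat ⊗ (list Hop ⊗ list nat)} rest)) (n≤1+n _))
  (≤-trans (m≤n+m _ (∥_∥ {list nat} V)) (n≤1+n _))

-- Counting

elements : Subset.Subset n → List (Fin n)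
elements []          = []
elements (true ∷ S)  = Fin.zero ∷ map Fin.suc (elements S)
elements (false ∷ S) = map Fin.suc (elements S)

length-elements : (S : Subset.Subset n) → length (elements S) ≡ Subset.∣ S ∣
length-elements []          = refl
length-elements (true ∷ S)  = cong suc (trans (List.length-map Fin.suc (elements S)) (length-elements S))
length-elements (false ∷ S) = trans (List.length-map Fin.suc (elements S)) (length-elements S)

∈-elements : ∀ {S : Subset.Subset n} {e} → e Subset.∈ S → e ∈ elements S
∈-elements {S = true ∷ S}  {Fin.zero}  _           = here refl
∈-elements {S = true ∷ S}  {Fin.suc e} (Vec.there e∈) = there (∈-map⁺ Fin.suc (∈-elements e∈))
∈-elements {S = false ∷ S} {Fin.suc e} (Vec.there e∈) = ∈-map⁺ Fin.suc (∈-elements e∈)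

-- `ks` may repeat entries: for each element of S one occurrence of its image is struck out, which
-- by injectivity leaves the images of the others in place.
∣∣≤length : ∀ {K : Set} {m} (S : Subset.Subset m) (f : Fin m → K) → (∀ {i j} → f i ≡ f j → i ≡ j) →
  ∀ ks → (∀ {e} → e Subset.∈ S → f e ∈ ks) → Subset.∣ S ∣ ≤ length ks
∣∣≤length []          f inj ks S⊆ = z≤n
∣∣≤length (false ∷ S) f inj ks S⊆ =
  ∣∣≤length S (f ∘ Fin.suc) (λ eq → Fin.suc-injective (inj eq)) ks (S⊆ ∘ Vec.there)
∣∣≤length {K} (true ∷ S) f inj ks S⊆ with ∈-∃++ (S⊆ Vec.here)
... | as , bs , refl = ≤-trans (s≤s (∣∣≤length S (f ∘ Fin.suc) (λ eq → Fin.suc-injective (inj eq)) (as ++ bs) rest))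
  (≤-reflexive (trans (cong suc (List.length-++ as)) (trans (sym (+-suc (length as) (length bs))) (sym (List.length-++ as)))))
  where
  rest : ∀ {e} → e Subset.∈ S → f (Fin.suc e) ∈ as ++ bs
  rest {e} e∈ = drop-middle (∈-++⁻ as (S⊆ (Vec.there e∈)))
    where
    drop-middle : f (Fin.suc e) ∈ as ⊎ f (Fin.suc e) ∈ (f Fin.zero ∷ bs) → f (Fin.suc e) ∈ as ++ bs
    drop-middle (inj₁ e∈as)         = ∈-++⁺ˡ e∈as
    drop-middle (inj₂ (there e∈bs)) = ∈-++⁺ʳ as e∈bs
    drop-middle (inj₂ (here eq)) with inj eq
    ... | ()

length-cartesianProduct : ∀ {Y Z : Set} (ys : List Y) (zs : List Z) → length (cartesianProduct ys zs) ≡ length ys * length zs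
length-cartesianProduct []       zs = refl
length-cartesianProduct (y ∷ ys) zs = trans (List.length-++ (map (y ,_) zs))
  (cong₂ _+_ (List.length-map (y ,_) zs) (length-cartesianProduct ys zs))

edgeKey : Fin (n * n) → ℕ × ℕ
edgeKey {n} e = key (proj₁ (remQuot {n} n e)) (proj₂ (remQuot {n} n e))

edgeKey-injective : ∀ {e f : Fin (n * n)} → edgeKey {n} e ≡ edgeKey {n} f → e ≡ f
edgeKey-injective {n} {e} {f} eq = let (p , q) = key-injective eq in
  trans (sym (Fin.combine-remQuot {n} n e)) (trans (cong₂ combine p q) (Fin.combine-remQuot {n} n f))

listSet-mono : ∀ {B B′} → (∀ {k} → k ∈ B → k ∈ B′) → listSet n B Subset.⊆ listSet n B′
listSet-mono {n} {B} {B′} B⊆ {e} e∈ = subst (Subset._∈ listSet n B′) (Fin.combine-remQuot {n} n e)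
  (∈-listSet⁺ {B = B′} (B⊆ (∈-listSet⁻ {B = B} (subst (Subset._∈ listSet n B) (sym (Fin.combine-remQuot {n} n e)) e∈))))

inside⁻ : ∀ M k → T (inside M k) → k ∈ cartesianProduct M M
inside⁻ M k c = let (a , b) = to (T-∧ {element (proj₁ k) M}) c in ∈-cartesianProduct⁺ (element⇒∈ M a) (element⇒∈ M b)

-- The input graph with integral lengths

module Scaled {n} (G : Graph n) where

  ent : List ⟦ Entry ⟧
  ent = entries (rawGraph G)

  private
    cell : Fin n → Fin n → List ⟦ Entry ⟧
    cell u v = maybe′ (λ l → [ key u v , (num l , den l) ]) [] (len G u v)

    row : Fin n → List (List ⟦ Entry ⟧)
    row u = tabulate (cell u)

    entries-shape : ent ≡ concat (tabulate (concat ∘ row))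
    entries-shape = begin
      concatMap rowOf (enumerate (map _ (allFin n)))
        ≡⟨ cong (concatMap rowOf ∘ enumerate) (List.map-tabulate {n = n} id _) ⟩
      concatMap rowOf (enumerate (tabulate (λ u → map (λ v → Maybe.map rawℚ (len G u v)) (allFin n))))
        ≡⟨ cong (concatMap rowOf) (enumerate-tabulate {n} _) ⟩
      concatMap rowOf (tabulate (λ u → toℕ u , map (λ v → Maybe.map rawℚ (len G u v)) (allFin n)))
        ≡⟨ cong concat (List.map-tabulate {n = n} _ rowOf) ⟩
      concat (tabulate (λ u → rowOf (toℕ u , map (λ v → Maybe.map rawℚ (len G u v)) (allFin n))))
        ≡⟨ cong concat (List.tabulate-cong inner) ⟩
      concat (tabulate (concat ∘ row))  ∎
      where
      open ≡-Reasoning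
      cellOf : ℕ → ℕ × Maybe (⟦ Int ⟧ × ⟦ Int ⟧) → List ⟦ Entry ⟧
      cellOf u c = maybe′ (λ pq → [ (u , proj₁ c) , (proj₂ (proj₁ pq) , proj₂ (proj₂ pq)) ]) [] (proj₂ c)
      rowOf : ℕ × List (Maybe (⟦ Int ⟧ × ⟦ Int ⟧)) → List ⟦ Entry ⟧
      rowOf r = concatMap (cellOf (proj₁ r)) (enumerate (proj₂ r))
      same : ∀ u v m → cellOf (toℕ u) (toℕ v , Maybe.map rawℚ m) ≡ maybe′ (λ l → [ key u v , (num l , den l) ]) [] m
      same u v nothing  = refl
      same u v (just l) = refl
      inner : ∀ u → rowOf (toℕ u , map (λ v → Maybe.map rawℚ (len G u v)) (allFin n)) ≡ concat (row u)
      inner u = begin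
        concatMap (cellOf (toℕ u)) (enumerate (map _ (allFin n)))
          ≡⟨ cong (concatMap (cellOf (toℕ u)) ∘ enumerate) (List.map-tabulate {n = n} id _) ⟩
        concatMap (cellOf (toℕ u)) (enumerate (tabulate (λ v → Maybe.map rawℚ (len G u v))))
          ≡⟨ cong (concatMap (cellOf (toℕ u))) (enumerate-tabulate {n} _) ⟩
        concatMap (cellOf (toℕ u)) (tabulate (λ v → toℕ v , Maybe.map rawℚ (len G u v)))
          ≡⟨ cong concat (List.map-tabulate {n = n} _ (cellOf (toℕ u))) ⟩
        concat (tabulate (λ v → cellOf (toℕ u) (toℕ v , Maybe.map rawℚ (len G u v))))
          ≡⟨ cong concat (List.tabulate-cong (λ v → same u v (len G u v))) ⟩
        concat (row u)  ∎

    ∈-cell⁻ : ∀ {e} u v → e ∈ cell u v → ∃[ l ] len G u v ≡ just l × e ≡ (key u v , (num l , den l))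
    ∈-cell⁻ u v e∈ with len G u v
    ∈-cell⁻ u v (here refl) | just l = l , refl , refl

  ∈-ent⁺ : ∀ {u v l} → len G u v ≡ just l → (key u v , (num l , den l)) ∈ ent
  ∈-ent⁺ {u} {v} {l} eq = subst (_ ∈_) (sym entries-shape)
    (∈-concat⁺′ (∈-concat⁺′ (subst (λ m → _ ∈ maybe′ (λ l → [ key u v , (num l , den l) ]) [] m) (sym eq) (here refl))
                            (∈-tabulate⁺ v)) (∈-tabulate⁺ {f = concat ∘ row} u))

  ∈-ent⁻ : ∀ {e} → e ∈ ent → ∃[ u ] ∃[ v ] ∃[ l ] len G u v ≡ just l × e ≡ (key u v , (num l , den l))
  ∈-ent⁻ e∈ with ∈-concat⁻′ (tabulate (concat ∘ row)) (subst (_ ∈_) entries-shape e∈)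
  ... | es , e∈es , es∈ with ∈-tabulate⁻ es∈
  ... | u , refl with ∈-concat⁻′ (row u) e∈es
  ... | es , e∈es , es∈ with ∈-tabulate⁻ es∈
  ... | v , refl with ∈-cell⁻ u v e∈es
  ... | l , eq , e≡ = u , v , l , eq , e≡

  ent-unique : AllPairs (λ e e′ → proj₁ e ≢ proj₁ e′) ent
  ent-unique = subst (AllPairs _) (sym entries-shape) (AllPairs.concat⁺
    (All.tabulate⁺ λ u → AllPairs.concat⁺
      (All.tabulate⁺ λ v → single u v)
      (AllPairs.tabulate⁺ λ {v} {v′} v≢v′ → All.tabulate λ e∈ → All.tabulate λ e′∈ eq →
        let (_ , _ , e≡) = ∈-cell⁻ u v e∈ ; (_ , _ , e′≡) = ∈-cell⁻ u v′ e′∈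
        in v≢v′ (proj₂ (key-injective (trans (sym (cong proj₁ e≡)) (trans eq (cong proj₁ e′≡)))))))
    (AllPairs.tabulate⁺ λ {u} {u′} u≢u′ → All.tabulate λ e∈ → All.tabulate λ e′∈ eq →
      u≢u′ (Fin.toℕ-injective (trans (sym (source u e∈)) (trans (cong (proj₁) eq) (source u′ e′∈))))))
    where
    single : ∀ u v → AllPairs (λ e e′ → proj₁ e ≢ proj₁ e′) (cell u v)
    single u v with len G u v
    ... | nothing = []
    ... | just _  = [] ∷ []
    source : ∀ u {e} → e ∈ concat (row u) → proj₁ (proj₁ e) ≡ toℕ u
    source u e∈ with ∈-concat⁻′ (row u) e∈
    ... | es , e∈es , es∈ with ∈-tabulate⁻ es∈
    ... | v , refl = cong (proj₁ ∘ proj₁) (proj₂ (proj₂ (∈-cell⁻ u v e∈es)))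

  abstract
    Q : ℕ
    Q = denominator ent

    wt : Fin n → Fin n → ℕ
    wt u v = numerator ent (key u v)

    wt-scales : ∀ {u v l} → len G u v ≡ just l → wt u v * den l ≡ num l * Q
    wt-scales eq = numerator-scales ent-unique (∈-ent⁺ eq)

    Q≢0 : NonZero Q
    Q≢0 = ListAction.product≢0 (All.map⁺ (All.tabulate λ e∈ →
      let (_ , _ , l , _ , e≡) = ∈-ent⁻ e∈ in subst (λ e → NonZero (proj₂ (proj₂ e))) (sym e≡) (den-nonZero l)))

  instance
    Q-nonZero : NonZero Q
    Q-nonZero = Q≢0

    ιQ-positive : ℚ.Positive (ι Q)
    ιQ-positive = ι-positive Q

  -- `wt-scales` states this multiplied by the denominator of l, within ℕ; in ℚ the denominator
  -- cancels.
  ι-wt : ∀ {u v l} → len G u v ≡ just l → ι (wt u v) ≡ l ℚ.* ι Q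
  ι-wt {u} {v} {l} eq = *-cancelʳ-≡-pos (ι (den l)) {{ι-positive (den l) {{den-nonZero l}}}} (begin
    ι (wt u v) ℚ.* ι (den l)  ≡⟨ ι-* (wt u v) (den l) ⟨
    ι (wt u v * den l)  ≡⟨ cong ι (wt-scales eq) ⟩
    ι (num l * Q)  ≡⟨ ι-* (num l) Q ⟩
    ι (num l) ℚ.* ι Q  ≡⟨ cong (ℚ._* ι Q) (*-ι-denominator l (↥-num (nonneg G eq)) (↧-den l)) ⟨
    l ℚ.* ι (den l) ℚ.* ι Q  ≡⟨ ℚ.*-assoc l _ _ ⟩
    l ℚ.* (ι (den l) ℚ.* ι Q)  ≡⟨ cong (l ℚ.*_) (ℚ.*-comm (ι (den l)) (ι Q)) ⟩
    l ℚ.* (ι Q ℚ.* ι (den l))  ≡⟨ ℚ.*-assoc l _ _ ⟨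
    l ℚ.* ι Q ℚ.* ι (den l)  ∎)
    where open ≡-Reasoning

  length-ent : length ent ≤ n * n
  length-ent = ≤-trans (≤-reflexive (cong length entries-shape))
    (≤-trans (length-concat n (tabulate (concat ∘ row)) (All.tabulate⁺ λ u →
        ≤-trans (length-concat 1 (row u) (All.tabulate⁺ λ v → single (len G u v)))
          (≤-reflexive (trans (cong (_* 1) (List.length-tabulate (cell u))) (*-identityʳ n)))))
      (≤-reflexive (cong (_* n) (List.length-tabulate (concat ∘ row)))))
    where
    single : ∀ {e : ℚ → ⟦ Entry ⟧} m → length (maybe′ (λ l → [ e l ]) [] m) ≤ 1
    single nothing  = z≤n
    single (just _) = ≤-refl

  infix 4 _≐_
  _≐_ : ℕ → ℚ → Set
  X ≐ L = ι X ≡ L ℚ.* ι Q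

  ≐-+ : ∀ {X Y L M} → X ≐ L → Y ≐ M → X + Y ≐ L ℚ.+ M
  ≐-+ {X} {Y} {L} {M} p q = trans (ι-+ X Y) (trans (cong₂ ℚ._+_ p q) (sym (ℚ.*-distribʳ-+ (ι Q) L M)))

  ≐-0 : 0 ≐ 0ℚ
  ≐-0 = sym (ℚ.*-zeroˡ (ι Q))

  module _ {d} (0≤d : 0ℚ ℚ.≤ d) where

    private
      scaled-target : d ℚ.* ι (den d) ℚ.* ι Q ≡ ι (num d * Q)
      scaled-target = trans (cong (ℚ._* ι Q) (*-ι-denominator d (↥-num 0≤d) (↧-den d))) (sym (ι-* (num d) Q))

      scaled-length : ∀ {X L} → X ≐ L → L ℚ.* ι (den d) ℚ.* ι Q ≡ ι (X * den d)
      scaled-length {X} {L} eq = begin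
        L ℚ.* ι (den d) ℚ.* ι Q  ≡⟨ ℚ.*-assoc L _ _ ⟩
        L ℚ.* (ι (den d) ℚ.* ι Q)  ≡⟨ cong (L ℚ.*_) (ℚ.*-comm (ι (den d)) (ι Q)) ⟩
        L ℚ.* (ι Q ℚ.* ι (den d))  ≡⟨ ℚ.*-assoc L _ _ ⟨
        L ℚ.* ι Q ℚ.* ι (den d)  ≡⟨ cong (ℚ._* ι (den d)) eq ⟨
        ι X ℚ.* ι (den d)  ≡⟨ ι-* X (den d) ⟨
        ι (X * den d)  ∎
        where open ≡-Reasoning

      instance
        ιden-positive : ℚ.Positive (ι (den d))
        ιden-positive = ι-positive (den d) {{den-nonZero d}}

    -- L ≤ d multiplied by the positive number `den d * Q` is the comparison of naturals that the
    -- program performs; `fits⁻` goes back.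
    fits⁺ : ∀ {X L} → X ≐ L → L ℚ.≤ d → X * den d ≤ num d * Q
    fits⁺ {X} {L} eq L≤d = ι-cancel (subst₂ ℚ._≤_ (scaled-length {X} {L} eq) scaled-target
      (ℚ.*-monoʳ-≤-nonNeg (ι Q) {{ℚ.pos⇒nonNeg (ι Q)}} (ℚ.*-monoʳ-≤-nonNeg (ι (den d)) {{ℚ.pos⇒nonNeg (ι (den d))}} L≤d)))

    fits⁻ : ∀ {X L} → X ≐ L → X * den d ≤ num d * Q → L ℚ.≤ d
    fits⁻ {X} {L} eq le = ℚ.*-cancelʳ-≤-pos (ι (den d)) (ℚ.*-cancelʳ-≤-pos (ι Q)
      (subst₂ ℚ._≤_ (sym (scaled-length {X} {L} eq)) (sym scaled-target) (ι-mono le)))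

  abstract
    W : List ⟦ WEdge ⟧
    W = weighted ent

    ∈-W⁺ : ∀ {u v l} → len G u v ≡ just l → (key u v , wt u v) ∈ W
    ∈-W⁺ eq = ∈-map⁺ (λ e → proj₁ e , numerator ent (proj₁ e)) (∈-ent⁺ eq)

    ∈-W⁻ : ∀ {e} → e ∈ W → ∃[ u ] ∃[ v ] ∃[ l ] len G u v ≡ just l × e ≡ (key u v , wt u v)
    ∈-W⁻ e∈ with ∈-map⁻ _ e∈
    ... | e , e∈ent , refl with ∈-ent⁻ e∈ent
    ... | u , v , l , eq , refl = u , v , l , eq , refl

    V : List ℕ
    V = vertices (rawGraph G)

    V≡ : V ≡ tabulate (toℕ {n})
    V≡ = trans (cong (map proj₁ ∘ enumerate) (List.map-tabulate {n = n} id _))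
      (trans (cong (map proj₁) (enumerate-tabulate {n} _)) (List.map-tabulate {n = n} _ proj₁))

    ∈-V⁺ : ∀ (v : Fin n) → toℕ v ∈ V
    ∈-V⁺ v = subst (toℕ v ∈_) (sym V≡) (∈-tabulate⁺ v)

    ∈-V⁻ : ∀ {x} → x ∈ V → Σ[ v ∈ Fin n ] x ≡ toℕ v
    ∈-V⁻ x∈ = ∈-tabulate⁻ (subst (_ ∈_) V≡ x∈)

    length-V : length V ≡ n
    length-V = trans (cong length V≡) (List.length-tabulate (toℕ {n}))

    H : List ⟦ Hop ⟧
    H = hops W

    ∈-H⁺ : ∀ {s v t l m} → len G s v ≡ just l → len G v t ≡ just m → (key s t , (toℕ v , wt s v + wt v t)) ∈ H
    ∈-H⁺ {s} {v} {t} p q = ∈-concatMap⁺ _ (lose (∈-W⁺ p) (∈-concatMap⁺ _ (lose (∈-W⁺ q)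
      (subst (λ b → (key s t , (toℕ v , wt s v + wt v t)) ∈ (if b then [ key s t , (toℕ v , wt s v + wt v t) ] else [])) (sym (to T-≡ (==-refl (toℕ v)))) (here refl)))))

    ∈-H⁻ : ∀ {h} → h ∈ H → ∃[ s ] ∃[ v ] ∃[ t ] ∃[ l ] ∃[ m ] len G s v ≡ just l × len G v t ≡ just m ×
           h ≡ (key s t , (toℕ v , wt s v + wt v t))
    ∈-H⁻ h∈ with find (∈-concatMap⁻ _ {xs = W} h∈)
    ... | e , e∈ , h∈′ with find (∈-concatMap⁻ _ {xs = W} h∈′)
    ... | f , f∈ , h∈″ with ∈-W⁻ e∈ | ∈-W⁻ f∈
    ... | s , v , l , p , refl | v′ , t , m , q , refl with toℕ v == toℕ v′ in eq
    ∈-H⁻ h∈ | e , e∈ , h∈′ | f , f∈ , here refl | s , v , l , p , refl | v′ , t , m , q , refl | true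
      with Fin.toℕ-injective (==⇒≡ {toℕ v} {toℕ v′} (subst T (sym eq) _))
    ... | refl = s , v , t , l , m , p , q , refl

    length-W : length W ≤ n * n
    length-W = ≤-trans (≤-reflexive (List.length-map _ ent)) length-ent

    -- Counts all pairs of edges. Only the logarithm of this bound enters the number of hubs, so a
    -- crude bound costs a constant factor.
    length-H : length H ≤ n * n * (n * n)
    length-H = ≤-trans (length-concatMap (length W) W λ e →
        ≤-trans (length-concatMap 1 W λ f → single (proj₂ (proj₁ e) == proj₁ (proj₁ f))) (≤-reflexive (*-identityʳ (length W))))
      (*-mono-≤ length-W length-W)
      where
      single : ∀ {h : ⟦ Hop ⟧} b → length (if b then [ h ] else []) ≤ 1
      single true  = ≤-refl
      single false = z≤n
      length-concatMap : ∀ {Y Z : Set} {f : Y → List Z} k ys → (∀ y → length (f y) ≤ k) → length (concatMap f ys) ≤ length ys * k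
      length-concatMap {f = f} k ys le = ≤-trans (length-concat k (map f ys) (All.map⁺ (All.tabulate λ {y} _ → le y)))
        (≤-reflexive (cong (_* k) (List.length-map f ys)))

    hs : List ℕ
    hs = hubs V H

    hs≡hubs : hs ≡ hubs V H
    hs≡hubs = refl

    plan-parts : plan (rawGraph G) ≡ (V , (W , (Q , (H , hs))))
    plan-parts = refl

  near⁺ : ∀ {s v t l m q τ} → len G s v ≡ just l → len G v t ≡ just m → (wt s v + wt v t) * q ≤ τ →
          T (near H (key s t) q τ (toℕ v))
  near⁺ {s} {v} {t} p q le = Any.any⁺ _ (lose (∈-H⁺ p q)
    (from T-∧ (==²-refl (key s t) , from T-∧ (==-refl (toℕ v) , ≤⇒≤ᵇ le))))

  near⁻ : ∀ {s t q τ x} → T (near H (key s t) q τ x) →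
          ∃[ v ] ∃[ l ] ∃[ m ] len G s v ≡ just l × len G v t ≡ just m × x ≡ toℕ v × (wt s v + wt v t) * q ≤ τ
  near⁻ {s} {t} {q} {τ} {x} tn =
    let (h , h∈ , th) = find (Any.any⁻ _ H tn) in unpack h th (∈-H⁻ h∈)
    where
    unpack : ∀ h → T ((proj₁ h ==² key s t) ∧ (proj₁ (proj₂ h) == x) ∧ (proj₂ (proj₂ h) * q ≤ᵇ τ)) →
      (∃[ s ] ∃[ v ] ∃[ t ] ∃[ l ] ∃[ m ] len G s v ≡ just l × len G v t ≡ just m ×
         h ≡ (key s t , (toℕ v , wt s v + wt v t))) →
      ∃[ v ] ∃[ l ] ∃[ m ] len G s v ≡ just l × len G v t ≡ just m × x ≡ toℕ v × (wt s v + wt v t) * q ≤ τ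
    unpack h th (s′ , v , t′ , l , m , p , p′ , refl) =
      same (key-injective (==²⇒≡ {key s′ t′} {key s t} (proj₁ (to T-∧ th))))
      where
      rest = to (T-∧ {toℕ v == x}) (proj₂ (to (T-∧ {key s′ t′ ==² key s t}) th))
      same : s′ ≡ s × t′ ≡ t → _
      same (refl , refl) = v , l , m , p , p′ , sym (==⇒≡ {toℕ v} {x} (proj₁ rest)) , ≤ᵇ⇒≤ _ _ (proj₂ rest)

  -- Paths and shortcuts

  path-nonneg : ∀ {F u v L} → Path G F u v L → 0ℚ ℚ.≤ L
  path-nonneg []            = ℚ.≤-refl
  path-nonneg (cons _ e p) = ℚ.+-mono-≤ (nonneg G e) (path-nonneg p)

  path-++ : ∀ {F u v w L M} → Path G F u v L → Path G F v w M → Path G F u w (L ℚ.+ M)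
  path-++ {M = M} [] q = subst (Path G _ _ _) (sym (ℚ.+-identityˡ M)) q
  path-++ {M = M} (cons {l = l} {L = L} e∈ e p) q =
    subst (Path G _ _ _) (sym (ℚ.+-assoc l L M)) (cons e∈ e (path-++ p q))

  edge : ∀ {F u v l} → combine u v Subset.∈ F → len G u v ≡ just l → Path G F u v l
  edge {l = l} e∈ e = subst (Path G _ _ _) (ℚ.+-identityʳ l) (cons e∈ e [])

  path-mono : ∀ {F F′ u v L} → F Subset.⊆ F′ → Path G F u v L → Path G F′ u v L
  path-mono F⊆ []             = []
  path-mono F⊆ (cons e∈ e p) = cons (F⊆ e∈) e (path-mono F⊆ p)

  first-edge : ∀ {F u w L} → Path G F u w L → u ≢ w → ∃[ v ] combine u v Subset.∈ F
  first-edge []                    u≢w = ⊥-elim (u≢w refl)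
  first-edge (cons {v = v} e∈ _ _) _   = v , e∈

  last-edge : ∀ {F u w L} → Path G F u w L → u ≢ w → ∃[ v ] combine v w Subset.∈ F
  last-edge []                            u≢w = ⊥-elim (u≢w refl)
  last-edge {w = w} (cons {u = u} {v = v} e∈ e p) u≢w with v Fin.≟ w
  ... | yes refl = u , e∈
  ... | no v≢w   = last-edge p v≢w

  -- Induction on the path, merging its first edge u → v with the shortcut of the rest. If v = w
  -- there is nothing to merge: the rest is a closed walk of nonnegative length, and the first edge
  -- is the shortcut.
  shortcut : Quasimetric G → ∀ {F u w L} → Path G F u w L → u ≢ w → ∃[ l ] len G u w ≡ just l × l ℚ.≤ L
  shortcut qm [] u≢w = ⊥-elim (u≢w refl)
  shortcut qm {w = w} (cons {v = v} {l = l} {L = L} _ e p) u≢w with v Fin.≟ w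
  ... | yes refl = l , e , ℚ.≤-trans (ℚ.≤-reflexive (sym (ℚ.+-identityʳ l))) (ℚ.+-monoʳ-≤ l (path-nonneg p))
  ... | no v≢w   =
    let (m , f , m≤) = shortcut qm p v≢w ; (r , g , r≤) = qm u≢w e f
    in r , g , ℚ.≤-trans r≤ (ℚ.+-monoʳ-≤ l m≤)

  -- Correctness of the connectivity test

  module Connected (B : List (ℕ × ℕ)) {d : ℚ} (0≤d : 0ℚ ℚ.≤ d) where

    private
      q τ ∞ : ℕ
      q = den d
      τ = num d * Q
      ∞ = suc τ
      open FloydWarshall ∞ V

      W₀ : List ⟦ WEdge ⟧
      W₀ = weights V q W B

      Realises : ℕ → ℕ → ℕ → Set
      Realises y z X = ∃[ u ] ∃[ v ] ∃[ L ] ∃[ Y ] y ≡ toℕ u × z ≡ toℕ v × Path G (listSet n B) u v L × Y ≐ L × X ≡ Y * q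

      realises-+ : ∀ {u v w X Y} → Realises u v X → Realises v w Y → Realises u w (X + Y)
      realises-+ (u , v , L , X′ , u≡ , v≡ , p , X≐ , X≡) (v′ , w , M , Y′ , v′≡ , w≡ , p′ , Y≐ , Y≡) =
        u , w , L ℚ.+ M , X′ + Y′ , u≡ , w≡ ,
        path-++ p (subst (λ v → Path G (listSet n B) v w M) (Fin.toℕ-injective (trans (sym v′≡) v≡)) p′) ,
        ≐-+ {X′} {Y′} {L} {M} X≐ Y≐ , trans (cong₂ _+_ X≡ Y≡) (sym (*-distribʳ-+ q X′ Y′))

      initial : ∀ {u v} → ((u , v) , dist ∞ W₀ (u , v)) ∈ W₀ → Realises u v (dist ∞ W₀ (u , v))
      initial {u} {v} e∈ = cases (∈-++⁻ (map (λ v → (v , v) , 0) V) e∈)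
        where
        X = dist ∞ W₀ (u , v)
        owned : List ⟦ WEdge ⟧
        owned = filterᵇ (λ e → member (proj₁ e) B) W
        loop : ∃[ w ] w ∈ V × ((u , v) , X) ≡ ((w , w) , 0) → Realises u v X
        loop (w , w∈ , eq) = let (w′ , w≡) = ∈-V⁻ w∈ in
          w′ , w′ , 0ℚ , 0 , trans (cong (proj₁ ∘ proj₁) eq) w≡ , trans (cong (proj₂ ∘ proj₁) eq) w≡ , [] , ≐-0 , cong proj₂ eq
        step : ∃[ e ] e ∈ owned × ((u , v) , X) ≡ (proj₁ e , proj₂ e * q) → Realises u v X
        step (e , e∈ , eq) =
          let (e∈W , t) = ∈-filterᵇ⁻ (λ e → member (proj₁ e) B) W e∈
              (a , b , l , ab , e≡) = ∈-W⁻ e∈W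
          in a , b , l , wt a b , trans (cong (proj₁ ∘ proj₁) eq) (cong (proj₁ ∘ proj₁) e≡) ,
             trans (cong (proj₂ ∘ proj₁) eq) (cong (proj₂ ∘ proj₁) e≡) ,
             edge (∈-listSet⁺ {B = B} (subst (_∈ B) (cong proj₁ e≡) (member⇒∈ B t))) ab , ι-wt ab ,
             trans (cong proj₂ eq) (cong (λ e → proj₂ e * q) e≡)
        cases : ((u , v) , X) ∈ map (λ v → (v , v) , 0) V ⊎ ((u , v) , X) ∈ map (λ e → proj₁ e , proj₂ e * q) owned → Realises u v X
        cases (inj₁ e∈) = loop (∈-map⁻ (λ v → (v , v) , 0) e∈)
        cases (inj₂ e∈) = step (∈-map⁻ (λ e → proj₁ e , proj₂ e * q) e∈)

      initial-sound : ∀ {u v} → u ∈ V → v ∈ V → dist ∞ W₀ (u , v) < ∞ → Realises u v (dist ∞ W₀ (u , v))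
      initial-sound {u} {v} _ _ lt = cases (dist-attained ∞ W₀ (u , v))
        where
        cases : dist ∞ W₀ (u , v) ≡ ∞ ⊎ ((u , v) , dist ∞ W₀ (u , v)) ∈ W₀ → Realises u v (dist ∞ W₀ (u , v))
        cases (inj₁ eq) = ⊥-elim (<⇒≢ lt eq)
        cases (inj₂ e∈) = initial e∈

      -- Each edge of the path is one use of the triangle inequality at its end v; the empty path is
      -- covered by the zero entries of `weights`.
      path-≤ : ∀ {u v L} → Path G (listSet n B) u v L → ∃[ X ] X ≐ L × dist ∞ (shortest ∞ V W₀) (key u v) ≤ X * q
      path-≤ {u} [] = 0 , ≐-0 , ≤-trans (shortest-≤ W₀ (∈-V⁺ u) (∈-V⁺ u))
        (dist-≤ W₀ (∈-++⁺ˡ (∈-map⁺ (λ v → (v , v) , 0) (∈-V⁺ u))))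
      path-≤ {u} {w} (cons {v = v} {l = l} {L = L} e∈ e p) =
        let (X , X≐ , le) = path-≤ p in
        wt u v + X , ≐-+ {wt u v} {X} {l} {L} (ι-wt e) X≐ ,
        ≤-trans (shortest-triangle W₀ (∈-V⁺ v) (∈-V⁺ u) (∈-V⁺ w))
          (≤-trans (+-mono-≤ (≤-trans (shortest-≤ W₀ (∈-V⁺ u) (∈-V⁺ v)) (dist-≤ W₀ (∈-++⁺ʳ (map (λ v → (v , v) , 0) V)
            (∈-map⁺ (λ e → proj₁ e , proj₂ e * q)
              (∈-filterᵇ⁺ (λ e → member (proj₁ e) B) (∈-W⁺ e) (∈⇒member (∈-listSet⁻ {B = B} e∈))))))) le)
            (≤-reflexive (sym (*-distribʳ-+ q (wt u v) X))))

    connected-complete : ∀ {s t L} → Path G (listSet n B) s t L → L ℚ.≤ d → T (connected V W B (key s t) (den d) (num d * Q))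
    connected-complete {L = L} p L≤d = let (X , X≐ , le) = path-≤ p in ≤⇒≤ᵇ (≤-trans le (fits⁺ 0≤d {X} {L} X≐ L≤d))

    connected-sound : ∀ {s t} → T (connected V W B (key s t) (den d) (num d * Q)) → Satisfies G (listSet n B) (request s t d)
    connected-sound {s} {t} c = finish (shortest-sound W₀ (λ {u} {v} → initial-sound {u} {v}) (∈-V⁺ s) (∈-V⁺ t) (s≤s le))
      where
      open Realised Realises realises-+
      δ = dist ∞ (shortest ∞ V W₀) (key s t)
      le : δ ≤ τ
      le = ≤ᵇ⇒≤ δ τ c
      finish : Realises (toℕ s) (toℕ t) δ → Satisfies G (listSet n B) (request s t d)
      finish (u , v , L , Y , s≡ , t≡ , p , Y≐ , δ≡) =
        subst₂ (λ u v → Satisfies G (listSet n B) (request u v d)) (sym (Fin.toℕ-injective s≡)) (sym (Fin.toℕ-injective t≡))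
          (L , p , fits⁻ 0≤d {Y} {L} Y≐ (subst (_≤ τ) δ≡ le))

  -- Executions of the program follow `bought`

  bought-serve : ∀ B (s t : Fin n) d → reply ((plan (rawGraph G) , B) , rawRequest (request s t d)) ≡
    serve (V , (W , (Q , (H , hs)))) B (toℕ s) (toℕ t) (den d) (num d * Q)
  bought-serve B s t d = reply-serve {V = V} {W} {Q} {H} {hs} B s t d plan-parts

  private
    cases : ∀ (P : List (ℕ × ℕ) → Set) B (r : Request n) → P B → (∀ P₁ → P (buy P₁ W B)) →
      (∀ P₁ P₂ → P (buy P₂ W (buy P₁ W B))) → P (reply ((plan (rawGraph G) , B) , rawRequest r))
    cases P B (request s t d) p p₁ p₂ = subst P (sym (bought-serve B s t d))
      (serve-cases P V W Q H hs B (toℕ s) (toℕ t) (den d) (num d * Q) (λ _ → p) (λ _ _ → p₁ _) (λ _ _ → p₂ _ _))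

  bought-edges : ∀ rs {k} → k ∈ bought G rs → ∃[ y ] (k , y) ∈ W
  bought-edges (r ∷ rs) = cases (λ B′ → ∀ {k} → k ∈ B′ → ∃[ y ] (k , y) ∈ W) (bought G rs) r (bought-edges rs)
    (λ P₁ k∈ → proj₁ (∈-buy⁻ P₁ W (bought G rs) k∈)) (λ P₁ P₂ k∈ → proj₁ (∈-buy⁻ P₂ W (buy P₁ W (bought G rs)) k∈))

  bought-grows : ∀ r rs {k} → k ∈ bought G rs → k ∈ bought G (r ∷ rs)
  bought-grows r rs {k} k∈ = cases (k ∈_) (bought G rs) r k∈ k∈₁
    (λ P₁ P₂ → ∈-buy⁺ P₂ W (buy P₁ W (bought G rs)) (proj₂ (bought-edges rs k∈)) (inj₁ (k∈₁ P₁)))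
    where
    k∈₁ : ∀ P₁ → k ∈ buy P₁ W (bought G rs)
    k∈₁ P₁ = ∈-buy⁺ P₁ W (bought G rs) (proj₂ (bought-edges rs k∈)) (inj₁ k∈)

  bought-size : ∀ rs → ∥_∥ {list Key} (bought G rs) ≤ ∥_∥ {list WEdge} W
  bought-size [] = 1≤size (enc (list WEdge) W)
  bought-size (r ∷ rs) = cases (λ B′ → ∥_∥ {list Key} B′ ≤ ∥_∥ {list WEdge} W) (bought G rs) r (bought-size rs)
    (λ P₁ → buy-size P₁ (bought G rs)) (λ P₁ P₂ → buy-size P₂ (buy P₁ W (bought G rs)))
    where
    keys-size : ∀ es → ∥_∥ {list Key} (map proj₁ es) ≤ ∥_∥ {list WEdge} es
    keys-size []       = ≤-refl
    keys-size ((k , y) ∷ es) = s≤s (+-mono-≤ (≤-trans (m≤m+n _ (∥_∥ {nat} y)) (n≤1+n _)) (keys-size es))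
    buy-size : ∀ P B → ∥_∥ {list Key} (buy P W B) ≤ ∥_∥ {list WEdge} W
    buy-size P B = ≤-trans (keys-size (filterᵇ (λ e → member (proj₁ e) B ∨ P (proj₁ e)) W)) (filterᵇ-size {WEdge} (λ e → member (proj₁ e) B ∨ P (proj₁ e)) W)

  -- Only the third register carries information from one round to the next; the other two and the
  -- coin counter are left open.
  State⟨_⟩ : History n → Store 3 × ℕ → Set
  State⟨ rs ⟩ s = ∃[ y ] ∃[ z ] ∃[ i ] s ≡ (y ∷ z ∷ memory (rawGraph G) (bought G rs) ∷ [] , i)

  round-state : ∀ {ρ rs s r es s′ t} → State⟨ rs ⟩ s → Round G ρ s r es s′ t → State⟨ r ∷ rs ⟩ s′ × pairKeys es ≡ bought G (r ∷ rs)
  round-state {ρ} {rs} {r = r} {es} {s′} (y , z , i , refl) R =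
    let (_ , ran , _) = replies G ρ (bought G rs) r {y} {z} {i} ; eq = run-deterministic (Round.run R) ran in
    (_ , _ , _ , eq) , encode-keys-injective _ _ (trans (encode-pairKeys es)
      (trans (sym (Round.outputs R)) (cong (λ s → lookup (proj₁ s) outputᴿ) eq)))

  execution-state : ∀ {ρ rs s E′} → Execution G ρ rs s E′ → State⟨ rs ⟩ s
  execution-state {ρ} (start p) = _ , _ , _ , run-deterministic p (proj₁ (proj₂ (prepares G ρ)))
  execution-state {rs = r ∷ rs} (round ex R) = proj₁ (round-state {rs = rs} {r = r} (execution-state ex) R)

  -- Each reply repeats all earlier purchases, so E′ is determined by the last reply alone.
  execution-edges : ∀ {ρ rs s E′} → Execution G ρ rs s E′ →
    E′ Subset.⊆ E G × (∀ {u v : Fin n} → combine u v Subset.∈ E′ → key u v ∈ bought G rs) × (∀ {u v : Fin n} → key u v ∈ bought G rs → combine u v Subset.∈ E′)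
  execution-edges (start _) = (λ e∈ → ⊥-elim (Subset.∉⊥ e∈)) , (λ e∈ → ⊥-elim (Subset.∉⊥ e∈)) , λ ()
  execution-edges {rs = r ∷ rs} (round {E′ = E′} {es = es} ex R) = sub , sound , complete
    where
    old = execution-edges {rs = rs} ex
    eq : pairKeys es ≡ bought G (r ∷ rs)
    eq = proj₂ (round-state {rs = rs} {r = r} (execution-state ex) R)
    sub : (E′ Subset.∪ edgeSet es) Subset.⊆ E G
    sub e∈ = [ proj₁ old , Round.edges R ]′ (Subset.x∈p∪q⁻ _ _ e∈)
    sound : ∀ {u v : Fin n} → combine u v Subset.∈ (E′ Subset.∪ edgeSet es) → key u v ∈ bought G (r ∷ rs)
    sound {u} {v} e∈ = [ bought-grows r rs ∘ proj₁ (proj₂ old) , new ∘ ∈-edgeSet⁻ es ]′ (Subset.x∈p∪q⁻ _ _ e∈)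
      where
      new : ∃[ u′ ] ∃[ v′ ] combine u v ≡ combine u′ v′ × (u′ , v′) ∈ es → key u v ∈ bought G (r ∷ rs)
      new (u′ , v′ , same , uv∈) = let (u≡ , v≡) = Fin.combine-injective u v u′ v′ same in
        subst (key u v ∈_) eq (subst₂ (λ a b → key a b ∈ pairKeys es) (sym u≡) (sym v≡) (∈-map⁺ (λ (u , v) → key u v) uv∈))
    complete : ∀ {u v : Fin n} → key u v ∈ bought G (r ∷ rs) → combine u v Subset.∈ (E′ Subset.∪ edgeSet es)
    complete {u} {v} k∈ = Subset.x∈p∪q⁺ (inj₂ (∈-edgeSet⁺ es (∈-pairKeys⁻ es (subst (key u v ∈_) (sym eq) k∈))))

  pairsOf : ∀ ks → (∀ {k} → k ∈ ks → ∃[ y ] (k , y) ∈ W) → ∃[ es ] pairKeys es ≡ ks × edgeSet es Subset.⊆ E G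
  pairsOf [] _ = [] , refl , λ e∈ → ⊥-elim (Subset.∉⊥ e∈)
  pairsOf (k ∷ ks) ks⊆ = add (∈-W⁻ (proj₂ (ks⊆ (here refl)))) (pairsOf ks (ks⊆ ∘ there))
    where
    add : ∃[ u ] ∃[ v ] ∃[ l ] len G u v ≡ just l × (k , proj₁ (ks⊆ (here refl))) ≡ (key u v , wt u v) →
          ∃[ es ] pairKeys es ≡ ks × edgeSet es Subset.⊆ E G → ∃[ es ] pairKeys es ≡ k ∷ ks × edgeSet es Subset.⊆ E G
    add (u , v , l , uv , eq) (es , keys , sub) = (u , v) ∷ es , cong₂ _∷_ (sym (cong proj₁ eq)) keys , sub′
      where
      sub′ : edgeSet ((u , v) ∷ es) Subset.⊆ E G
      sub′ e∈ = [ (λ e∈₁ → subst (Subset._∈ E G) (sym (Subset.x∈⁅y⁆⇒x≡y _ e∈₁)) (∈-E G uv)) , sub ]′ (Subset.x∈p∪q⁻ _ _ e∈)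

  plan-size : ∥_∥ {Plan} (plan (rawGraph G)) ≤ ⟦ space startᵖ ⟧ₚ (size (encodeGraph G))
  plan-size = ≤-trans (≤-trans (m≤m+n (∥_∥ {Plan} (plan (rawGraph G))) 1) (n≤1+n _))
    (subst (λ g → ∥_∥ {Memory} (plan (rawGraph G) , []) ≤ ⟦ space startᵖ ⟧ₚ (size g)) (encode-rawGraph G) (bound startᵖ (rawGraph G)))

  weights-size : ∥_∥ {list WEdge} W ≤ ∥_∥ {Plan} (plan (rawGraph G))
  weights-size = component-size plan-parts

  -- The two copies of `space startᵖ` bound the plan and the purchases, which are no larger than the
  -- edge list inside the plan. The 2 counts the nodes joining plan, purchases and request.
  stepTime : Poly
  stepTime = (con 11 ⊞ time replyᵖ) ⊚ (con 2 ⊞ space startᵖ ⊞ space startᵖ ⊞ 𝕏)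

  responds : ∀ {ρ rs s E′} r → Execution G ρ rs s E′ →
    ∃[ es ] ∃[ s′ ] ∃[ t ] Round G ρ s r es s′ t × t ≤ ⟦ stepTime ⟧ₚ (inputSize G (r ∷ rs))
  responds {ρ} {rs} {s} r ex = respond (execution-state ex) (pairsOf (bought G (r ∷ rs)) (bought-edges (r ∷ rs)))
    where
    N = inputSize G (r ∷ rs)
    S = ⟦ space startᵖ ⟧ₚ N
    plan≤ : ∥_∥ {Plan} (plan (rawGraph G)) ≤ S
    plan≤ = ≤-trans plan-size (poly-mono (space startᵖ) (m≤m+n _ _))
    sizes : 1 + (size (memory (rawGraph G) (bought G rs)) + size (encodeRequest r)) ≤ 2 + S + S + N
    sizes = +-mono-≤ {2 + (∥_∥ {Plan} (plan (rawGraph G)) + ∥_∥ {list Key} (bought G rs))} {2 + S + S}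
      (s≤s (s≤s (+-mono-≤ plan≤ (≤-trans (bought-size rs) (≤-trans weights-size plan≤)))))
      (≤-trans (m≤m+n (size (encodeRequest r)) _) (m≤n+m _ (size (encodeGraph G))))
    respond : State⟨ rs ⟩ s → ∃[ es ] pairKeys es ≡ bought G (r ∷ rs) × edgeSet es Subset.⊆ E G →
      ∃[ es ] ∃[ s′ ] ∃[ t ] Round G ρ s r es s′ t × t ≤ ⟦ stepTime ⟧ₚ N
    respond (y , z , i , s≡) (es , keys , sub) =
      let (t , ran , t≤) = replies G ρ (bought G rs) r {y} {z} {i} in
      es , s′ i , t , record
        { run = subst (λ s → Run ρ (OnlineAlgorithm.step spanner) (proj₁ s [ valueᴿ ]≔ encodeRequest r , proj₂ s) (s′ i) t) (sym s≡) ran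
        ; outputs = outputs ; edges = sub } ,
      ≤-trans t≤ (poly-≤-∘ (con 11 ⊞ time replyᵖ) (con 2 ⊞ space startᵖ ⊞ space startᵖ ⊞ 𝕏) {input} {N} sizes)
      where
      input : ℕ
      input = 1 + (size (memory (rawGraph G) (bought G rs)) + size (encodeRequest r))
      s′ : ℕ → Store 3 × ℕ
      s′ i = enc (list Key) (bought G (r ∷ rs)) ∷ enc (list Key) (bought G (r ∷ rs)) ∷ memory (rawGraph G) (bought G (r ∷ rs)) ∷ [] , i
      outputs : enc (list Key) (bought G (r ∷ rs)) ≡ encodeEdges es
      outputs = trans (cong (enc (list Key)) (sym keys)) (encode-pairKeys es)

  -- Feasibility and cost

  module Solution (qm : Quasimetric G) where

    module Answer (s t : Fin n) {d : ℚ} (0≤d : 0ℚ ℚ.≤ d) (B : List (ℕ × ℕ))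
                  (hits : ∀ {τ} → τ ∈ H → Greedy.Thick V H τ → ∃[ h ] h ∈ hs × T (hit H τ h)) where

      q τ : ℕ
      q = den d
      τ = num d * Q

      M core : List ℕ
      M    = mids V H (key s t) q τ
      core = toℕ s ∷ toℕ t ∷ M

      B₁ B₂ : List (ℕ × ℕ)
      B₁ = buy (toHubs hs (toℕ s) (toℕ t)) W B
      B₂ = buy (inside core) W B₁

      private
        Route : Set
        Route = ∃[ v ] ∃[ l ] ∃[ m ] len G s v ≡ just l × len G v t ≡ just m × toℕ v ∈ hs × (wt s v + wt v t) * q ≤ τ

        route-satisfies : Route → Satisfies G (listSet n B₁) (request s t d)
        route-satisfies (v , l , m , sv , vt , v∈ , le) =
          l ℚ.+ m , path-++ (edge (∈-listSet⁺ {B = B₁} out) sv) (edge (∈-listSet⁺ {B = B₁} into) vt) ,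
          fits⁻ 0≤d {wt s v + wt v t} {l ℚ.+ m} (≐-+ {wt s v} {wt v t} {l} {m} (ι-wt sv) (ι-wt vt)) le
          where
          out : key s v ∈ B₁
          out = ∈-buy⁺ (toHubs hs (toℕ s) (toℕ t)) W B (∈-W⁺ sv) (inj₂ (from T-∨ (inj₁ (from T-∧ (==-refl (toℕ s) , ∈⇒element v∈)))))
          into : key v t ∈ B₁
          into = ∈-buy⁺ (toHubs hs (toℕ s) (toℕ t)) W B (∈-W⁺ vt) (inj₂ (from (T-∨ {(toℕ v == toℕ s) ∧ element (toℕ t) hs}) (inj₂ (from T-∧ (==-refl (toℕ t) , ∈⇒element v∈)))))

        eligible : ⟦ Hop ⟧ → Bool
        eligible h = (proj₁ h ==² key s t) ∧ (proj₂ (proj₂ h) * q ≤ᵇ τ)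

        near-eligible : ∀ {y} → T (near H (key s t) q τ y) →
          ∃[ v ] ∃[ l ] ∃[ m ] len G s v ≡ just l × len G v t ≡ just m × y ≡ toℕ v ×
          (key s t , (toℕ v , wt s v + wt v t)) ∈ filterᵇ eligible H
        near-eligible tn = let (v , l , m , sv , vt , y≡ , le) = near⁻ tn in
          v , l , m , sv , vt , y≡ , ∈-filterᵇ⁺ eligible (∈-H⁺ sv vt) (from T-∧ (==²-refl (key s t) , ≤⇒≤ᵇ le))

        -- The longest eligible path of two edges is a candidate with the same middle vertices as the request.
        thick-route : length V < length M * length M * length M → Route
        thick-route N<m³ =
          let (v , v∈M)   = nonempty M 0<m
              (_ , tn)    = ∈-filterᵇ⁻ (near H (key s t) q τ) V v∈M
              (_ , _ , _ , _ , _ , _ , h∈) = near-eligible tn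
              (σ , σ∈ , σ≥) = maximal (proj₂ ∘ proj₂) (filterᵇ eligible H) h∈
              (σ∈H , σ-eligible) = ∈-filterᵇ⁻ eligible H σ∈
              (tk , tz) = to (T-∧ {proj₁ σ ==² key s t}) σ-eligible
          in finish σ σ∈H σ≥ (==²⇒≡ {proj₁ σ} {key s t} tk) (≤ᵇ⇒≤ _ _ tz)
          where
          0<m : 0 < length M
          0<m = n≢0⇒n>0 λ eq → <⇒≱ N<m³ (≤-trans (≤-reflexive (cong (λ m → m * m * m) eq)) z≤n)
          finish : ∀ σ → σ ∈ H → (∀ {h} → h ∈ filterᵇ eligible H → proj₂ (proj₂ h) ≤ proj₂ (proj₂ σ)) →
                   proj₁ σ ≡ key s t → proj₂ (proj₂ σ) * q ≤ τ → Route
          finish σ@(_ , (_ , z)) σ∈ σ≥ refl zq≤ = through-hub (hits σ∈ thick-σ)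
            where
            imp : ∀ y → T (near H (key s t) q τ y) → T (hit H σ y)
            imp y tn = let (v , l , m , sv , vt , y≡ , h∈) = near-eligible tn in
              subst (T ∘ hit H σ) (sym y≡) (near⁺ sv vt (≤-trans (≤-reflexive (*-identityʳ _)) (σ≥ h∈)))
            m≤ : length M ≤ length (filterᵇ (hit H σ) V)
            m≤ = length-filterᵇ-mono (near H (key s t) q τ) (hit H σ) V imp
            thick-σ : Greedy.Thick V H σ
            thick-σ = ≤ᵇ-not λ le → <⇒≱ N<m³ (≤-trans (*-mono-≤ (*-mono-≤ m≤ m≤) m≤) le)
            through-hub : ∃[ h ] h ∈ hs × T (hit H σ h) → Route
            through-hub (h , h∈ , th) = let (v , l , m , sv , vt , h≡ , le) = near⁻ th in
              v , l , m , sv , vt , subst (_∈ hs) h≡ h∈ ,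
              ≤-trans (*-monoˡ-≤ q (≤-trans (≤-reflexive (sym (*-identityʳ (wt s v + wt v t)))) le)) zq≤

      connected₁ : Bool
      connected₁ = connected V W B₁ (key s t) q τ

      -- Were M thick, a hub would lie in it, and the two edges through that hub, already in B₁,
      -- would satisfy the request, contrary to the test.
      thin : ¬ T connected₁ → length M * length M * length M ≤ n
      thin ¬c = ≤-trans (≮⇒≥ λ N<m³ →
          let (L , p , L≤d) = route-satisfies (thick-route N<m³) in ¬c (Connected.connected-complete B₁ 0≤d p L≤d))
        (≤-reflexive length-V)

      module _ {F : EdgeSet n} where

        -- Shortcuts of the two halves of the walk form a path s → u → t of two edges that is no
        -- longer than the walk, hence u is in M unless it is an endpoint.
        in-core : ∀ {u L₁ L₂} → Path G F s u L₁ → Path G F u t L₂ → L₁ ℚ.+ L₂ ℚ.≤ d → toℕ u ∈ core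
        in-core {u} p p′ le = go (u Fin.≟ s) (u Fin.≟ t)
          where
          go : Dec (u ≡ s) → Dec (u ≡ t) → toℕ u ∈ core
          go (yes u≡s) _         = here (cong toℕ u≡s)
          go _         (yes u≡t) = there (here (cong toℕ u≡t))
          go (no u≢s)  (no u≢t)  =
            let (l , su , l≤) = shortcut qm p (u≢s ∘ sym) ; (m , ut , m≤) = shortcut qm p′ u≢t in
            there (there (∈-filterᵇ⁺ (near H (key s t) q τ) (∈-V⁺ u) (near⁺ su ut
              (fits⁺ 0≤d {wt s u + wt u t} {l ℚ.+ m} (≐-+ {wt s u} {wt u t} {l} {m} (ι-wt su) (ι-wt ut))
                (ℚ.≤-trans (ℚ.+-mono-≤ l≤ m≤) le)))))

        New : Set
        New = Σ[ a ∈ Fin n ] Σ[ b ∈ Fin n ] combine a b Subset.∈ F × ¬ (key a b ∈ B₁) × key a b ∈ B₂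

        -- Follows the walk of F from s. The first edge outside B₁ has both ends on the walk, thus
        -- in the core, and is bought with the clique. If there is none, the rest of the walk lies
        -- in B₁.
        new-or-old : ∀ {u L₁ L₂} → Path G F s u L₁ → Path G F u t L₂ → L₁ ℚ.+ L₂ ℚ.≤ d →
                     New ⊎ Path G (listSet n B₁) u t L₂
        new-or-old p [] le = inj₂ []
        new-or-old {u} {L₁} p p′@(cons {v = v} {l = l} {L = L} e∈ e rest) le = decide (member (key u v) B₁) refl
          where
          le′ : L₁ ℚ.+ l ℚ.+ L ℚ.≤ d
          le′ = ℚ.≤-trans (ℚ.≤-reflexive (ℚ.+-assoc L₁ l L)) le
          p₁ : Path G F s v (L₁ ℚ.+ l)
          p₁ = path-++ p (edge e∈ e)
          extend : key u v ∈ B₁ → New ⊎ Path G (listSet n B₁) v t L → New ⊎ Path G (listSet n B₁) u t (l ℚ.+ L)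
          extend k∈ (inj₁ new) = inj₁ new
          extend k∈ (inj₂ old) = inj₂ (cons (∈-listSet⁺ {B = B₁} k∈) e old)
          decide : ∀ b → member (key u v) B₁ ≡ b → New ⊎ Path G (listSet n B₁) u t (l ℚ.+ L)
          decide true  eq = extend (member⇒∈ B₁ (from T-≡ eq)) (new-or-old p₁ rest le′)
          decide false eq = inj₁ (u , v , e∈ , (λ k∈ → subst T eq (∈⇒member k∈)) ,
            ∈-buy⁺ (inside core) W B₁ (∈-W⁺ e) (inj₂ (from T-∧ (∈⇒element (in-core p p′ le) , ∈⇒element (in-core p₁ rest le′)))))

        new-edge : ¬ T connected₁ → Satisfies G F (request s t d) → New
        new-edge ¬c (L , p , L≤d) = decide (new-or-old [] p (ℚ.≤-trans (ℚ.≤-reflexive (ℚ.+-identityˡ L)) L≤d))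
          where
          decide : New ⊎ Path G (listSet n B₁) s t L → New
          decide (inj₁ new) = new
          decide (inj₂ old) = ⊥-elim (¬c (Connected.connected-complete B₁ 0≤d old L≤d))

      -- The core contains s and t, so the clique includes the edge s → t, which is a shortcut of
      -- the admissible walk.
      direct : ∀ {F} → s ≢ t → Satisfies G F (request s t d) → Satisfies G (listSet n B₂) (request s t d)
      direct s≢t (L , p , L≤d) = let (l , st , l≤) = shortcut qm p s≢t in
        l , edge (∈-listSet⁺ {B = B₂} (∈-buy⁺ (inside core) W B₁ (∈-W⁺ st)
          (inj₂ (from T-∧ (∈⇒element {M = core} (here refl) , ∈⇒element {M = core} (there (here refl))))))) st , ℚ.≤-trans l≤ L≤d

      data Outcome : List (ℕ × ℕ) → Set where
        trivial  : s ≡ t → Outcome B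
        via-hubs : s ≢ t → T connected₁ → Outcome B₁
        clique   : s ≢ t → ¬ T connected₁ → Outcome B₂

      outcome : Outcome (serve (V , (W , (Q , (H , hs)))) B (toℕ s) (toℕ t) q τ)
      outcome = serve-cases Outcome V W Q H hs B (toℕ s) (toℕ t) q τ
        (λ eq → trivial (Fin.toℕ-injective (==⇒≡ {toℕ s} {toℕ t} eq)))
        (λ neq c → via-hubs (λ { refl → neq (==-refl (toℕ s)) }) c)
        (λ neq ¬c → clique (λ { refl → neq (==-refl (toℕ s)) }) ¬c)

    target-nonneg : ∀ {s t d F} → Satisfies G F (request s t d) → 0ℚ ℚ.≤ d
    target-nonneg (L , p , L≤d) = ℚ.≤-trans (path-nonneg p) L≤d

    satisfies-mono : ∀ {F F′} r → F Subset.⊆ F′ → Satisfies G F r → Satisfies G F′ r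
    satisfies-mono (request s t d) F⊆ (L , p , L≤d) = L , path-mono F⊆ p , L≤d

    module _ (hits : ∀ {τ} → τ ∈ H → Greedy.Thick V H τ → ∃[ h ] h ∈ hs × T (hit H τ h)) where

      bought-satisfies : ∀ rs → All (Admissible G) rs → All (Satisfies G (listSet n (bought G rs))) rs
      bought-satisfies []       []         = []
      bought-satisfies (r@(request s t d) ∷ rs) (ok ∷ oks) =
        subst (λ B → Satisfies G (listSet n B) r) (sym (bought-serve (bought G rs) s t d)) (new outcome) ∷ All.map (λ {r′} → satisfies-mono r′ (listSet-mono (bought-grows r rs))) (bought-satisfies rs oks)
        where
        open Answer s t (target-nonneg ok) (bought G rs) hits
        new : ∀ {B′} → Outcome B′ → Satisfies G (listSet n B′) r
        new (trivial s≡t)    = subst (λ t → Satisfies G _ (request s t d)) s≡t (0ℚ , [] , target-nonneg ok)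
        new (via-hubs _ c)   = Connected.connected-sound B₁ (target-nonneg ok) c
        new (clique s≢t _)   = direct s≢t ok

      -- F plays the role of OPT, and K is the price of one clique: 2 + m vertices, for m middle
      -- vertices and the two endpoints.
      module Charge (F : EdgeSet n) (K : ℕ) (K-bound : ∀ m → m * m * m ≤ n → (2 + m) * (2 + m) ≤ K) where

        hubEdgesAt : Fin (n * n) → List (ℕ × ℕ)
        hubEdgesAt e = map (toℕ (proj₁ (remQuot {n} n e)) ,_) hs ++ map (_, toℕ (proj₂ (remQuot {n} n e))) hs

        -- The hub edges are charged to the edges of F at the endpoints of the requests.
        hubEdges : List (ℕ × ℕ)
        hubEdges = concatMap hubEdgesAt (elements F)

        length-hubEdges : length hubEdges ≤ Subset.∣ F ∣ * (length hs + length hs)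
        length-hubEdges = ≤-trans (length-concat (length hs + length hs) (map hubEdgesAt (elements F))
            (All.map⁺ (All.tabulate λ {e} _ → ≤-reflexive (trans (List.length-++ (map (toℕ (proj₁ (remQuot {n} n e)) ,_) hs))
              (cong₂ _+_ (List.length-map _ hs) (List.length-map _ hs))))))
          (≤-reflexive (cong (_* (length hs + length hs)) (trans (List.length-map hubEdgesAt (elements F)) (length-elements F))))

        ∈-hubEdgesˡ : ∀ {u v : Fin n} {h} → combine u v Subset.∈ F → h ∈ hs → (toℕ u , h) ∈ hubEdges
        ∈-hubEdgesˡ {u} {v} {h} e∈ h∈ = ∈-concatMap⁺ _ (lose (∈-elements e∈)
          (∈-++⁺ˡ (subst (λ w → (toℕ u , h) ∈ map (toℕ w ,_) hs) (sym (cong proj₁ (Fin.remQuot-combine {n} u v))) (∈-map⁺ (toℕ u ,_) h∈))))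

        ∈-hubEdgesʳ : ∀ {u v : Fin n} {h} → combine u v Subset.∈ F → h ∈ hs → (h , toℕ v) ∈ hubEdges
        ∈-hubEdgesʳ {u} {v} {h} e∈ h∈ = ∈-concatMap⁺ _ (lose (∈-elements e∈)
          (∈-++⁺ʳ (map (toℕ (proj₁ (remQuot {n} n (combine u v))) ,_) hs)
            (subst (λ w → (h , toℕ v) ∈ map (_, toℕ w) hs) (sym (cong proj₂ (Fin.remQuot-combine {n} u v))) (∈-map⁺ (_, toℕ v) h∈))))

        -- As s ≢ t, the walk in F has a first edge leaving s and a last edge entering t. These pay
        -- for the hub edges at s and t, for all requests at once.
        toHubs⇒hubEdges : ∀ {s t d k} → s ≢ t → Satisfies G F (request s t d) → T (toHubs hs (toℕ s) (toℕ t) k) → k ∈ hubEdges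
        toHubs⇒hubEdges {s} {t} {d} {k} s≢t (L , p , _) th = [ outward , inward ]′ (to (T-∨ {(proj₁ k == toℕ s) ∧ element (proj₂ k) hs}) th)
          where
          outward : T ((proj₁ k == toℕ s) ∧ element (proj₂ k) hs) → k ∈ hubEdges
          outward c = let (a , b) = to (T-∧ {proj₁ k == toℕ s}) c in
            subst (λ u → (u , proj₂ k) ∈ hubEdges) (sym (==⇒≡ {proj₁ k} a)) (∈-hubEdgesˡ (proj₂ (first-edge p s≢t)) (element⇒∈ hs b))
          inward : T ((proj₂ k == toℕ t) ∧ element (proj₁ k) hs) → k ∈ hubEdges
          inward c = let (a , b) = to (T-∧ {proj₂ k == toℕ t}) c in
            subst (λ v → (proj₁ k , v) ∈ hubEdges) (sym (==⇒≡ {proj₂ k} a)) (∈-hubEdgesʳ (proj₂ (last-edge p s≢t)) (element⇒∈ hs b))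

        shared : List (ℕ × ℕ) → ℕ
        shared B = Subset.∣ F Subset.∩ listSet n B ∣

        -- Amortisation with the potential `shared`: C lists the clique purchases, and K of them are
        -- allowed for each edge of F that has been bought.
        Paid : List (ℕ × ℕ) → Set
        Paid B = ∃[ C ] length C ≤ K * shared B × (∀ {k} → k ∈ B → k ∈ hubEdges ⊎ k ∈ C)

        ∩-mono : ∀ {S S′ : EdgeSet n} → S Subset.⊆ S′ → (F Subset.∩ S) Subset.⊆ (F Subset.∩ S′)
        ∩-mono {S} {S′} S⊆ e∈ = let (a , b) = Subset.x∈p∩q⁻ F S e∈ in Subset.x∈p∩q⁺ (a , S⊆ b)

        paid : ∀ rs → All (Admissible G) rs → All (Satisfies G F) rs → Paid (bought G rs)
        paid []       []         []         = [] , z≤n , λ ()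
        paid (r@(request s t d) ∷ rs) (ok ∷ oks) (sat ∷ sats) = subst Paid (sym (bought-serve (bought G rs) s t d)) (pay outcome (paid rs oks sats))
          where
          B₀ = bought G rs
          open Answer s t (target-nonneg ok) (bought G rs) hits
          B₀⊆B₁ : ∀ {k} → k ∈ B₀ → k ∈ B₁
          B₀⊆B₁ k∈ = ∈-buy⁺ (toHubs hs (toℕ s) (toℕ t)) W B₀ (proj₂ (bought-edges rs k∈)) (inj₁ k∈)
          B₁⊆B₂ : ∀ {k} → k ∈ B₁ → k ∈ B₂
          B₁⊆B₂ k∈ = ∈-buy⁺ (inside core) W B₁ (proj₂ (proj₁ (∈-buy⁻ (toHubs hs (toℕ s) (toℕ t)) W B₀ k∈))) (inj₁ k∈)
          module _ (s≢t : s ≢ t) (C : List (ℕ × ℕ)) (cover : ∀ {k} → k ∈ B₀ → k ∈ hubEdges ⊎ k ∈ C) where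
            cover₁ : ∀ {k} → k ∈ B₁ → k ∈ hubEdges ⊎ k ∈ C
            cover₁ k∈ = [ cover , inj₁ ∘ toHubs⇒hubEdges s≢t sat ]′ (proj₂ (∈-buy⁻ (toHubs hs (toℕ s) (toℕ t)) W B₀ k∈))
            cover₂ : ∀ {k} → k ∈ B₂ → k ∈ hubEdges ⊎ k ∈ cartesianProduct core core ++ C
            cover₂ {k} k∈ = combineCovers (proj₂ (∈-buy⁻ (inside core) W B₁ k∈))
              where
              combineCovers : k ∈ B₁ ⊎ T (inside core k) → k ∈ hubEdges ⊎ k ∈ cartesianProduct core core ++ C
              combineCovers (inj₁ k∈₁) = [ inj₁ , inj₂ ∘ ∈-++⁺ʳ (cartesianProduct core core) ]′ (cover₁ k∈₁)
              combineCovers (inj₂ c)   = inj₂ (∈-++⁺ˡ (inside⁻ core k c))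
          pay : ∀ {B′} → Outcome B′ → Paid B₀ → Paid B′
          pay (trivial _)      old            = old
          pay (via-hubs s≢t _) (C , le , cov) = C ,
            ≤-trans le (*-monoʳ-≤ K (Subset.p⊆q⇒∣p∣≤∣q∣ (∩-mono (listSet-mono B₀⊆B₁)))) , cover₁ s≢t C cov
          pay (clique s≢t ¬c)  (C , le , cov) = cartesianProduct core core ++ C , (begin
              length (cartesianProduct core core ++ C)  ≡⟨ List.length-++ (cartesianProduct core core) ⟩
              length (cartesianProduct core core) + length C  ≡⟨ cong (_+ length C) (length-cartesianProduct core core) ⟩
              length core * length core + length C  ≤⟨ +-mono-≤ (K-bound (length M) (thin ¬c)) le ⟩
              K + K * shared B₀  ≡⟨ *-suc K (shared B₀) ⟨
              -- The clique contains an edge of F missing from B₁, and so from B₀: the potential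
              -- rises by at least one and covers the price K.
              K * suc (shared B₀)  ≤⟨ *-monoʳ-≤ K (more (new-edge ¬c sat)) ⟩
              K * shared B₂  ∎) , cover₂ s≢t C cov
            where
            open ≤-Reasoning
            more : New {F} → shared B₀ < shared B₂
            more (a , b , ab∈F , ∉B₁ , ∈B₂) = Subset.p⊂q⇒∣p∣<∣q∣
              (∩-mono (listSet-mono (B₁⊆B₂ ∘ B₀⊆B₁)) , combine a b , Subset.x∈p∩q⁺ (ab∈F , ∈-listSet⁺ {B = B₂} ∈B₂) ,
               λ ab∈ → ∉B₁ (B₀⊆B₁ (∈-listSet⁻ {B = B₀} (proj₂ (Subset.x∈p∩q⁻ F (listSet n B₀) ab∈)))))

        cost-bound : ∀ {rs} {E′ : EdgeSet n} → All (Admissible G) rs → All (Satisfies G F) rs →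
          (∀ {u v : Fin n} → combine u v Subset.∈ E′ → key u v ∈ bought G rs) →
          Subset.∣ E′ ∣ ≤ Subset.∣ F ∣ * (length hs + length hs + K)
        cost-bound {rs} {E′} oks sats E′⊆ = charge (paid rs oks sats)
          where
          open ≤-Reasoning
          charge : Paid (bought G rs) → Subset.∣ E′ ∣ ≤ Subset.∣ F ∣ * (length hs + length hs + K)
          charge (C , le , cov) = begin
            Subset.∣ E′ ∣  ≤⟨ ∣∣≤length E′ (edgeKey {n}) edgeKey-injective (hubEdges ++ C) covers ⟩
            length (hubEdges ++ C)  ≡⟨ List.length-++ hubEdges ⟩
            length hubEdges + length C  ≤⟨ +-mono-≤ length-hubEdges (≤-trans le (*-monoʳ-≤ K (Subset.∣p∩q∣≤∣p∣ F (listSet n (bought G rs))))) ⟩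
            Subset.∣ F ∣ * (length hs + length hs) + K * Subset.∣ F ∣ ≡⟨ cong (Subset.∣ F ∣ * (length hs + length hs) +_) (*-comm K Subset.∣ F ∣) ⟩
            Subset.∣ F ∣ * (length hs + length hs) + Subset.∣ F ∣ * K ≡⟨ *-distribˡ-+ Subset.∣ F ∣ (length hs + length hs) K ⟨
            Subset.∣ F ∣ * (length hs + length hs + K)  ∎
            where
            covers : ∀ {e} → e Subset.∈ E′ → edgeKey {n} e ∈ hubEdges ++ C
            covers {e} e∈ = [ ∈-++⁺ˡ , ∈-++⁺ʳ hubEdges ]′ (cov (E′⊆ (subst (Subset._∈ E′) (sym (Fin.combine-remQuot {n} n e)) e∈)))

    private
      inhabited : Request n → NonZero n
      inhabited r = Fin.nonZeroIndex (Request.source r)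

    correct : ∀ {ρ rs s E′} → All (Admissible G) rs → Execution G ρ rs s E′ →
      Feasible G rs E′ × (∀ OPT → IsOPT G rs OPT → Within 22 1 n Subset.∣ E′ ∣ OPT)
    -- Before the first request n may be 0, which `Ratio` excludes, but nothing has been bought.
    -- Later, a request supplies a vertex.
    correct {rs = []} {E′ = E′} [] ex =
      let (E′⊆E , sound , _) = execution-edges ex in
      (E′⊆E , []) , λ OPT _ → subst (λ c → Within 22 1 n c OPT) (sym (n≤0⇒n≡0 (∣∣≤length E′ (edgeKey {n}) edgeKey-injective [] λ {e} e∈ →
        sound (subst (Subset._∈ E′) (sym (Fin.combine-remQuot {n} n e)) e∈)))) z≤n
    correct {rs = rs@(r ∷ _)} {E′ = E′} oks ex =
      (E′⊆E , All.map (λ {r} → satisfies-mono r X⊆E′) (bought-satisfies hits rs oks)) , ratio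
      where
      instance
        n-nonZero : NonZero n
        n-nonZero = inhabited r
        V-nonZero : NonZero (length V)
        V-nonZero = subst NonZero (sym length-V) n-nonZero
      root = cubeRoot (n * n)
      β = proj₁ root
      open Ratio n β (proj₁ (proj₂ root)) (proj₂ (proj₂ root))
      instance
        β-nonZero : NonZero β
        β-nonZero = >-nonZero 1≤B
      ℓ = ⌈log₂ n ⌉
      open Greedy.Analysis V H β (subst (λ N → N * N ≤ β * β * β) (sym length-V) (proj₁ (proj₂ root)))
      hits : ∀ {τ} → τ ∈ H → Greedy.Thick V H τ → ∃[ h ] h ∈ hs × T (hit H τ h)
      hits {τ} τ∈ th = subst (λ hs → ∃[ h ] h ∈ hs × T (hit H τ h)) (sym hs≡hubs) (hubs-hit τ∈ th)
      E′⊆E = proj₁ (execution-edges ex)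
      X⊆E′ : listSet n (bought G rs) Subset.⊆ E′
      X⊆E′ {e} e∈ = subst (Subset._∈ E′) (Fin.combine-remQuot {n} n e) (proj₂ (proj₂ (execution-edges ex))
        (∈-listSet⁻ {B = bought G rs} (subst (Subset._∈ listSet n (bought G rs)) (sym (Fin.combine-remQuot {n} n e)) e∈)))
      -- At most n^4 sets are used up by 4 ℓ halvings of β greedy steps each and one last step,
      -- which gives 4 ℓ β + 1 hubs.
      hops≤ : length H ≤ 2 ^ (4 * ℓ)
      hops≤ = begin
        length H  ≤⟨ length-H ⟩
        n * n * (n * n)  ≡⟨ lemma n ⟩
        n ^ 4  ≤⟨ ^-monoˡ-≤ 4 (n≤2^⌈log₂n⌉ n) ⟩
        (2 ^ ℓ) ^ 4  ≡⟨ ^-*-assoc 2 ℓ 4 ⟩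
        2 ^ (ℓ * 4)  ≡⟨ cong (2 ^_) (*-comm ℓ 4) ⟩
        2 ^ (4 * ℓ)  ∎
        where
        open ≤-Reasoning
        lemma : ∀ n → n * n * (n * n) ≡ n * (n * (n * (n * 1)))
        lemma = solve-∀
      ratio : ∀ OPT → IsOPT G rs OPT → Within 22 1 n Subset.∣ E′ ∣ OPT
      ratio OPT ((F , (_ , sats) , refl) , _) = within {length hs} {Subset.∣ E′ ∣} {Subset.∣ F ∣} (subst (λ hs → length hs ≤ suc (4 * ℓ * β)) (sym hs≡hubs) (hubs-length (4 * ℓ) hops≤))
        (Charge.cost-bound hits F (9 * β) thin-bound oks sats (proj₁ (proj₂ (execution-edges ex))))

-- One monomial has to serve preparation and rounds alike, so it is taken to bound the sum of the
-- two polynomials.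
spanner-polynomialTime : PolynomialTime spanner
spanner-polynomialTime = c , e , λ {n} G qm ρ →
  (let (t , ran , t≤) = prepares G ρ in _ , t , ran ,
     ≤-trans t≤ (≤-trans (poly-mono (time startᵖ ⊞ con 2) (m≤m+n (size (encodeGraph G)) 0))
       (≤-trans (m≤m+n _ _) (le (inputSize G []))))) ,
  λ rs r _ ex → let (es , s′ , t , R , t≤) = Scaled.responds G r ex in
    es , s′ , t , R , ≤-trans t≤ (≤-trans (m≤n+m (⟦ stepTime ⟧ₚ (inputSize G (r ∷ rs))) _) (le (inputSize G (r ∷ rs))))
  where
  stepTime : Poly
  stepTime = (con 11 ⊞ time replyᵖ) ⊚ (con 2 ⊞ space startᵖ ⊞ space startᵖ ⊞ 𝕏)
  bnd = poly-≤-monomial ((time startᵖ ⊞ con 2) ⊞ stepTime)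
  c = proj₁ bnd
  e = proj₁ (proj₂ bnd)
  le = proj₂ (proj₂ bnd)

-- No coin is flipped, so an empty list of bad outcomes of zero coins is a witness for every a. The
-- guarantee at an earlier time is `correct` for the truncated history.
spanner-competitive : ∀ a → Competitive a spanner
spanner-competitive a = 22 , 1 , λ G qm rs oks → 0 , [] , z≤n , λ ρ _ j ex → Scaled.Solution.correct G qm (All.drop⁺ j oks) ex

theorem3 : (a : ℕ) → ∃[ A ] PolynomialTime A × Competitive a A
theorem3 a = spanner , spanner-polynomialTime , spanner-competitive a
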